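{- (i) Let $n\ge 1$ be an integer, let $m$ be an integer with $\gcd(n,m)=1$, and let $q=e^{2\pi m i/n}$. If $3\mid n$, then $$\sum_{k=0}^{n-1}q^{k}C_k^q=\frac12\left(i\sqrt{3}\left(\frac{m}{3}\right)-1\right).$$ (ii) Moreover, for any prime $p$ and any integer $a>0$, $$\sum_{k=0}^{p^a-1}C_k\equiv\frac12\left(3\left(\frac{p^a}{3}\right)-1\right)\pmod p.$$
   Context: The Gaussian $q$-binomial coefficient $\binom{n}{k}_q$ is the polynomial in $q$ given by $\binom{n}{k}_q=\dfrac{(q;q)_n}{(q;q)_k(q;q)_{n-k}}$ if $0\le k\le n$ and $\binom{n}{k}_q=0$ otherwise, where $(z;q)_n=\prod_{j=0}^{n-1}(1-zq^j)$. The $q$-Catalan number is the polynomial $C_n^q=\dfrac{1}{[n+1]_q}\binom{2n}{n}_q=\binom{2n}{n}_q-q\binom{2n}{n+1}_q$, where $[n+1]_q=\dfrac{1-q^{n+1}}{1-q}$; at a root of unity it denotes the value of this polynomial. $C_n=\frac{1}{n+1}\binom{2n}{n}$ is the ordinary Catalan number. $\left(\frac{\cdot}{3}\right)$ is the Legendre symbol modulo $3$ (equal to $0,1,-1$ for arguments $\equiv 0,1,2\pmod 3$). The congruence modulo $p$ is between rational numbers with denominator prime to $p$ (the right-hand side is an integer when $p\ne 3$, and equals $-1/2$ when $p=3$). -}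

module Defs where

open import Level using (Level; _⊔_) renaming (suc to lsuc)
open import Algebra.Bundles using (CommutativeRing)
open import Algebra.Properties.Ring using (-0#≈0#; -‿distribˡ-*; -‿distribʳ-*; -‿+-comm)
open import Data.Fin.Base using (Fin; toℕ)
open import Data.Integer.Base as ℤ using (ℤ; +_; -[1+_]; 0ℤ; 1ℤ; -1ℤ)
open import Data.Integer.DivMod using (_%ℕ_)
open import Data.Integer.Divisibility as ℤ∣ using ()
open import Data.List.Base using (List; []; _∷_; [_]; length; map; drop)
open import Data.Nat.Base as ℕ using (ℕ; zero; suc; NonZero; _!)
open import Data.Nat.Combinatorics using (_C_)
open import Data.Nat.Coprimality using (Coprime)
open import Data.Nat.Properties using (_≤?_; _!≢0)
open import Data.Product.Base using (_×_; _,_; ∃-syntax; proj₁)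
open import Data.Rational.Base as ℚ using (ℚ; ↥_; ↧ₙ_)
open import Data.Rational.Properties using (+-0-monoid)
open import Data.Sum.Base using (_⊎_; inj₂)
open import Relation.Binary.Core using (Rel)
open import Relation.Binary.Definitions using (Cotransitive)
open import Relation.Binary.Structures using (IsStrictPartialOrder)
open import Relation.Nullary.Decidable.Core using (yes; no)
open import Relation.Nullary.Negation.Core using (¬_)

import Algebra.Properties.Monoid.Sum as MonoidSum
import Algebra.Properties.Semiring.Exp as SemiringExp
import Algebra.Properties.Semiring.Mult as SemiringMult
import Algebra.Solver.Ring.NaturalCoefficients.Default as Solver

------------------------------------------------------------------------
-- Integer polynomials

-- Coefficients are listed from degree 0 upwards.  Trailing zeros are allowed,
-- so two lists may denote the same polynomial.
Poly : Set
Poly = List ℤ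

infixl 6 _+ₚ_ _-ₚ_
infixl 7 _*ₚ_ _·ₚ_ _÷ₚ_

_+ₚ_ : Poly → Poly → Poly
[]       +ₚ g        = g
f        +ₚ []       = f
(a ∷ f)  +ₚ (b ∷ g)  = (a ℤ.+ b) ∷ (f +ₚ g)

_·ₚ_ : ℤ → Poly → Poly
c ·ₚ f = map (c ℤ.*_) f

_-ₚ_ : Poly → Poly → Poly
f -ₚ g = f +ₚ (-1ℤ ·ₚ g)

_*ₚ_ : Poly → Poly → Poly
[]      *ₚ g = []
(a ∷ f) *ₚ g = (a ·ₚ g) +ₚ (0ℤ ∷ (f *ₚ g))

1ₚ : Poly
1ₚ = [ 1ℤ ]

X^_ : ℕ → Poly
X^ zero  = 1ₚ
X^ suc n = 0ℤ ∷ (X^ n)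

constant : Poly → ℤ
constant []      = 0ℤ
constant (c ∷ _) = c

-- The first N coefficients of the power series f / g, where g has constant
-- term 1: with c the constant term of f, f = c·g + X·f′ and f/g = c + X·(f′/g).
series÷ : ℕ → Poly → Poly → Poly
series÷ zero    f g = []
series÷ (suc N) f g = constant f ∷ series÷ N (drop 1 (f -ₚ constant f ·ₚ g)) g

-- If g has constant term 1 and divides f, then the quotient has degree below
-- length f, so this is the exact quotient.  It is only used for such f and g.
_÷ₚ_ : Poly → Poly → Poly
f ÷ₚ g = series÷ (length f) f g

-- (z;q)ₙ, with q the indeterminate and z a polynomial in q.
qPochhammer : Poly → ℕ → Poly
qPochhammer z zero    = 1ₚ
qPochhammer z (suc n) = qPochhammer z n *ₚ (1ₚ -ₚ z *ₚ (X^ n))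

gaussianBinomial : ℕ → ℕ → Poly
gaussianBinomial n k with k ≤? n
... | yes _ = qq n ÷ₚ (qq k *ₚ qq (n ℕ.∸ k))
  where
  qq : ℕ → Poly
  qq = qPochhammer (X^ 1)
... | no  _ = []

qNumber : ℕ → Poly
qNumber n = (1ₚ -ₚ (X^ n)) ÷ₚ (1ₚ -ₚ (X^ 1))

qCatalan : ℕ → Poly
qCatalan n = gaussianBinomial (2 ℕ.* n) n ÷ₚ qNumber (suc n)

------------------------------------------------------------------------
-- Arithmetic

catalan : ℕ → ℚ
catalan n = + ((2 ℕ.* n) C n) ℚ./ suc n

-- The Legendre symbol modulo 3.
legendre₃ : ℤ → ℤ
legendre₃ m with m %ℕ 3
... | 0 = 0ℤ
... | 1 = 1ℤ
... | _ = -1ℤ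

-- Congruence modulo p of rationals with denominators prime to p; numerators
-- and denominators are those of the reduced fractions.
infix 4 _≡_[modℚ_]
_≡_[modℚ_] : ℚ → ℚ → ℕ → Set
x ≡ y [modℚ p ] =
  Coprime (↧ₙ x) p × Coprime (↧ₙ y) p × (+ p) ℤ∣.∣ (↥ (x ℚ.- y))

open MonoidSum +-0-monoid public using () renaming (sum to sumℚ)

------------------------------------------------------------------------
-- Real numbers

-- A Cauchy complete Archimedean ordered field.  Classically this determines ℝ
-- up to isomorphism.  The axioms are those that also hold of the constructive
-- reals, so the order is cotransitive rather than trichotomous, and only
-- elements apart from zero are required to be invertible.
record RealField c ℓ₁ ℓ₂ : Set (lsuc (c ⊔ ℓ₁ ⊔ ℓ₂)) where
  field
    commutativeRing : CommutativeRing c ℓ₁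
  open CommutativeRing commutativeRing public
  open SemiringMult (CommutativeRing.semiring commutativeRing) public
    using () renaming (_×_ to _×ᵣ_)

  fromℕ : ℕ → Carrier
  fromℕ n = n ×ᵣ 1#

  infix 4 _<_
  field
    _<_                  : Rel Carrier ℓ₂
    isStrictPartialOrder : IsStrictPartialOrder _≈_ _<_
    <-cotransitive       : Cotransitive _<_
    <-tight              : ∀ {x y} → ¬ (x < y) → ¬ (y < x) → x ≈ y
    0<1                  : 0# < 1#
    +-monoˡ-<            : ∀ {x y} z → x < y → x + z < y + z
    *-pos                : ∀ {x y} → 0# < x → 0# < y → 0# < x * y
    inverse              : ∀ x → x < 0# ⊎ 0# < x → ∃[ y ] x * y ≈ 1#
    archimedean          : ∀ x → ∃[ n ] x < fromℕ n

  open IsStrictPartialOrder isStrictPartialOrder public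
    using (<-resp-≈; <-respˡ-≈; <-respʳ-≈)
    renaming (trans to <-trans; irrefl to <-irrefl)

  infix 4 ∣_∣<_
  ∣_∣<_ : Carrier → Carrier → Set ℓ₂
  ∣ x ∣< ε = (- ε < x) × (x < ε)

  IsCauchy : (ℕ → Carrier) → Set (c ⊔ ℓ₂)
  IsCauchy u = ∀ ε → 0# < ε →
    ∃[ N ] (∀ m n → N ℕ.≤ m → N ℕ.≤ n → ∣ u m - u n ∣< ε)

  _⟶_ : (ℕ → Carrier) → Carrier → Set (c ⊔ ℓ₂)
  u ⟶ l = ∀ ε → 0# < ε → ∃[ N ] (∀ n → N ℕ.≤ n → ∣ u n - l ∣< ε)

  field
    complete : ∀ u → IsCauchy u → ∃[ l ] (u ⟶ l)

  fromℕ-pos : ∀ n → 0# < fromℕ (suc n)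
  fromℕ-pos zero    = <-respʳ-≈ (sym (+-identityʳ 1#)) 0<1
  fromℕ-pos (suc n) = <-trans (fromℕ-pos n)
    (<-respˡ-≈ (+-identityˡ _) (+-monoˡ-< (fromℕ (suc n)) 0<1))

  1/_ : (n : ℕ) → .{{NonZero n}} → Carrier
  1/ suc n = proj₁ (inverse (fromℕ (suc n)) (inj₂ (fromℕ-pos n)))

  fromℤ : ℤ → Carrier
  fromℤ (+ n)    = fromℕ n
  fromℤ -[1+ n ] = - fromℕ (suc n)

  IsSqrt : Carrier → Carrier → Set (ℓ₁ ⊔ ℓ₂)
  IsSqrt x s = ¬ (s < 0#) × s * s ≈ x

------------------------------------------------------------------------
-- Complex numbers

module Complex {c ℓ₁ ℓ₂} (R : RealField c ℓ₁ ℓ₂) where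

  private
    module ℝ = RealField R
    open ℝ using () renaming (Carrier to ℝ)
    module S = Solver ℝ.commutativeSemiring
    open S using () renaming (_:+_ to _⊕_; _:*_ to _⊗_; _:=_ to _⊜_)

  infix 5 _+i_
  record ℂ : Set c where
    constructor _+i_
    field
      re im : ℝ
  open ℂ public

  infix 4 _≈_ _,≈_
  record _≈_ (z w : ℂ) : Set ℓ₁ where
    constructor _,≈_
    field
      re≈ : re z ℝ.≈ re w
      im≈ : im z ℝ.≈ im w

  infix  8 -_
  infixl 7 _*_
  infixl 6 _+_ _-_

  _+_ _*_ : ℂ → ℂ → ℂ
  (a +i b) + (a′ +i b′) = a ℝ.+ a′ +i b ℝ.+ b′
  (a +i b) * (a′ +i b′) =
    a ℝ.* a′ ℝ.+ ℝ.- (b ℝ.* b′) +i a ℝ.* b′ ℝ.+ b ℝ.* a′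

  -_ : ℂ → ℂ
  - (a +i b) = ℝ.- a +i ℝ.- b

  _-_ : ℂ → ℂ → ℂ
  z - w = z + (- w)

  real : ℝ → ℂ
  real a = a +i ℝ.0#

  0# 1# 𝕚 : ℂ
  0# = real ℝ.0#
  1# = real ℝ.1#
  𝕚  = ℝ.0# +i ℝ.1#

  ℂ-commutativeRing : CommutativeRing c ℓ₁
  ℂ-commutativeRing = record
    { Carrier = ℂ ; _≈_ = _≈_ ; _+_ = _+_ ; _*_ = _*_ ; -_ = -_
    ; 0# = 0# ; 1# = 1#
    ; isCommutativeRing = record
      { isRing = record
        { +-isAbelianGroup = record
          { isGroup = record
            { isMonoid = record
              { isSemigroup = record
                { isMagma = record
                  { isEquivalence = record
                    { refl  = ℝ.refl ,≈ ℝ.refl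
                    ; sym   = λ { (p ,≈ q) → ℝ.sym p ,≈ ℝ.sym q }
                    ; trans = λ { (p ,≈ q) (p′ ,≈ q′) → ℝ.trans p p′ ,≈ ℝ.trans q q′ }
                    }
                  ; ∙-cong = λ { (p ,≈ q) (p′ ,≈ q′) → ℝ.+-cong p p′ ,≈ ℝ.+-cong q q′ }
                  }
                ; assoc = λ _ _ _ → ℝ.+-assoc _ _ _ ,≈ ℝ.+-assoc _ _ _
                }
              ; identity = (λ _ → ℝ.+-identityˡ _ ,≈ ℝ.+-identityˡ _)
                         , (λ _ → ℝ.+-identityʳ _ ,≈ ℝ.+-identityʳ _)
              }
            ; inverse = (λ _ → ℝ.-‿inverseˡ _ ,≈ ℝ.-‿inverseˡ _)
                      , (λ _ → ℝ.-‿inverseʳ _ ,≈ ℝ.-‿inverseʳ _)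
            ; ⁻¹-cong = λ { (p ,≈ q) → ℝ.-‿cong p ,≈ ℝ.-‿cong q }
            }
          ; comm = λ _ _ → ℝ.+-comm _ _ ,≈ ℝ.+-comm _ _
          }
        ; *-cong = λ { (p ,≈ q) (p′ ,≈ q′) →
              ℝ.+-cong (ℝ.*-cong p p′) (ℝ.-‿cong (ℝ.*-cong q q′))
            ,≈ ℝ.+-cong (ℝ.*-cong p q′) (ℝ.*-cong q p′) }
        ; *-assoc = *-assoc
        ; *-identity = *-identityˡ , (λ z → ≈-trans (*-comm z 1#) (*-identityˡ z))
        ; distrib = distribˡ , λ x y z →
            ≈-trans (*-comm (y + z) x)
              (≈-trans (distribˡ x y z) (+-cong (*-comm x y) (*-comm x z)))
        }
      ; *-comm = *-comm
      }
    }
    where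
    ≈-trans : ∀ {x y z} → x ≈ y → y ≈ z → x ≈ z
    ≈-trans (p ,≈ q) (p′ ,≈ q′) = ℝ.trans p p′ ,≈ ℝ.trans q q′

    +-cong : ∀ {x y u v} → x ≈ y → u ≈ v → x + u ≈ y + v
    +-cong (p ,≈ q) (p′ ,≈ q′) = ℝ.+-cong p p′ ,≈ ℝ.+-cong q q′

    *-comm : ∀ x y → x * y ≈ y * x
    *-comm (a +i b) (d +i e) =
        ℝ.+-cong (ℝ.*-comm a d) (ℝ.-‿cong (ℝ.*-comm b e))
      ,≈ ℝ.trans (ℝ.+-comm _ _) (ℝ.+-cong (ℝ.*-comm b d) (ℝ.*-comm a e))

    *-identityˡ : ∀ x → 1# * x ≈ x
    *-identityˡ (a +i b) =
        ℝ.trans (ℝ.+-cong (ℝ.*-identityˡ a)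
                  (ℝ.trans (ℝ.-‿cong (ℝ.zeroˡ b)) (-0#≈0# ℝ.ring)))
          (ℝ.+-identityʳ a)
      ,≈ ℝ.trans (ℝ.+-cong (ℝ.*-identityˡ b) (ℝ.zeroˡ a)) (ℝ.+-identityʳ b)

    -- The solver knows no subtraction, so negations are moved onto variables.
    neg : ∀ b x → ℝ.- (b ℝ.* x) ℝ.≈ ℝ.- b ℝ.* x
    neg = -‿distribˡ-* ℝ.ring

    *-assoc : ∀ x y z → (x * y) * z ≈ x * (y * z)
    *-assoc (a +i b) (d +i e) (f +i g) =
        ℝ.trans
          (ℝ.+-cong
            (ℝ.*-congʳ (ℝ.+-congˡ (neg b e)))
            (ℝ.trans (neg _ g) (ℝ.*-congʳ (ℝ.trans (ℝ.sym (-‿+-comm ℝ.ring _ _))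
              (ℝ.+-cong (-‿distribʳ-* ℝ.ring a e) (neg b d))))))
          (ℝ.trans
            (S.solve 7 (λ a b′ d e e′ f g →
                (a ⊗ d ⊕ b′ ⊗ e) ⊗ f ⊕ (a ⊗ e′ ⊕ b′ ⊗ d) ⊗ g
              ⊜ a ⊗ (d ⊗ f ⊕ e′ ⊗ g) ⊕ b′ ⊗ (d ⊗ g ⊕ e ⊗ f))
              ℝ.refl a (ℝ.- b) d e (ℝ.- e) f g)
            (ℝ.sym (ℝ.+-cong (ℝ.*-congˡ (ℝ.+-congˡ (neg e g))) (neg b _))))
      ,≈ ℝ.trans (ℝ.+-congʳ (ℝ.*-congʳ (ℝ.+-congˡ (neg b e))))
          (ℝ.trans
            (S.solve 7 (λ a b b′ d e f g →
                (a ⊗ d ⊕ b′ ⊗ e) ⊗ g ⊕ (a ⊗ e ⊕ b ⊗ d) ⊗ f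
              ⊜ a ⊗ (d ⊗ g ⊕ e ⊗ f) ⊕ (b ⊗ (d ⊗ f) ⊕ (b′ ⊗ e) ⊗ g))
              ℝ.refl a b (ℝ.- b) d e f g)
            (ℝ.+-congˡ (ℝ.sym (ℝ.trans (ℝ.distribˡ b _ _) (ℝ.+-congˡ
              (ℝ.trans (ℝ.sym (-‿distribʳ-* ℝ.ring b _))
                (ℝ.trans (neg b _) (ℝ.sym (ℝ.*-assoc _ e g)))))))))

    distribˡ : ∀ x y z → x * (y + z) ≈ x * y + x * z
    distribˡ (a +i b) (d +i e) (f +i g) =
        ℝ.trans (ℝ.+-congˡ (neg b _))
          (ℝ.trans
            (S.solve 6 (λ a b′ d e f g →
                a ⊗ (d ⊕ f) ⊕ b′ ⊗ (e ⊕ g)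
              ⊜ (a ⊗ d ⊕ b′ ⊗ e) ⊕ (a ⊗ f ⊕ b′ ⊗ g))
              ℝ.refl a (ℝ.- b) d e f g)
            (ℝ.sym (ℝ.+-cong (ℝ.+-congˡ (neg b e)) (ℝ.+-congˡ (neg b g)))))
      ,≈ S.solve 6 (λ a b d e f g →
            a ⊗ (e ⊕ g) ⊕ b ⊗ (d ⊕ f)
          ⊜ (a ⊗ e ⊕ b ⊗ d) ⊕ (a ⊗ g ⊕ b ⊗ f))
          ℝ.refl a b d e f g

  open SemiringExp (CommutativeRing.semiring ℂ-commutativeRing) public using (_^_)
  open MonoidSum (CommutativeRing.+-monoid ℂ-commutativeRing) public using (sum)

  fromℤ : ℤ → ℂ
  fromℤ m = real (ℝ.fromℤ m)

  eval : Poly → ℂ → ℂ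
  eval []      z = 0#
  eval (c ∷ f) z = fromℤ c + z * eval f z

  _⟶_ : (ℕ → ℂ) → ℂ → Set (c ⊔ ℓ₂)
  u ⟶ l = ((λ n → re (u n)) ℝ.⟶ re l) × ((λ n → im (u n)) ℝ.⟶ im l)

  expPartialSum : ℂ → ℕ → ℂ
  expPartialSum z N =
    sum {N} (λ k → real (ℝ.1/_ (toℕ k !) {{toℕ k !≢0}}) * z ^ toℕ k)

  -- IsExp z w means e^z = w.
  IsExp : ℂ → ℂ → Set (c ⊔ ℓ₂)
  IsExp z w = expPartialSum z ⟶ w

  -- IsSin x s means sin x = s, the sine being the imaginary part of e^{ix}.
  IsSin : ℝ → ℝ → Set (c ⊔ ℓ₁ ⊔ ℓ₂)
  IsSin x s = ∃[ w ] (IsExp (𝕚 * real x) w × im w ℝ.≈ s)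

  -- π is the least positive zero of the sine.  That there is no zero below it
  -- is put positively, as sin > 0 on the open interval from 0 to π.
  IsPi : ℝ → Set (c ⊔ ℓ₁ ⊔ ℓ₂)
  IsPi π = ℝ.0# ℝ.< π × IsSin π ℝ.0#
         × (∀ x s → ℝ.0# ℝ.< x → x ℝ.< π → IsSin x s → ℝ.0# ℝ.< s)

{-# OPTIONS --safe #-}

-- Put H n j = [2n, n+j]_q, so that C_n^q = H n 0 − q H n 1.  By Pascal's rule and
-- the ratio of neighbouring coefficients, the differences
-- D n j = H n j − q^(2j+1) H n (j+1) satisfy
--   q^j (D (n+1) (j+1) − D n (j+1)) = q^n (H n j − q^(4j+6) H n (j+3)).
-- Weighting j = d, d+3, d+6, … so that the right-hand sides telescope writes
-- Σ_{k<n} q^k H k d as a weighted sum of the q^j D n (j+1).  When H n j vanishes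
-- for 0 < j < n, which happens at a primitive n-th root of unity, and modulo p
-- for q = 1 and n = p^a, at most one term survives.  For (i) it yields q^(n/3).
--
-- It remains to identify roots of unity from π as the least positive zero of
-- the sine.  The addition theorem for exp holds because the error of the
-- product of two partial sums is dominated by the tail of a real exponential
-- series.  The positivity of the sine below π then gives e^(iπ) = −1, makes
-- 1 − q^j cancellable for 0 < j < n, and makes e^(iπ/3) a root of x² − x + 1
-- rather than of x + 1.
module Submission where

open import Defs
open import Data.Fin.Base using (toℕ)
open import Data.Integer.Base using (ℤ; +_; 1ℤ)
open import Data.Integer.GCD using (gcd)
open import Data.Nat.Base as ℕ using (ℕ; NonZero)
open import Data.Nat.Divisibility using (_∣_)
open import Data.Nat.Primality using (Prime)
open import Data.Product.Base using (_×_)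
open import Data.Rational.Base as ℚ using (½; 1ℚ)
open import Relation.Binary.PropositionalEquality.Core using (_≡_)

open import Algebra.Bundles using (CommutativeRing; RawMonoid)
open import Algebra.Solver.Ring.AlmostCommutativeRing using (fromCommutativeRing; _-Raw-AlmostCommutative⟶_)
open import Data.Empty using (⊥; ⊥-elim)
open import Data.Integer.Base as ℤ using (-[1+_]; +[1+_]; 0ℤ; -1ℤ)
open import Data.Integer.DivMod using (_%ℕ_; _/ℕ_; n%ℕd<d; a≡a%ℕn+[a/ℕn]*n)
open import Data.List.Base using ([]; _∷_; length; drop)
open import Data.List.Properties using (length-map)
open import Data.Maybe.Base as Maybe using ()
open import Data.Nat.Base using (zero; suc; _!)
open import Data.Nat.Combinatorics using (_C_; nCk+nC[k+1]≡[n+1]C[k+1])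
open import Data.Nat.Coprimality as Coprimality using (Coprime; 1-coprimeTo; coprime?; coprime-divisor; gcd≡1⇒coprime)
open import Data.Nat.DivMod using (_%_; _/_; m≡m%n+[m/n]*n; m%n<n)
open import Data.Nat.Divisibility using (divides; _∣?_; ∣-refl; ∣-trans; m∣m*n; n∣m*n; ∣m⇒∣m*n)
open import Data.Nat.Divisibility using (∣m+n∣m⇒∣n; *-cancelˡ-∣; *-monoʳ-∣; >⇒∤; ∣1⇒≡1)
open import Data.Nat.GCD using (gcd[m,n]∣n)
open import Data.Nat.Primality using (euclidsLemma; prime?; prime⇒irreducible; prime⇒nonZero)
open import Data.Product.Base using (_,_; ∃-syntax; proj₁; proj₂)
open import Data.Rational.Base using (ℚ; mkℚ; ↥_)
open import Data.Rational.Unnormalised.Base using (mkℚᵘ; *≡*)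
open import Data.Sum.Base using (_⊎_; inj₁; inj₂; [_,_]′)
open import Level using (_⊔_)
open import Relation.Binary.Core using (Rel)
open import Relation.Binary.PropositionalEquality as ≡ using (_≢_)
open import Relation.Nullary using (¬_; yes; no)
open import Relation.Nullary.Decidable using (from-yes)
open import Relation.Nullary.Decidable.Core using (dec⇒maybe)

import Algebra.Definitions.RawMonoid as RawMonoidDefinitions
import Algebra.Properties.Monoid.Sum
import Algebra.Properties.Ring
import Algebra.Properties.Semiring.Exp
import Algebra.Properties.Semiring.Mult
import Algebra.Properties.Semiring.Mult.TCOptimised as Mult′
import Algebra.Solver.Ring
import Data.Integer.Divisibility as ℤ∣ᵤ
import Data.Integer.Divisibility.Signed as ℤ∣
import Data.Integer.Properties as ℤₚ
import Data.Nat.Properties as ℕₚ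
import Data.Nat.Solver as ℕSolver
import Data.Rational.Properties as ℚₚ
import Relation.Binary.Reasoning.Setoid

-- A ring solver with integer coefficients

-- Two obstacles shape the development. The reals are constructive, so no step may divide by 1 - q^j
-- or ask whether it is zero. Primitivity of `q` is therefore phrased as cancellability of 1 - q^j,
-- and the evidence for it is always a strictly positive imaginary part, because a positive norm can
-- be cancelled. Moreover `q` lives in several rings (the variable of a power series ring, a complex
-- number, 1 modulo `p`), so the identities are proved over an arbitrary commutative ring with all
-- denominators cleared.
--
-- The number 3 enters because the recurrence for D links H n j to H n (j+3). The residue of n - d
-- modulo 3 decides whether the index `n`, where H n n = 1, is met by the first coefficient of a
-- term, by its second one, or by none. At q = 1 this residue alone gives the Legendre symbol of
-- p^a; in (i) that of `m` comes from q^(n/3) = e^(2πim/3).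
--
-- The polynomials C_n^q are defined by truncated list division. Their coefficients are found in the
-- power series ring over ℤ, where degree bounds show that the truncation loses nothing.

module IntegerCoefficients {c ℓ} (R : CommutativeRing c ℓ) where
  open CommutativeRing R
  open Algebra.Properties.Ring ring
  open Mult′ semiring using (×-homo-+; ×1-homo-*) renaming (_×_ to _×′_)
  open Relation.Binary.Reasoning.Setoid setoid

  -- The optimised multiple makes `int 1ℤ` reduce to `1#` itself, so `con 1ℤ` in a solver equation
  -- matches `1#` directly.
  int : ℤ → Carrier
  int (+ n)    = n ×′ 1#
  int -[1+ n ] = - (suc n ×′ 1#)

  int-⊖ : ∀ m n → int (m ℤ.⊖ n) ≈ m ×′ 1# - n ×′ 1#
  int-⊖ m zero = sym (trans (+-congˡ -0#≈0#) (+-identityʳ _))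
  int-⊖ zero (suc n) = sym (+-identityˡ _)
  int-⊖ (suc m) (suc n) = begin
    int (suc m ℤ.⊖ suc n)                      ≈⟨ reflexive (≡.cong int (ℤₚ.[1+m]⊖[1+n]≡m⊖n m n)) ⟩
    int (m ℤ.⊖ n)                              ≈⟨ int-⊖ m n ⟩
    m ×′ 1# - n ×′ 1#                            ≈⟨ +-identityˡ _ ⟨
    0# + (m ×′ 1# - n ×′ 1#)                     ≈⟨ +-congʳ (-‿inverseʳ 1#) ⟨
    1# - 1# + (m ×′ 1# - n ×′ 1#)                ≈⟨ +-assoc _ _ _ ⟩
    1# + (- 1# + (m ×′ 1# - n ×′ 1#))            ≈⟨ +-congˡ (+-assoc _ _ _) ⟨
    1# + (- 1# + m ×′ 1# - n ×′ 1#)              ≈⟨ +-congˡ (+-congʳ (+-comm _ _)) ⟩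
    1# + (m ×′ 1# - 1# - n ×′ 1#)                ≈⟨ +-congˡ (+-assoc _ _ _) ⟩
    1# + (m ×′ 1# + (- 1# - n ×′ 1#))            ≈⟨ +-assoc _ _ _ ⟨
    (1# + m ×′ 1#) + (- 1# - n ×′ 1#)            ≈⟨ +-congˡ (-‿+-comm 1# _) ⟩
    (1# + m ×′ 1#) - (1# + n ×′ 1#)              ≈⟨ +-cong (×-homo-+ 1# 1 m) (-‿cong (×-homo-+ 1# 1 n)) ⟨
    suc m ×′ 1# - suc n ×′ 1#                    ∎

  int-+ : ∀ i j → int (i ℤ.+ j) ≈ int i + int j
  int-+ (+ m)    (+ n)    = ×-homo-+ 1# m n
  int-+ (+ m)    -[1+ n ] = int-⊖ m (suc n)
  int-+ -[1+ m ] (+ n)    = trans (int-⊖ n (suc m)) (+-comm _ _)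
  int-+ -[1+ m ] -[1+ n ] = begin
    - (suc (suc (m ℕ.+ n)) ×′ 1#)     ≡⟨ ≡.cong (λ k → - (k ×′ 1#)) (≡.cong suc (ℕₚ.+-suc m n)) ⟨
    - ((suc m ℕ.+ suc n) ×′ 1#)       ≈⟨ -‿cong (×-homo-+ 1# (suc m) (suc n)) ⟩
    - (suc m ×′ 1# + suc n ×′ 1#)      ≈⟨ -‿+-comm _ _ ⟨
    - (suc m ×′ 1#) - (suc n ×′ 1#)    ∎

  int-neg : ∀ i → int (ℤ.- i) ≈ - int i
  int-neg (+ zero)  = sym -0#≈0#
  int-neg +[1+ n ]  = refl
  int-neg -[1+ n ]  = sym (-‿involutive _)

  int-*⁺ : ∀ m j → int (+ m ℤ.* j) ≈ int (+ m) * int j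
  int-*⁺ m (+ n) = trans (reflexive (≡.cong int (≡.sym (ℤₚ.pos-* m n)))) (×1-homo-* m n)
  int-*⁺ m -[1+ n ] = begin
    int (+ m ℤ.* -[1+ n ])         ≡⟨ ≡.cong int (ℤₚ.neg-distribʳ-* (+ m) +[1+ n ]) ⟨
    int (ℤ.- (+ m ℤ.* +[1+ n ]))   ≈⟨ int-neg (+ m ℤ.* +[1+ n ]) ⟩
    - int (+ m ℤ.* +[1+ n ])       ≈⟨ -‿cong (int-*⁺ m +[1+ n ]) ⟩
    - (int (+ m) * int +[1+ n ])   ≈⟨ -‿distribʳ-* _ _ ⟩
    int (+ m) * int -[1+ n ]       ∎

  int-* : ∀ i j → int (i ℤ.* j) ≈ int i * int j
  int-* (+ m) j = int-*⁺ m j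
  int-* -[1+ m ] j = begin
    int (-[1+ m ] ℤ.* j)           ≡⟨ ≡.cong int (ℤₚ.neg-distribˡ-* +[1+ m ] j) ⟨
    int (ℤ.- (+[1+ m ] ℤ.* j))     ≈⟨ int-neg (+[1+ m ] ℤ.* j) ⟩
    - int (+[1+ m ] ℤ.* j)         ≈⟨ -‿cong (int-*⁺ (suc m) j) ⟩
    - (int +[1+ m ] * int j)       ≈⟨ -‿distribˡ-* _ _ ⟩
    int -[1+ m ] * int j           ∎

  private
    morphism : ℤ.+-*-rawRing -Raw-AlmostCommutative⟶ fromCommutativeRing R
    morphism = record
      { ⟦_⟧ = int ; +-homo = int-+ ; *-homo = int-* ; -‿homo = int-neg
      ; 0-homo = refl ; 1-homo = refl }

  open Algebra.Solver.Ring ℤ.+-*-rawRing (fromCommutativeRing R) morphism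
    (λ i j → Maybe.map (λ i≡j → reflexive (≡.cong int i≡j)) (dec⇒maybe (i ℤₚ.≟ j)))
    public using (solve; con; _:+_; _:*_; _:-_; :-_; _:=_)

-- Stated for abstract rings: on the complex numbers the solver would unfold
-- every operation into real and imaginary parts.
module RingIdentities {c ℓ} (R : CommutativeRing c ℓ) where
  open CommutativeRing R
  open IntegerCoefficients R

  0*x-0≈0 : ∀ x → 0# * x - 0# ≈ 0#
  0*x-0≈0 = solve 1 (λ x → con 0ℤ :* x :- con 0ℤ := con 0ℤ) refl

  [x*y]*z≈y*[x*z] : ∀ x y z → (x * y) * z ≈ y * (x * z)
  [x*y]*z≈y*[x*z] = solve 3 (λ x y z → (x :* y) :* z := y :* (x :* z)) refl

  x³+1 : ∀ x → (x + 1#) * (x * x - x + 1#) ≈ x * (x * x) + 1#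
  x³+1 = solve 1 (λ x → (x :+ con 1ℤ) :* (x :* x :- x :+ con 1ℤ) := x :* (x :* x) :+ con 1ℤ) refl

  x²-split : ∀ x → x * x ≈ (x * x - x + 1#) + (x - 1#)
  x²-split = solve 1 (λ x → x :* x := (x :* x :- x :+ con 1ℤ) :+ (x :- con 1ℤ)) refl

  [1-x²]y : ∀ x y → (x - 1#) * ((x + 1#) * y) ≈ - ((1# - x * x) * y)
  [1-x²]y = solve 2 (λ x y →
    (x :- con 1ℤ) :* ((x :+ con 1ℤ) :* y) := :- ((con 1ℤ :- x :* x) :* y)) refl

-- Finite sums over initial segments of the natural numbers

module PartialSums {c ℓ} (R : CommutativeRing c ℓ) where
  open CommutativeRing R
  open IntegerCoefficients R
  open Algebra.Properties.Monoid.Sum +-monoid public using (sum)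
  open Relation.Binary.Reasoning.Setoid setoid

  -- Summands are functions on all of ℕ, so one function serves for every bound; the sum still
  -- unfolds to the `Fin`-indexed sums of the theorem.
  Σ< : ℕ → (ℕ → Carrier) → Carrier
  Σ< n f = sum {n} (λ k → f (toℕ k))

  Σ<-cong : ∀ n {f g} → (∀ k → k ℕ.< n → f k ≈ g k) → Σ< n f ≈ Σ< n g
  Σ<-cong zero    e = refl
  Σ<-cong (suc n) e = +-cong (e 0 (ℕ.s≤s ℕ.z≤n)) (Σ<-cong n (λ k p → e (suc k) (ℕ.s≤s p)))

  Σ<-zero : ∀ n {f} → (∀ k → k ℕ.< n → f k ≈ 0#) → Σ< n f ≈ 0#
  Σ<-zero zero    e = refl
  Σ<-zero (suc n) e = trans (+-cong (e 0 (ℕ.s≤s ℕ.z≤n)) (Σ<-zero n (λ k p → e (suc k) (ℕ.s≤s p))))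
      (+-identityˡ 0#)

  Σ<-last : ∀ n f → Σ< (suc n) f ≈ Σ< n f + f n
  Σ<-last zero    f = +-comm _ _
  Σ<-last (suc n) f = trans (+-congˡ (Σ<-last n (λ k → f (suc k)))) (sym (+-assoc _ _ _))

  Σ<-+ : ∀ n f g → Σ< n (λ k → f k + g k) ≈ Σ< n f + Σ< n g
  Σ<-+ zero    f g = sym (+-identityˡ 0#)
  Σ<-+ (suc n) f g = trans (+-congˡ (Σ<-+ n (λ k → f (suc k)) (λ k → g (suc k))))
    (solve 4 (λ a b s t → a :+ b :+ (s :+ t) := a :+ s :+ (b :+ t)) refl _ _ _ _)

  Σ<-* : ∀ n a f → Σ< n (λ k → a * f k) ≈ a * Σ< n f
  Σ<-* zero    a f = sym (zeroʳ a)
  Σ<-* (suc n) a f = trans (+-congˡ (Σ<-* n a (λ k → f (suc k)))) (sym (distribˡ a _ _))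

-- The telescoping identity for central q-binomial coefficients

j+l+j+l : ∀ j l → j ℕ.+ l ℕ.+ j ℕ.+ l ≡ 2 ℕ.* (j ℕ.+ l)
j+l+j+l = ℕSolver.+-*-Solver.solve 2 (λ j l → j :+ l :+ j :+ l := con 2 :* (j :+ l)) ≡.refl
  where open ℕSolver.+-*-Solver

module QBinomial {ℓ₁ ℓ₂} (R : CommutativeRing ℓ₁ ℓ₂) (q : CommutativeRing.Carrier R) where
  open CommutativeRing R
  open IntegerCoefficients R
  open PartialSums R
  open Algebra.Properties.Ring ring using (x∙y⁻¹≈ε⇒x≈y; x≈y⇒x∙y⁻¹≈ε)
  open Algebra.Properties.Semiring.Exp semiring
  open Relation.Binary.Reasoning.Setoid setoid

  -- Pascal's rule involves no division, so the definition makes sense for any `q` in any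
  -- commutative ring.
  qbinom : ℕ → ℕ → Carrier
  qbinom n       zero    = 1#
  qbinom zero    (suc k) = 0#
  qbinom (suc n) (suc k) = qbinom n k + q ^ suc k * qbinom n (suc k)

  qnum : ℕ → Carrier
  qnum zero    = 0#
  qnum (suc n) = qnum n + q ^ n

  qfact : ℕ → Carrier
  qfact zero    = 1#
  qfact (suc n) = qfact n * (1# - q ^ suc n)

  qnum-closed : ∀ n → (1# - q) * qnum n ≈ 1# - q ^ n
  qnum-closed zero = solve 1 (λ q → (con 1ℤ :- q) :* con 0ℤ := con 1ℤ :- con 1ℤ) refl q
  qnum-closed (suc n) = begin
    (1# - q) * (qnum n + q ^ n)          ≈⟨ distribˡ _ _ _ ⟩
    (1# - q) * qnum n + (1# - q) * q ^ n ≈⟨ +-congʳ (qnum-closed n) ⟩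
    1# - q ^ n + (1# - q) * q ^ n        ≈⟨ solve 2 (λ q x → con 1ℤ :- x :+ (con 1ℤ :- q) :* x := con 1ℤ
        :- q :* x) refl q (q ^ n) ⟩
    1# - q ^ suc n                       ∎

  qnum-suc : ∀ n → qnum (suc n) ≈ 1# + q * qnum n
  qnum-suc zero    = solve 1 (λ q → con 0ℤ :+ con 1ℤ := con 1ℤ :+ q :* con 0ℤ) refl q
  qnum-suc (suc n) = trans (+-congʳ (qnum-suc n))
    (solve 3 (λ q a x → con 1ℤ :+ q :* a :+ q :* x := con 1ℤ :+ q :* (a :+ x)) refl q (qnum n) (q ^ n))

  qbinom-above : ∀ n j → qbinom n (suc (n ℕ.+ j)) ≈ 0#
  qbinom-above zero    j = refl
  qbinom-above (suc n) j = begin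
    qbinom n (suc (n ℕ.+ j)) + x * qbinom n (suc (suc (n ℕ.+ j)))
      ≈⟨ +-cong (qbinom-above n j)
          (*-congˡ (trans (reflexive (≡.cong (λ i → qbinom n (suc i)) (≡.sym (ℕₚ.+-suc n j))))
          (qbinom-above n (suc j)))) ⟩
    0# + x * 0#  ≈⟨ solve 1 (λ x → con 0ℤ :+ x :* con 0ℤ := con 0ℤ) refl x ⟩
    0#           ∎
    where x = q ^ suc (suc (n ℕ.+ j))

  qbinom-> : ∀ {n k} → n ℕ.< k → qbinom n k ≈ 0#
  qbinom-> {n} {suc k} (ℕ.s≤s n≤k) with ℕₚ.m≤n⇒∃[o]m+o≡n n≤k
  ... | j , ≡.refl = qbinom-above n j

  qbinom-refl : ∀ n → qbinom n n ≈ 1#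
  qbinom-refl zero    = refl
  qbinom-refl (suc n) = begin
    qbinom n n + q ^ suc n * qbinom n (suc n) ≈⟨ +-cong (qbinom-refl n)
        (*-congˡ (qbinom-> (ℕₚ.n<1+n n))) ⟩
    1# + q ^ suc n * 0#                       ≈⟨ solve 1 (λ x → con 1ℤ :+ x :* con 0ℤ := con 1ℤ) refl
        (q ^ suc n) ⟩
    1#                                        ∎

  -- Stated with q-numbers instead of powers of `q`, because `qbinom-ratio` reads 0 = 0 at q = 1
  -- while this form still carries the classical ratio of neighbouring binomial coefficients.
  qbinom-step : ∀ k l → qnum (suc k) * qbinom (k ℕ.+ l) (suc k) ≈ qnum l * qbinom (k ℕ.+ l) k
  qbinom-step k zero rewrite ℕₚ.+-identityʳ k =
    trans (*-congˡ (qbinom-> (ℕₚ.n<1+n k))) (trans (zeroʳ _) (sym (zeroˡ _)))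
  qbinom-step zero (suc l) = begin
    qnum 1 * (1# + q ^ 1 * qbinom l 1)
      ≈⟨ solve 3 (λ q m b → m :* (con 1ℤ :+ (q :* con 1ℤ) :* b) := m :+ q :* (m :* b)) refl q (qnum 1)
          (qbinom l 1) ⟩
    qnum 1 + q * (qnum 1 * qbinom l 1)
      ≈⟨ +-congˡ (*-congˡ (qbinom-step 0 l)) ⟩
    (0# + 1#) + q * (qnum l * 1#)
      ≈⟨ solve 2 (λ q m → (con 0ℤ :+ con 1ℤ) :+ q :* (m :* con 1ℤ) := (con 1ℤ :+ q :* m) :* con 1ℤ) refl
          q (qnum l) ⟩
    (1# + q * qnum l) * 1#
      ≈⟨ *-congʳ (qnum-suc l) ⟨
    qnum (suc l) * 1# ∎
  qbinom-step (suc k) (suc l) = begin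
    (m + x) * (b + q * x * c)
      ≈⟨ solve 5 (λ m x q b c → (m :+ x) :* (b :+ q :* x :* c) := (m :+ x) :* b :+ q :* x :*
          ((m :+ x) :* c)) refl m x q b c ⟩
    (m + x) * b + q * x * ((m + x) * c)
      ≈⟨ +-congˡ (*-congˡ step₁) ⟩
    (m + x) * b + q * x * (qnum l * b)
      ≈⟨ solve 5 (λ m x q b l → (m :+ x) :* b :+ q :* x :* (l :* b) := m :* b :+ x :*
          ((con 1ℤ :+ q :* l) :* b)) refl m x q b (qnum l) ⟩
    m * b + x * ((1# + q * qnum l) * b)
      ≈⟨ +-cong step₀ (*-congˡ (*-congʳ (sym (qnum-suc l)))) ⟩
    qnum (suc l) * a + x * (qnum (suc l) * b)
      ≈⟨ solve 4 (λ n a x b → n :* a :+ x :* (n :* b) := n :* (a :+ x :* b)) refl (qnum (suc l)) a x b ⟩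
    qnum (suc l) * (a + x * b) ∎
    where
    m = qnum (suc k)
    x = q ^ suc k
    a = qbinom (k ℕ.+ suc l) k
    b = qbinom (k ℕ.+ suc l) (suc k)
    c = qbinom (k ℕ.+ suc l) (suc (suc k))
    step₀ : m * b ≈ qnum (suc l) * a
    step₀ = qbinom-step k (suc l)
    step₁ : (m + x) * c ≈ qnum l * b
    step₁ = ≡.subst (λ i → (m + x) * qbinom i (suc (suc k)) ≈ qnum l * qbinom i (suc k))
      (≡.sym (ℕₚ.+-suc k l)) (qbinom-step (suc k) l)

  qbinom-ratio : ∀ k l →
    (1# - q ^ suc k) * qbinom (k ℕ.+ l) (suc k) ≈ (1# - q ^ l) * qbinom (k ℕ.+ l) k
  qbinom-ratio k l = begin
    (1# - q ^ suc k) * b          ≈⟨ *-congʳ (qnum-closed (suc k)) ⟨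
    (1# - q) * qnum (suc k) * b   ≈⟨ *-assoc _ _ _ ⟩
    (1# - q) * (qnum (suc k) * b) ≈⟨ *-congˡ (qbinom-step k l) ⟩
    (1# - q) * (qnum l * a)       ≈⟨ *-assoc _ _ _ ⟨
    (1# - q) * qnum l * a         ≈⟨ *-congʳ (qnum-closed l) ⟩
    (1# - q ^ l) * a              ∎
    where
    a = qbinom (k ℕ.+ l) k
    b = qbinom (k ℕ.+ l) (suc k)

  -- The quotient of q-factorials with its denominator cleared. The induction moves one factor from
  -- `qfact k` to `qfact l`, keeping k + l fixed.
  qbinom-qfact : ∀ k l → qbinom (k ℕ.+ l) k * (qfact k * qfact l) ≈ qfact (k ℕ.+ l)
  qbinom-qfact zero    l = trans (*-identityˡ _) (*-identityˡ _)
  qbinom-qfact (suc k) l = begin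
    b * (qfact k * (1# - q ^ suc k) * qfact l)
      ≈⟨ solve 4 (λ b u v w → b :* (u :* v :* w) := (v :* b) :* (u :* w)) refl b (qfact k)
          (1# - q ^ suc k) (qfact l) ⟩
    ((1# - q ^ suc k) * b) * (qfact k * qfact l)
      ≈⟨ *-congʳ ratio ⟩
    ((1# - q ^ suc l) * a) * (qfact k * qfact l)
      ≈⟨ solve 4 (λ a u v w → (v :* a) :* (u :* w) := a :* (u :* (w :* v))) refl a (qfact k)
          (1# - q ^ suc l) (qfact l) ⟩
    a * (qfact k * qfact (suc l))
      ≈⟨ qbinom-qfact k (suc l) ⟩
    qfact (k ℕ.+ suc l)
      ≡⟨ ≡.cong qfact (ℕₚ.+-suc k l) ⟩
    qfact (suc k ℕ.+ l) ∎
    where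
    a = qbinom (k ℕ.+ suc l) k
    b = qbinom (suc k ℕ.+ l) (suc k)
    ratio : (1# - q ^ suc k) * b ≈ (1# - q ^ suc l) * a
    ratio = trans (*-congˡ (reflexive (≡.cong (λ i → qbinom i (suc k)) (≡.sym (ℕₚ.+-suc k l)))))
        (qbinom-ratio k (suc l))

  central : ℕ → ℕ → Carrier
  central n j = qbinom (2 ℕ.* n) (n ℕ.+ j)

  central-refl : ∀ n → central n n ≈ 1#
  central-refl n rewrite ℕₚ.+-identityʳ n = qbinom-refl (n ℕ.+ n)

  central-> : ∀ {n j} → n ℕ.< j → central n j ≈ 0#
  central-> {n} {j} n<j rewrite ℕₚ.+-identityʳ n = qbinom-> (ℕₚ.+-monoʳ-< n n<j)

  qCat : ℕ → Carrier
  qCat n = central n 0 - q * central n 1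

  qnum-qCat : ∀ n → qnum (suc n) * qCat n ≈ qbinom (2 ℕ.* n) n
  qnum-qCat n rewrite ℕₚ.+-identityʳ n | ℕₚ.+-comm n 1 = begin
    qnum (suc n) * (a - q * b)
      ≈⟨ solve 4 (λ m a q b → m :* (a :- q :* b) := m :* a :- q :* (m :* b)) refl (qnum (suc n)) a q b ⟩
    qnum (suc n) * a - q * (qnum (suc n) * b)
      ≈⟨ +-cong (*-congʳ (qnum-suc n)) (-‿cong (*-congˡ (qbinom-step n n))) ⟩
    (1# + q * qnum n) * a - q * (qnum n * a)
      ≈⟨ solve 3 (λ q m a → (con 1ℤ :+ q :* m) :* a :- q :* (m :* a) := a) refl q (qnum n) a ⟩
    a ∎
    where
    a = qbinom (n ℕ.+ n) n
    b = qbinom (n ℕ.+ n) (suc n)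

  -- Pascal's rule is used twice, since the upper index grows by two.
  central-pascal : ∀ n j → central (suc n) (suc j) ≈
    central n j + q ^ (n ℕ.+ suc j) * (1# + q) * central n (suc j)
      + q ^ (n ℕ.+ suc j) * q ^ (n ℕ.+ suc j) * (q * q) * central n (suc (suc j))
  central-pascal n j
    rewrite ℕₚ.+-identityʳ n | ℕₚ.+-suc n n | ℕₚ.+-suc n (suc j) | ℕₚ.+-suc n j =
      solve 5 (λ q y a b c → a :+ y :* b :+ q :* y :* (b :+ q :* y :* c)
                 := a :+ y :* (con 1ℤ :+ q) :* b :+ y :* y :* (q :* q) :* c)
        refl q (q ^ suc (n ℕ.+ j)) (qbinom (n ℕ.+ n) (n ℕ.+ j))
        (qbinom (n ℕ.+ n) (suc (n ℕ.+ j))) (qbinom (n ℕ.+ n) (suc (suc (n ℕ.+ j))))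

  -- Multiplying `qbinom-ratio` by `q ^ j` turns q^(n-j) into `q ^ n`. No difference n - j remains,
  -- and the relation holds for every `j`, both sides being zero when j > n.
  central-ratio : ∀ n j →
    (q ^ j - q ^ n * q ^ j * q ^ j * q) * central n (suc j) ≈ (q ^ j - q ^ n) * central n j
  central-ratio n j with ℕₚ.≤-<-connex j n
  ... | inj₂ n<j = trans (trans (*-congˡ (central-> (ℕₚ.m<n⇒m<1+n n<j))) (zeroʳ _))
                         (sym (trans (*-congˡ (central-> n<j)) (zeroʳ _)))
  ... | inj₁ j≤n with ℕₚ.m≤n⇒∃[o]m+o≡n j≤n
  ... | l , ≡.refl = begin
    (x - q ^ n * x * x * q) * b
      ≈⟨ solve 4 (λ q x w b → (x :- w :* x :* x :* q) :* b := x :* ((con 1ℤ :- q :* (w :* x)) :* b)) refl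
          q x (q ^ n) b ⟩
    x * ((1# - q * (q ^ n * x)) * b)
      ≈⟨ *-congˡ (*-congʳ (+-congˡ (-‿cong (*-congˡ (^-homo-* q n j))))) ⟨
    x * ((1# - q ^ suc (n ℕ.+ j)) * b)
      ≈⟨ *-congˡ ratio ⟩
    x * ((1# - q ^ l) * a)
      ≈⟨ solve 3 (λ x y a → x :* ((con 1ℤ :- y) :* a) := (x :- x :* y) :* a) refl x (q ^ l) a ⟩
    (x - x * q ^ l) * a
      ≈⟨ *-congʳ (+-congˡ (-‿cong (^-homo-* q j l))) ⟨
    (x - q ^ n) * a ∎
    where
    x = q ^ j
    a = central n j
    b = central n (suc j)
    ratio : (1# - q ^ suc (n ℕ.+ j)) * b ≈ (1# - q ^ l) * a
    ratio = ≡.subst₂ (λ i k → (1# - q ^ suc (n ℕ.+ j)) * qbinom i k ≈ (1# - q ^ l) * qbinom i (n ℕ.+ j))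
      (j+l+j+l j l) (≡.sym (ℕₚ.+-suc n j)) (qbinom-ratio (n ℕ.+ j) l)

  centralDiff : ℕ → ℕ → Carrier
  centralDiff n j = central n j - q * (q ^ j * q ^ j) * central n (suc j)

  q^4j+6 : ℕ → Carrier
  q^4j+6 j = (q ^ j * q ^ j * q ^ j * q ^ j) * (q * q * q * q * q * q)

  -- The factor q^j avoids negative powers of q.  The two sides differ by multiples
  -- of the relations central-ratio at j, j + 1 and j + 2.
  centralDiff-suc : ∀ n j →
    q ^ j * centralDiff (suc n) (suc j) ≈
      q ^ j * centralDiff n (suc j) + q ^ n * (central n j - q^4j+6 j * central n (3 ℕ.+ j))
  centralDiff-suc n j = begin
    Q * (central (suc n) (suc j) - q * ((q * Q) * (q * Q)) * central (suc n) (suc (suc j)))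
      ≈⟨ *-congˡ (+-cong (trans (central-pascal n j) (+-cong (+-congˡ (*-congʳ (*-congʳ e₁)))
          (*-congʳ (*-congʳ (*-cong e₁ e₁)))))
           (-‿cong (*-congˡ (trans (central-pascal n (suc j)) (+-cong (+-congˡ (*-congʳ (*-congʳ e₂)))
               (*-congʳ (*-congʳ (*-cong e₂ e₂)))))))) ⟩
    Q * ((y₀ + N * (q * Q) * (1# + q) * y₁ + N * (q * Q) * (N * (q * Q)) * (q * q) * y₂)
      - q * ((q * Q) * (q * Q)) * (y₁ + N * (q * (q * Q)) * (1# + q) * y₂ + N * (q * (q * Q)) *
          (N * (q * (q * Q))) * (q * q) * y₃))
      ≈⟨ solve 7 (λ q Q N y₀ y₁ y₂ y₃ → let
             Q₁ = q :* Q
             Q₂ = q :* Q₁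
             rel = λ X b a → (X :- N :* X :* X :* q) :* b :- (X :- N) :* a in
           Q :* ((y₀ :+ N :* Q₁ :* (con 1ℤ :+ q) :* y₁ :+ N :* Q₁ :* (N :* Q₁) :* (q :* q) :* y₂)
             :- q :* (Q₁ :* Q₁) :* (y₁ :+ N :* Q₂ :* (con 1ℤ :+ q) :* y₂ :+ N :* Q₂ :* (N :* Q₂) :*
                 (q :* q) :* y₃))
           := Q :* (y₁ :- q :* (Q₁ :* Q₁) :* y₂) :+ N :* (y₀ :- (Q :* Q :* Q :* Q) :*
               (q :* q :* q :* q :* q :* q) :* y₃)
              :- rel Q y₁ y₀ :+ Q₁ :* Q₁ :* rel Q₁ y₂ y₁ :+ N :* Q :* Q₁ :* Q₁ :* q :* q :* rel Q₂ y₃ y₂)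
           refl q Q N y₀ y₁ y₂ y₃ ⟩
    T - (A 0 - B 0) + q * Q * (q * Q) * (A 1 - B 1) + N * Q * (q * Q) * (q * Q) * q * q * (A 2 - B 2)
      ≈⟨ +-cong (+-cong (+-congˡ (-‿cong (r 0))) (*-congˡ (r 1))) (*-congˡ (r 2)) ⟩
    T - 0# + q * Q * (q * Q) * 0# + N * Q * (q * Q) * (q * Q) * q * q * 0#
      ≈⟨ solve 3 (λ T a b → T :- con 0ℤ :+ a :* con 0ℤ :+ b :* con 0ℤ := T) refl T _ _ ⟩
    T ∎
    where
    Q = q ^ j
    N = q ^ n
    y₀ = central n j
    y₁ = central n (suc j)
    y₂ = central n (suc (suc j))
    y₃ = central n (3 ℕ.+ j)
    T = Q * (y₁ - q * ((q * Q) * (q * Q)) * y₂) + N * (y₀ - q^4j+6 j * y₃)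
    A B : ℕ → Carrier
    A i = (q ^ (i ℕ.+ j) - q ^ n * q ^ (i ℕ.+ j) * q ^ (i ℕ.+ j) * q) * central n (suc (i ℕ.+ j))
    B i = (q ^ (i ℕ.+ j) - q ^ n) * central n (i ℕ.+ j)
    r : ∀ i → A i - B i ≈ 0#
    r i = x≈y⇒x∙y⁻¹≈ε (central-ratio n (i ℕ.+ j))
    e₁ : q ^ (n ℕ.+ suc j) ≈ N * (q * Q)
    e₁ = ^-homo-* q n (suc j)
    e₂ : q ^ (n ℕ.+ suc (suc j)) ≈ N * (q * (q * Q))
    e₂ = ^-homo-* q n (suc (suc j))

  -- With these weights, the subtracted term of centralDiff-suc at j cancels the
  -- leading one at j + 3.
  weight : ℕ → ℕ → Carrier
  weight d zero    = 1#
  weight d (suc i) = weight d i * q^4j+6 (i ℕ.* 3 ℕ.+ d)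

  term : ℕ → ℕ → ℕ → Carrier
  term d n i = weight d i * (q ^ j * centralDiff n (suc j)) where j = i ℕ.* 3 ℕ.+ d

  term-suc : ∀ d n i → term d (suc n) i ≈
    term d n i + q ^ n * (weight d i * central n (i ℕ.* 3 ℕ.+ d) - weight d (suc i) * central n
        (suc i ℕ.* 3 ℕ.+ d))
  term-suc d n i = trans (*-congˡ (centralDiff-suc n j))
    (solve 6 (λ w t N a z b → w :* (t :+ N :* (a :- z :* b)) := w :* t :+ N :* (w :* a :- w :* z :* b))
      refl (weight d i) _ (q ^ n) (central n j) (q^4j+6 j) (central n (3 ℕ.+ j)))
    where j = i ℕ.* 3 ℕ.+ d

  Σterm-suc : ∀ d n I → Σ< I (term d (suc n)) ≈
    Σ< I (term d n) + q ^ n * (central n d - weight d I * central n (I ℕ.* 3 ℕ.+ d))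
  Σterm-suc d n zero = solve 2 (λ N a → con 0ℤ := con 0ℤ :+ N :* (a :- con 1ℤ :* a)) refl (q ^ n)
      (central n d)
  Σterm-suc d n (suc I) = begin
    Σ< (suc I) (term d (suc n))                    ≈⟨ Σ<-last I (term d (suc n)) ⟩
    Σ< I (term d (suc n)) + term d (suc n) I       ≈⟨ +-cong (Σterm-suc d n I) (term-suc d n I) ⟩
    (s + N * (a - b)) + (term d n I + N * (b - z)) ≈⟨ solve 6 (λ s N a b t z →
      (s :+ N :* (a :- b)) :+ (t :+ N :* (b :- z)) := (s :+ t) :+ N :* (a :- z)) refl s N a b
          (term d n I) z ⟩
    (s + term d n I) + N * (a - z)                 ≈⟨ +-congʳ (Σ<-last I (term d n)) ⟨
    Σ< (suc I) (term d n) + N * (a - z)            ∎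
    where
    N = q ^ n
    s = Σ< I (term d n)
    a = central n d
    b = weight d I * central n (I ℕ.* 3 ℕ.+ d)
    z = weight d (suc I) * central n (suc I ℕ.* 3 ℕ.+ d)

  -- `Σterm-suc` summed over `n`. The bound on `n` keeps the far boundary index above every upper
  -- limit reached, so its coefficient vanishes; at n = 0 all terms are zero.
  Σcentral : ∀ d I n → n ℕ.≤ I ℕ.* 3 ℕ.+ d → Σ< n (λ k → q ^ k * central k d) ≈ Σ< I (term d n)
  Σcentral d I zero _ = sym (Σ<-zero I λ i _ → begin
    weight d i * (q ^ j i * (0# - q * (q ^ suc (j i) * q ^ suc (j i)) * 0#))
      ≈⟨ solve 3 (λ w u v → w :* (u :* (con 0ℤ :- v :* con 0ℤ)) := con 0ℤ) refl (weight d i)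
          (q ^ j i) _ ⟩
    0# ∎)
    where
    j : ℕ → ℕ
    j i = i ℕ.* 3 ℕ.+ d
  Σcentral d I (suc n) n<j = begin
    Σ< (suc n) (λ k → q ^ k * central k d)              ≈⟨ Σ<-last n (λ k → q ^ k * central k d) ⟩
    Σ< n (λ k → q ^ k * central k d) + q ^ n * central n d ≈⟨ +-congʳ (Σcentral d I n (ℕₚ.<⇒≤ n<j)) ⟩
    Σ< I (term d n) + q ^ n * central n d
      ≈⟨ solve 4 (λ s N a w → s :+ N :* a := s :+ N :* (a :- w :* con 0ℤ)) refl _ _ _ _ ⟩
    Σ< I (term d n) + q ^ n * (central n d - weight d I * 0#)
      ≈⟨ +-congˡ (*-congˡ (+-congˡ (-‿cong (*-congˡ (central-> n<j))))) ⟨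
    Σ< I (term d n) + q ^ n * (central n d - weight d I * central n (I ℕ.* 3 ℕ.+ d))
      ≈⟨ Σterm-suc d n I ⟨
    Σ< I (term d (suc n)) ∎

-- Evaluation of the sums when H n j = 0 for 0 < j < n

module Vanishing {ℓ₁ ℓ₂} (R : CommutativeRing ℓ₁ ℓ₂) (q : CommutativeRing.Carrier R)
  (n : ℕ) (vanish : ∀ j → 0 ℕ.< j → j ℕ.< n →
     CommutativeRing._≈_ R (QBinomial.central R q n j) (CommutativeRing.0# R)) where
  open CommutativeRing R
  open IntegerCoefficients R
  open PartialSums R
  open QBinomial R q
  open Algebra.Properties.Semiring.Exp semiring
  open Relation.Binary.Reasoning.Setoid setoid

  S : ℕ → Carrier
  S d = Σ< n (λ k → q ^ k * central k d)

  Σ-qCat : Σ< n (λ k → q ^ k * qCat k) ≈ S 0 - q * S 1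
  Σ-qCat = begin
    Σ< n (λ k → q ^ k * qCat k)
      ≈⟨ Σ<-cong n (λ k _ → solve 4 (λ q x a b → x :* (a :- q :* b) := x :* a :+ :- q :* (x :* b)) refl q
          (q ^ k) (central k 0) (central k 1)) ⟩
    Σ< n (λ k → q ^ k * central k 0 + - q * (q ^ k * central k 1))
      ≈⟨ Σ<-+ n (λ k → q ^ k * central k 0) (λ k → - q * (q ^ k * central k 1)) ⟩
    S 0 + Σ< n (λ k → - q * (q ^ k * central k 1))
      ≈⟨ +-congˡ (Σ<-* n (- q) (λ k → q ^ k * central k 1)) ⟩
    S 0 + - q * S 1
      ≈⟨ solve 3 (λ q a b → a :+ :- q :* b := a :- q :* b) refl q (S 0) (S 1) ⟩
    S 0 - q * S 1 ∎

  term≈ : ∀ d i {a b} → central n (suc (i ℕ.* 3 ℕ.+ d)) ≈ a → central n (2 ℕ.+ (i ℕ.* 3 ℕ.+ d)) ≈ b →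
    let x = q ^ (i ℕ.* 3 ℕ.+ d) in
    term d n i ≈ weight d i * (x * (a - q * ((q * x) * (q * x)) * b))
  term≈ d i a b = *-congˡ (*-congˡ (+-cong a (-‿cong (*-congˡ b))))

  -- With j = 3i + d, a term contains the coefficients at j + 1 and j + 2 only. For i < I one has j
  -- + 3 ≤ n, so both indices lie strictly between 0 and `n`.
  Σterm-small : ∀ d I → I ℕ.* 3 ℕ.+ d ℕ.≤ n → Σ< I (term d n) ≈ 0#
  Σterm-small d I I≤n = Σ<-zero I λ i i<I → let j+3≤n = ℕₚ.≤-trans (ℕₚ.+-monoˡ-≤ d (ℕₚ.*-monoˡ-≤ 3 i<I)) I≤n in trans
    (term≈ d i (vanish _ (ℕ.s≤s ℕ.z≤n) (ℕₚ.<-trans (ℕₚ.n<1+n _) j+3≤n)) (vanish _ (ℕ.s≤s ℕ.z≤n) j+3≤n))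
    (solve 3 (λ w x v → w :* (x :* (con 0ℤ :- v :* con 0ℤ)) := con 0ℤ) refl _ _ _)

  -- This and `S-one`, `S-two` treat n - d ≡ 0, 1, 2 modulo 3. The index `n` is met by no term, by
  -- the leading coefficient of the last `centralDiff`, or by its subtracted one, whence the minus
  -- sign in `S-two`.
  S-zero : ∀ d I → n ≡ I ℕ.* 3 ℕ.+ d → S d ≈ 0#
  S-zero d I n≡ = trans (Σcentral d I n (ℕₚ.≤-reflexive n≡))
      (Σterm-small d I (ℕₚ.≤-reflexive (≡.sym n≡)))

  S-last : ∀ d I → I ℕ.* 3 ℕ.+ d ℕ.≤ n → n ℕ.≤ suc I ℕ.* 3 ℕ.+ d → S d ≈ term d n I
  S-last d I I≤n n≤ = begin
    S d                           ≈⟨ Σcentral d (suc I) n n≤ ⟩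
    Σ< (suc I) (term d n)         ≈⟨ Σ<-last I (term d n) ⟩
    Σ< I (term d n) + term d n I  ≈⟨ +-congʳ (Σterm-small d I I≤n) ⟩
    0# + term d n I               ≈⟨ +-identityˡ _ ⟩
    term d n I                    ∎

  S-one : ∀ d I → n ≡ suc (I ℕ.* 3 ℕ.+ d) → S d ≈ weight d I * q ^ (I ℕ.* 3 ℕ.+ d)
  S-one d I ≡.refl = begin
    S d         ≈⟨ S-last d I (ℕₚ.n≤1+n _) (ℕ.s≤s (ℕₚ.m≤n+m _ 2)) ⟩
    term d n I  ≈⟨ term≈ d I (central-refl n) (central-> (ℕₚ.n<1+n n)) ⟩
    _           ≈⟨ solve 3 (λ w x v → w :* (x :* (con 1ℤ :- v :* con 0ℤ)) := w :* x) refl _ _ _ ⟩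
    weight d I * q ^ (I ℕ.* 3 ℕ.+ d) ∎

  S-two : ∀ d I → n ≡ 2 ℕ.+ (I ℕ.* 3 ℕ.+ d) → S d ≈ - (weight d I * q ^ (3 ℕ.* (suc (I ℕ.* 3 ℕ.+ d))))
  S-two d I ≡.refl = begin
    S d         ≈⟨ S-last d I (ℕₚ.m≤n+m _ 2) (ℕ.s≤s (ℕₚ.m≤n+m _ 1)) ⟩
    term d n I  ≈⟨ term≈ d I (vanish (suc j) (ℕ.s≤s ℕ.z≤n) (ℕₚ.n<1+n _)) (central-refl n) ⟩
    _           ≈⟨ solve 3 (λ w q x → w :* (x :* (con 0ℤ :- q :* ((q :* x) :* (q :* x)) :* con 1ℤ)) := :-
        (w :* ((q :* x) :* ((q :* x) :* (q :* x))))) refl _ _ _ ⟩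
    - (weight d I * (x * (x * x)))
      ≈⟨ -‿cong (*-congˡ (trans (^-homo-* q (suc j) _)
          (*-congˡ (trans (^-homo-* q (suc j) _)
          (*-congˡ (trans (^-homo-* q (suc j) 0) (*-identityʳ _))))))) ⟨
    - (weight d I * q ^ (3 ℕ.* suc j)) ∎
    where
    j = I ℕ.* 3 ℕ.+ d
    x = q ^ suc j

-- The parameter q = 1

module UnitParameter {ℓ₁ ℓ₂} (R : CommutativeRing ℓ₁ ℓ₂) where
  open CommutativeRing R
  open IntegerCoefficients R
  open QBinomial R 1#
  open PartialSums R
  open Algebra.Properties.Semiring.Exp semiring
  open Mult′ semiring using (×-homo-+) renaming (_×_ to _×′_)
  open Relation.Binary.Reasoning.Setoid setoid

  1^ : ∀ k → 1# ^ k ≈ 1#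
  1^ zero    = refl
  1^ (suc k) = trans (*-identityˡ _) (1^ k)

  qbinom-one : ∀ n k → qbinom n k ≈ (n C k) ×′ 1#
  qbinom-one zero    zero    = refl
  qbinom-one (suc n) zero    = refl
  qbinom-one zero    (suc k) = refl
  qbinom-one (suc n) (suc k) = begin
    qbinom n k + 1# ^ suc k * qbinom n (suc k)  ≈⟨ +-congˡ (trans (*-congʳ (1^ (suc k)))
        (*-identityˡ _)) ⟩
    qbinom n k + qbinom n (suc k)               ≈⟨ +-cong (qbinom-one n k) (qbinom-one n (suc k)) ⟩
    (n C k) ×′ 1# + (n C suc k) ×′ 1#             ≈⟨ ×-homo-+ 1# (n C k) (n C suc k) ⟨
    (n C k ℕ.+ n C suc k) ×′ 1#                  ≡⟨ ≡.cong (_×′ 1#) (nCk+nC[k+1]≡[n+1]C[k+1] n k) ⟩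
    (suc n C suc k) ×′ 1#                        ∎

  weight≈1 : ∀ d i → weight d i ≈ 1#
  weight≈1 d zero    = refl
  weight≈1 d (suc i) = begin
    weight d i * (y * y * y * y * (1# * 1# * 1# * 1# * 1# * 1#)) ≈⟨ *-cong (weight≈1 d i)
        (*-congʳ (*-cong (*-cong (*-cong y≈1 y≈1) y≈1) y≈1)) ⟩
    1# * (1# * 1# * 1# * 1# * (1# * 1# * 1# * 1# * 1# * 1#))     ≈⟨ solve 0 (let o = con 1ℤ in o :*
        (o :* o :* o :* o :* (o :* o :* o :* o :* o :* o)) := o) refl ⟩
    1# ∎
    where
    y = 1# ^ (i ℕ.* 3 ℕ.+ d)
    y≈1 = 1^ (i ℕ.* 3 ℕ.+ d)

  module _ (n : ℕ) (vanish : ∀ j → 0 ℕ.< j → j ℕ.< n → central n j ≈ 0#) where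
    open Vanishing R 1# n vanish

    private
      w≈1 : ∀ d i k → weight d i * 1# ^ k ≈ 1#
      w≈1 d i k = trans (*-cong (weight≈1 d i) (1^ k)) (*-identityˡ 1#)

    -- At q = 1 the sum `S d` is 0, 1 or -1 as n - d ≡ 0, 1 or 2 modulo 3. Hence S 0 - S 1 is 0 + 1,
    -- 1 - 0 and -1 - 1 in this and the next two lemmas.
    Σ-qCat≡0 : ∀ e → n ≡ suc e ℕ.* 3 → Σ< n (λ k → 1# ^ k * qCat k) ≈ 1#
    Σ-qCat≡0 e n≡ = begin
      Σ< n (λ k → 1# ^ k * qCat k)  ≈⟨ Σ-qCat ⟩
      S 0 - 1# * S 1
        ≈⟨ +-cong (S-zero 0 (suc e) (≡.trans n≡ (≡.sym (ℕₚ.+-identityʳ _))))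
            (-‿cong (*-congˡ (trans (S-two 1 e (≡.trans n≡ (≡.cong (2 ℕ.+_) (ℕₚ.+-comm 1 (e ℕ.* 3)))))
            (-‿cong (w≈1 1 e (3 ℕ.* suc (e ℕ.* 3 ℕ.+ 1))))))) ⟩
      0# - 1# * - 1#                ≈⟨ solve 0 (con 0ℤ :- con 1ℤ :* :- con 1ℤ := con 1ℤ) refl ⟩
      1#                            ∎

    Σ-qCat≡1 : ∀ e → n ≡ suc (e ℕ.* 3) → Σ< n (λ k → 1# ^ k * qCat k) ≈ 1#
    Σ-qCat≡1 e n≡ = begin
      Σ< n (λ k → 1# ^ k * qCat k)  ≈⟨ Σ-qCat ⟩
      S 0 - 1# * S 1
        ≈⟨ +-cong (trans (S-one 0 e (≡.trans n≡ (≡.cong suc (≡.sym (ℕₚ.+-identityʳ _)))))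
            (w≈1 0 e (e ℕ.* 3 ℕ.+ 0)))
            (-‿cong (*-congˡ (S-zero 1 e (≡.trans n≡ (ℕₚ.+-comm 1 (e ℕ.* 3)))))) ⟩
      1# - 1# * 0#                  ≈⟨ solve 0 (con 1ℤ :- con 1ℤ :* con 0ℤ := con 1ℤ) refl ⟩
      1#                            ∎

    Σ-qCat≡2 : ∀ e → n ≡ 2 ℕ.+ e ℕ.* 3 → Σ< n (λ k → 1# ^ k * qCat k) ≈ - (1# + 1#)
    Σ-qCat≡2 e n≡ = begin
      Σ< n (λ k → 1# ^ k * qCat k)  ≈⟨ Σ-qCat ⟩
      S 0 - 1# * S 1
        ≈⟨ +-cong (trans (S-two 0 e (≡.trans n≡ (≡.cong (2 ℕ.+_) (≡.sym (ℕₚ.+-identityʳ _)))))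
            (-‿cong (w≈1 0 e (3 ℕ.* suc (e ℕ.* 3 ℕ.+ 0)))))
            (-‿cong (*-congˡ (trans (S-one 1 e (≡.trans n≡ (≡.cong suc (ℕₚ.+-comm 1 (e ℕ.* 3)))))
            (w≈1 1 e (e ℕ.* 3 ℕ.+ 1))))) ⟩
      - 1# - 1# * 1#                ≈⟨ solve 0 (:- con 1ℤ :- con 1ℤ :* con 1ℤ := :- (con 1ℤ :+ con 1ℤ))
          refl ⟩
      - (1# + 1#)                   ∎

-- Over an integral domain this says that q has multiplicative order n.
record IsPrimitiveRoot {ℓ₁ ℓ₂} (R : CommutativeRing ℓ₁ ℓ₂) (q : CommutativeRing.Carrier R) (n : ℕ) : Set
    (ℓ₁ ⊔ ℓ₂) where
  open CommutativeRing R
  open Algebra.Properties.Semiring.Exp semiring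
  field
    qⁿ≈1    : q ^ n ≈ 1#
    regular : ∀ j → 0 ℕ.< j → j ℕ.< n → ∀ x → (1# - q ^ j) * x ≈ 0# → x ≈ 0#

-- The parameter q a primitive n-th root of unity

module PrimitiveRoot {ℓ₁ ℓ₂} (R : CommutativeRing ℓ₁ ℓ₂) (q : CommutativeRing.Carrier R)
  (n : ℕ) (root : IsPrimitiveRoot R q n) where
  open CommutativeRing R
  open Algebra.Properties.Semiring.Exp semiring
  open IsPrimitiveRoot root
  open IntegerCoefficients R
  open QBinomial R q
  open PartialSums R
  open Relation.Binary.Reasoning.Setoid setoid

  ^-periodic : ∀ k m → q ^ (n ℕ.* k ℕ.+ m) ≈ q ^ m
  ^-periodic k m = begin
    q ^ (n ℕ.* k ℕ.+ m)   ≈⟨ ^-homo-* q (n ℕ.* k) m ⟩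
    q ^ (n ℕ.* k) * q ^ m ≈⟨ *-congʳ (^-assocʳ q n k) ⟨
    (q ^ n) ^ k * q ^ m   ≈⟨ *-congʳ (^-congˡ k qⁿ≈1) ⟩
    1# ^ k * q ^ m        ≈⟨ *-congʳ (UnitParameter.1^ R k) ⟩
    1# * q ^ m            ≈⟨ *-identityˡ _ ⟩
    q ^ m                 ∎

  -- The power q^(n-j) is an inverse of `q ^ j`.
  ^-regular : ∀ j → j ℕ.≤ n → ∀ x → q ^ j * x ≈ 0# → x ≈ 0#
  ^-regular j j≤n x qʲx≈0 = begin
    x                                  ≈⟨ *-identityˡ x ⟨
    1# * x                             ≈⟨ *-congʳ qⁿ≈1 ⟨
    q ^ n * x                          ≡⟨ ≡.cong (λ i → q ^ i * x) (ℕₚ.m∸n+n≡m j≤n) ⟨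
    q ^ (n ℕ.∸ j ℕ.+ j) * x            ≈⟨ *-congʳ (^-homo-* q (n ℕ.∸ j) j) ⟩
    q ^ (n ℕ.∸ j) * q ^ j * x          ≈⟨ *-assoc _ _ _ ⟩
    q ^ (n ℕ.∸ j) * (q ^ j * x)        ≈⟨ *-congˡ qʲx≈0 ⟩
    q ^ (n ℕ.∸ j) * 0#                 ≈⟨ zeroʳ _ ⟩
    0#                                 ∎

  -- With q^n = 1, `central-ratio` expresses q^j (1 - q^(j+1)) H n (j+1) as (q^j - 1) H n j. The
  -- right side is zero, at j = 0 by its first factor and afterwards by induction; both factors on
  -- the left can be cancelled.
  central-vanish : ∀ j → 0 ℕ.< j → j ℕ.< n → central n j ≈ 0#
  central-vanish (suc j) _ j<n = regular (suc j) (ℕ.s≤s ℕ.z≤n) j<n _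
    (^-regular j (ℕₚ.≤-trans (ℕₚ.n≤1+n j) (ℕₚ.<⇒≤ j<n)) _ (begin
      x * ((1# - q * x) * b)
        ≈⟨ solve 3 (λ q x b → x :* ((con 1ℤ :- q :* x) :* b) := (x :- con 1ℤ :* x :* x :* q) :* b) refl q
            x b ⟩
      (x - 1# * x * x * q) * b
        ≈⟨ *-congʳ (+-congˡ (-‿cong (*-congʳ (*-congʳ (*-congʳ qⁿ≈1))))) ⟨
      (x - q ^ n * x * x * q) * b
        ≈⟨ central-ratio n j ⟩
      (x - q ^ n) * central n j
        ≈⟨ *-congʳ (+-congˡ (-‿cong qⁿ≈1)) ⟩
      (x - 1#) * central n j
        ≈⟨ prev j j<n ⟩
      0# ∎))
    where
    x = q ^ j
    b = central n (suc j)
    prev : ∀ j → suc j ℕ.< n → (q ^ j - 1#) * central n j ≈ 0#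
    prev zero    _   = solve 1 (λ a → (con 1ℤ :- con 1ℤ) :* a := con 0ℤ) refl (central n 0)
    prev (suc j) j<n = trans (*-congˡ (central-vanish (suc j) (ℕ.s≤s ℕ.z≤n)
        (ℕₚ.<-trans (ℕₚ.n<1+n _) j<n))) (zeroʳ _)

  -- The exponent is the sum of 4(3l + 1) + 6 = 12l + 10 over l < i.
  weight-one : ∀ i → weight 1 i ≈ q ^ (6 ℕ.* i ℕ.* i ℕ.+ 4 ℕ.* i)
  weight-one zero = refl
  weight-one (suc i) = begin
    weight 1 i * (y * y * y * y * (q * q * q * q * q * q))
      ≈⟨ *-cong (weight-one i) (solve 2 (λ q y → y :* y :* y :* y :* (q :* q :* q :* q :* q :* q)
           := q :* (q :* (q :* (q :* (q :* (q :* (y :* (y :* (y :* (y :* con 1ℤ)))))))))) refl q y) ⟩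
    q ^ e * (q * (q * (q * (q * (q * (q * y ^ 4))))))
      ≈⟨ *-congˡ (*-congˡ (*-congˡ (*-congˡ (*-congˡ (*-congˡ (*-congˡ (^-assocʳ q j 4))))))) ⟩
    q ^ e * q ^ (6 ℕ.+ j ℕ.* 4)
      ≈⟨ ^-homo-* q e _ ⟨
    q ^ (e ℕ.+ (6 ℕ.+ j ℕ.* 4))
      ≡⟨ ≡.cong (q ^_) (exponent i) ⟩
    q ^ (6 ℕ.* suc i ℕ.* suc i ℕ.+ 4 ℕ.* suc i) ∎
    where
    j = i ℕ.* 3 ℕ.+ 1
    y = q ^ j
    e = 6 ℕ.* i ℕ.* i ℕ.+ 4 ℕ.* i
    exponent : ∀ i → 6 ℕ.* i ℕ.* i ℕ.+ 4 ℕ.* i ℕ.+ (6 ℕ.+ (i ℕ.* 3 ℕ.+ 1) ℕ.* 4) ≡ 6 ℕ.* suc i ℕ.* suc i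
        ℕ.+ 4 ℕ.* suc i
    exponent = N.solve 1 (λ i → N.con 6 N.:* i N.:* i N.:+ N.con 4 N.:* i N.:+
        (N.con 6 N.:+ (i N.:* N.con 3 N.:+ N.con 1) N.:* N.con 4)
      N.:= N.con 6 N.:* (N.con 1 N.:+ i) N.:* (N.con 1 N.:+ i) N.:+ N.con 4 N.:* (N.con 1 N.:+ i)) ≡.refl
      where module N = ℕSolver.+-*-Solver

  Σ-qCat-root : ∀ e → n ≡ suc e ℕ.* 3 → Σ< n (λ k → q ^ k * qCat k) ≈ q ^ suc e
  Σ-qCat-root e n≡ = begin
    Σ< n (λ k → q ^ k * qCat k)   ≈⟨ Σ-qCat ⟩
    S 0 - q * S 1
      ≈⟨ +-cong (S-zero 0 (suc e) (≡.trans n≡ (≡.sym (ℕₚ.+-identityʳ _))))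
          (-‿cong (*-congˡ (S-two 1 e (≡.trans n≡ (≡.cong (2 ℕ.+_) (ℕₚ.+-comm 1 (e ℕ.* 3))))))) ⟩
    0# - q * - (weight 1 e * q ^ (3 ℕ.* suc j))
      ≈⟨ solve 3 (λ q w y → con 0ℤ :- q :* :- (w :* y) := w :* (q :* y)) refl q _ _ ⟩
    weight 1 e * q ^ suc (3 ℕ.* suc j)
      ≈⟨ *-congʳ (weight-one e) ⟩
    q ^ (6 ℕ.* e ℕ.* e ℕ.+ 4 ℕ.* e) * q ^ suc (3 ℕ.* suc j)
      ≈⟨ ^-homo-* q (6 ℕ.* e ℕ.* e ℕ.+ 4 ℕ.* e) _ ⟨
    q ^ (6 ℕ.* e ℕ.* e ℕ.+ 4 ℕ.* e ℕ.+ suc (3 ℕ.* suc j))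
      -- The exponent is 6e² + 13e + 7 = (e + 1)(6e + 7), and with n = 3(e + 1) this is 2(e + 1)n +
      -- (e + 1).
      ≡⟨ ≡.cong (q ^_) (≡.trans (exponent e) (≡.cong (λ i → i ℕ.* (2 ℕ.* suc e) ℕ.+ suc e) (≡.sym n≡))) ⟩
    q ^ (n ℕ.* (2 ℕ.* suc e) ℕ.+ suc e)
      ≈⟨ ^-periodic (2 ℕ.* suc e) (suc e) ⟩
    q ^ suc e ∎
    where
    open Vanishing R q n central-vanish
    j = e ℕ.* 3 ℕ.+ 1
    exponent : ∀ e → 6 ℕ.* e ℕ.* e ℕ.+ 4 ℕ.* e ℕ.+ suc (3 ℕ.* suc (e ℕ.* 3 ℕ.+ 1)) ≡ suc e ℕ.* 3 ℕ.*
        (2 ℕ.* suc e) ℕ.+ suc e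
    exponent = N.solve 1 (λ e → N.con 6 N.:* e N.:* e N.:+ N.con 4 N.:* e N.:+ (N.con 1 N.:+ N.con 3 N.:*
        (N.con 1 N.:+ (e N.:* N.con 3 N.:+ N.con 1)))
      N.:= (N.con 1 N.:+ e) N.:* N.con 3 N.:* (N.con 2 N.:* (N.con 1 N.:+ e)) N.:+ (N.con 1 N.:+ e))
          ≡.refl
      where module N = ℕSolver.+-*-Solver

-- Formal power series and the polynomials C_n^q

module PowerSeries {ℓ₁ ℓ₂} (R : CommutativeRing ℓ₁ ℓ₂) where
  open CommutativeRing R
  open IntegerCoefficients R
  open Algebra.Properties.Semiring.Mult semiring using () renaming (_×_ to _×′_)
  open Relation.Binary.Reasoning.Setoid setoid

  -- Formal power series serve twice: over ℤ to identify exact quotients of polynomials, and over ℝ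
  -- and ℂ to multiply exponential series.
  Series : Set ℓ₁
  Series = ℕ → Carrier

  infix 4 _≋_
  _≋_ : Series → Series → Set ℓ₂
  f ≋ g = ∀ n → f n ≈ g n

  cons : Carrier → Series → Series
  cons a f zero    = a
  cons a f (suc n) = f n

  shift : Series → Series
  shift f n = f (suc n)

  0ₛ 1ₛ X : Series
  0ₛ _ = 0#
  1ₛ = cons 1# 0ₛ
  X  = cons 0# 1ₛ

  infixl 6 _⊕_
  infixl 7 _⊗_
  -- The product follows f·g = f₀·g + X·(shift f)·g in place of a convolution sum, so the ring laws
  -- are inductions on the coefficient index.
  _⊕_ _⊗_ : Series → Series → Series
  (f ⊕ g) n = f n + g n
  (f ⊗ g) zero    = f 0 * g 0
  (f ⊗ g) (suc n) = f 0 * g (suc n) + (shift f ⊗ g) n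

  ⊝_ : Series → Series
  (⊝ f) n = - f n

  ⊗-cong : ∀ {f f′ g g′} → f ≋ f′ → g ≋ g′ → f ⊗ g ≋ f′ ⊗ g′
  ⊗-cong p r zero    = *-cong (p 0) (r 0)
  ⊗-cong p r (suc n) = +-cong (*-cong (p 0) (r (suc n))) (⊗-cong (λ k → p (suc k)) r n)

  ⊗-sucʳ : ∀ f g n → (f ⊗ g) (suc n) ≈ (f ⊗ shift g) n + f (suc n) * g 0
  ⊗-sucʳ f g zero    = refl
  ⊗-sucʳ f g (suc n) = trans (+-congˡ (⊗-sucʳ (shift f) g n)) (sym (+-assoc _ _ _))

  ⊗-comm : ∀ f g → f ⊗ g ≋ g ⊗ f
  ⊗-comm f g zero    = *-comm _ _
  ⊗-comm f g (suc n) = begin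
    f 0 * g (suc n) + (shift f ⊗ g) n   ≈⟨ +-cong (*-comm _ _) (⊗-comm (shift f) g n) ⟩
    g (suc n) * f 0 + (g ⊗ shift f) n   ≈⟨ +-comm _ _ ⟩
    (g ⊗ shift f) n + g (suc n) * f 0   ≈⟨ ⊗-sucʳ g f n ⟨
    (g ⊗ f) (suc n)                     ∎

  ⊗-distribʳ : ∀ h f g → (f ⊕ g) ⊗ h ≋ (f ⊗ h) ⊕ (g ⊗ h)
  ⊗-distribʳ h f g zero    = distribʳ _ _ _
  ⊗-distribʳ h f g (suc n) = trans (+-cong (distribʳ _ _ _) (⊗-distribʳ h (shift f) (shift g) n))
    (solve 4 (λ a b u v → a :+ b :+ (u :+ v) := a :+ u :+ (b :+ v)) refl _ _ _ _)

  ⊗-scale : ∀ a f g → (λ n → a * f n) ⊗ g ≋ (λ n → a * (f ⊗ g) n)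
  ⊗-scale a f g zero    = *-assoc _ _ _
  ⊗-scale a f g (suc n) = trans (+-cong (*-assoc _ _ _) (⊗-scale a (shift f) g n)) (sym (distribˡ a _ _))

  ⊗-assoc : ∀ f g h → (f ⊗ g) ⊗ h ≋ f ⊗ (g ⊗ h)
  ⊗-assoc f g h zero    = *-assoc _ _ _
  ⊗-assoc f g h (suc n) = begin
    f 0 * g 0 * h (suc n) + (shift (f ⊗ g) ⊗ h) n
      ≈⟨ +-congˡ (⊗-distribʳ h (λ k → f 0 * g (suc k)) (shift f ⊗ g) n) ⟩
    f 0 * g 0 * h (suc n) + (((λ k → f 0 * g (suc k)) ⊗ h) n + ((shift f ⊗ g) ⊗ h) n)
      ≈⟨ +-congˡ (+-cong (⊗-scale (f 0) (shift g) h n) (⊗-assoc (shift f) g h n)) ⟩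
    f 0 * g 0 * h (suc n) + (f 0 * (shift g ⊗ h) n + (shift f ⊗ (g ⊗ h)) n)
      ≈⟨ solve 5 (λ a b c s t → a :* b :* c :+ (a :* s :+ t) := a :* (b :* c :+ s) :+ t) refl _ _ _ _ _ ⟩
    f 0 * (g 0 * h (suc n) + (shift g ⊗ h) n) + (shift f ⊗ (g ⊗ h)) n ∎

  ⊗-zeroˡ : ∀ g → 0ₛ ⊗ g ≋ 0ₛ
  ⊗-zeroˡ g zero    = zeroˡ _
  ⊗-zeroˡ g (suc n) = trans (+-cong (zeroˡ _) (⊗-zeroˡ g n)) (+-identityˡ _)

  ⊗-identityˡ : ∀ g → 1ₛ ⊗ g ≋ g
  ⊗-identityˡ g zero    = *-identityˡ _
  ⊗-identityˡ g (suc n) = trans (+-cong (*-identityˡ _) (⊗-zeroˡ g n)) (+-identityʳ _)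

  X⊗ : ∀ g → X ⊗ g ≋ cons 0# g
  X⊗ g zero    = zeroˡ _
  X⊗ g (suc n) = trans (+-cong (zeroˡ _) (⊗-identityˡ g n)) (+-identityˡ _)

  seriesRing : CommutativeRing ℓ₁ ℓ₂
  seriesRing = record
    { Carrier = Series ; _≈_ = _≋_ ; _+_ = _⊕_ ; _*_ = _⊗_ ; -_ = ⊝_ ; 0# = 0ₛ ; 1# = 1ₛ
    ; isCommutativeRing = record
      { isRing = record
        { +-isAbelianGroup = record
          { isGroup = record
            { isMonoid = record
              { isSemigroup = record
                { isMagma = record
                  { isEquivalence = record
                    { refl  = λ _ → refl
                    ; sym   = λ p n → sym (p n)
                    ; trans = λ p r n → trans (p n) (r n)
                    }
                  ; ∙-cong = λ p r n → +-cong (p n) (r n)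
                  }
                ; assoc = λ _ _ _ _ → +-assoc _ _ _
                }
              ; identity = (λ _ _ → +-identityˡ _) , (λ _ _ → +-identityʳ _)
              }
            ; inverse = (λ _ _ → -‿inverseˡ _) , (λ _ _ → -‿inverseʳ _)
            ; ⁻¹-cong = λ p n → -‿cong (p n)
            }
          ; comm = λ _ _ _ → +-comm _ _
          }
        ; *-cong = ⊗-cong
        ; *-assoc = ⊗-assoc
        ; *-identity = ⊗-identityˡ , λ f n → trans (⊗-comm f 1ₛ n) (⊗-identityˡ f n)
        ; distrib = (λ f g h n → trans (⊗-comm f (g ⊕ h) n) (trans (⊗-distribʳ f g h n)
            (+-cong (⊗-comm g f n) (⊗-comm h f n))))
                  , ⊗-distribʳ
        }
      ; *-comm = ⊗-comm
      }
    }

  deriv : Series → Series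
  deriv f n = (suc n ×′ 1#) * f (suc n)

  -- For f = f₀ + X·g one has f′ = g + X·g′; this is the same identity with the constant term
  -- removed.
  deriv-shift : ∀ f → shift (deriv f) ≋ deriv (shift f) ⊕ shift (shift f)
  deriv-shift f n = solve 2 (λ a b → (con 1ℤ :+ a) :* b := a :* b :+ b) refl (suc n ×′ 1#)
      (f (suc (suc n)))

  leibniz : ∀ f g → deriv (f ⊗ g) ≋ (deriv f ⊗ g) ⊕ (f ⊗ deriv g)
  leibniz f g zero = solve 4 (λ a b u v → (con 1ℤ :+ con 0ℤ) :* (a :* v :+ u :* b) :=
      ((con 1ℤ :+ con 0ℤ) :* u) :* b :+ a :* ((con 1ℤ :+ con 0ℤ) :* v))
      refl (f 0) (g 0) (f 1) (g 1)
  leibniz f g (suc n) = begin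
    (1# + k) * (f 0 * g (suc (suc n)) + (shift f ⊗ g) (suc n))
      ≈⟨ solve 4 (λ k a b s → (con 1ℤ :+ k) :* (a :* b :+ s) := a :* ((con 1ℤ :+ k) :* b) :+ s :+ k :* s)
          refl k (f 0) _ _ ⟩
    f 0 * deriv g (suc n) + (shift f ⊗ g) (suc n) + deriv (shift f ⊗ g) n
      ≈⟨ +-congˡ (leibniz (shift f) g n) ⟩
    f 0 * deriv g (suc n) + (shift f ⊗ g) (suc n) + ((deriv (shift f) ⊗ g) n + (shift f ⊗ deriv g) n)
      ≈⟨ solve 5 (λ p a s u v → p :+ (a :+ s) :+ (u :+ v) := (con 1ℤ :+ con 0ℤ) :* a :+ (u :+ s) :+
          (p :+ v)) refl _ _ _ _ _ ⟩
    (1# + 0#) * (f 1 * g (suc n)) + ((deriv (shift f) ⊗ g) n + (shift (shift f) ⊗ g) n) +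
        (f 0 * deriv g (suc n) + (shift f ⊗ deriv g) n)
      ≈⟨ +-congʳ (+-cong (sym (*-assoc _ _ _))
          (trans (sym (⊗-distribʳ g (deriv (shift f)) (shift (shift f)) n))
          (sym (⊗-cong {g = g} (deriv-shift f) (λ _ → refl) n)))) ⟩
    (deriv f ⊗ g) (suc n) + (f ⊗ deriv g) (suc n) ∎
    where
    k = suc n ×′ 1#

  -- A series with f′ = a f is determined by its constant term, and products
  -- of such series are again of this form.
  exp-⊗ : (∀ n {x y} → (suc n ×′ 1#) * x ≈ (suc n ×′ 1#) * y → x ≈ y) →
    ∀ {a b f g h} → deriv f ≋ (λ n → a * f n) → deriv g ≋ (λ n → b * g n) → deriv h ≋
        (λ n → (a + b) * h n) →
    f 0 * g 0 ≈ h 0 → f ⊗ g ≋ h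
  exp-⊗ cancel f′ g′ h′ e zero = e
  exp-⊗ cancel {a} {b} {f} {g} {h} f′ g′ h′ e (suc n) = cancel n (begin
    deriv (f ⊗ g) n                       ≈⟨ leibniz f g n ⟩
    (deriv f ⊗ g) n + (f ⊗ deriv g) n     ≈⟨ +-cong (⊗-cong {g = g} f′ (λ _ → refl) n)
        (⊗-cong {f = f} (λ _ → refl) g′ n) ⟩
    ((λ n → a * f n) ⊗ g) n + (f ⊗ (λ n → b * g n)) n
      ≈⟨ +-cong (⊗-scale a f g n) (trans (⊗-comm f _ n) (trans (⊗-scale b g f n)
          (*-congˡ (⊗-comm g f n)))) ⟩
    a * (f ⊗ g) n + b * (f ⊗ g) n         ≈⟨ distribʳ _ _ _ ⟨
    (a + b) * (f ⊗ g) n                   ≈⟨ *-congˡ (exp-⊗ cancel {f = f} {g} f′ g′ h′ e n) ⟩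
    (a + b) * h n                         ≈⟨ h′ n ⟨
    deriv h n                             ∎)

-- Integer polynomials inside the power series ring

module IntegerPolynomials where
  open PowerSeries ℤₚ.+-*-commutativeRing using (Series; _≋_; X; _⊗_; _⊕_; ⊝_; 1ₛ; 0ₛ; cons; shift; X⊗; ⊗-cong; ⊗-comm; ⊗-zeroˡ; ⊗-identityˡ; ⊗-sucʳ; ⊗-assoc; seriesRing)
  private
    module ℤ[[X]] = CommutativeRing seriesRing
    module ℤX = QBinomial seriesRing X
  open Algebra.Properties.Semiring.Exp ℤ[[X]].semiring using () renaming (_^_ to _^ₛ_)

  coeff : Poly → Series
  coeff []      _       = 0ℤ
  coeff (a ∷ f) zero    = a
  coeff (a ∷ f) (suc n) = coeff f n

  coeff-+ : ∀ f g → coeff (f +ₚ g) ≋ coeff f ⊕ coeff g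
  coeff-+ []      g       n       = ≡.sym (ℤₚ.+-identityˡ _)
  coeff-+ (a ∷ f) []      n       = ≡.sym (ℤₚ.+-identityʳ _)
  coeff-+ (a ∷ f) (b ∷ g) zero    = ≡.refl
  coeff-+ (a ∷ f) (b ∷ g) (suc n) = coeff-+ f g n

  coeff-· : ∀ a f n → coeff (a ·ₚ f) n ≡ a ℤ.* coeff f n
  coeff-· a []      n       = ≡.sym (ℤₚ.*-zeroʳ a)
  coeff-· a (b ∷ f) zero    = ≡.refl
  coeff-· a (b ∷ f) (suc n) = coeff-· a f n

  coeff-- : ∀ f g n → coeff (f -ₚ g) n ≡ coeff f n ℤ.- coeff g n
  coeff-- f g n = ≡.trans (coeff-+ f (-1ℤ ·ₚ g) n)
    (≡.cong (λ z → coeff f n ℤ.+ z) (≡.trans (coeff-· -1ℤ g n) (ℤₚ.-1*i≡-i _)))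

  coeff-* : ∀ f g → coeff (f *ₚ g) ≋ coeff f ⊗ coeff g
  coeff-* []      g n       = ≡.sym (⊗-zeroˡ (coeff g) n)
  coeff-* (a ∷ f) g zero    = ≡.trans (coeff-+ (a ·ₚ g) _ 0) (≡.trans (ℤₚ.+-identityʳ _) (coeff-· a g 0))
  coeff-* (a ∷ f) g (suc n) = ≡.trans (coeff-+ (a ·ₚ g) _ (suc n)) (≡.cong₂ ℤ._+_ (coeff-· a g (suc n))
      (coeff-* f g n))

  coeff-1 : coeff 1ₚ ≋ 1ₛ
  coeff-1 zero    = ≡.refl
  coeff-1 (suc n) = ≡.refl

  coeff-X^ : ∀ k → coeff (X^ k) ≋ X ^ₛ k
  coeff-X^ zero    = coeff-1
  coeff-X^ (suc k) n = ≡.trans (step n) (≡.sym (X⊗ (X ^ₛ k) n))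
    where
    step : coeff (X^ suc k) ≋ cons 0ℤ (X ^ₛ k)
    step zero    = ≡.refl
    step (suc n) = coeff-X^ k n

  coeff-length : ∀ f n → length f ℕ.≤ n → coeff f n ≡ 0ℤ
  coeff-length []      n       _         = ≡.refl
  coeff-length (a ∷ f) (suc n) (ℕ.s≤s p) = coeff-length f n p

  coeff-constant : ∀ f → constant f ≡ coeff f 0
  coeff-constant []      = ≡.refl
  coeff-constant (a ∷ f) = ≡.refl

  coeff-drop : ∀ f n → coeff (drop 1 f) n ≡ coeff f (suc n)
  coeff-drop []      n = ≡.refl
  coeff-drop (a ∷ f) n = ≡.refl

  length-series÷ : ∀ N f g → length (series÷ N f g) ≡ N
  length-series÷ zero    f g = ≡.refl
  length-series÷ (suc N) f g = ≡.cong suc (length-series÷ N _ g)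

  -- The invariant f = g·h survives a division step: as g has constant term 1, f - h₀·g is X times
  -- the product of g and `shift h`.
  coeff-series÷ : ∀ N f g h → coeff g 0 ≡ 1ℤ → coeff f ≋ coeff g ⊗ h →
    ∀ n → n ℕ.< N → coeff (series÷ N f g) n ≡ h n
  coeff-series÷ (suc N) f g h g₀ f≋ zero _ = ≡.trans (coeff-constant f)
    (≡.trans (f≋ 0) (≡.trans (≡.cong (ℤ._* h 0) g₀) (ℤₚ.*-identityˡ _)))
  coeff-series÷ (suc N) f g h g₀ f≋ (suc n) (ℕ.s≤s n<N) =
    coeff-series÷ N (drop 1 (f -ₚ constant f ·ₚ g)) g (shift h) g₀ step n n<N
    where
    open ≡.≡-Reasoning
    f₀ : constant f ≡ h 0
    f₀ = coeff-series÷ (suc N) f g h g₀ f≋ zero (ℕ.s≤s ℕ.z≤n)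
    step : coeff (drop 1 (f -ₚ constant f ·ₚ g)) ≋ coeff g ⊗ shift h
    step n = begin
      coeff (drop 1 (f -ₚ constant f ·ₚ g)) n          ≡⟨ coeff-drop (f -ₚ constant f ·ₚ g) n ⟩
      coeff (f -ₚ constant f ·ₚ g) (suc n)             ≡⟨ coeff-- f (constant f ·ₚ g) (suc n) ⟩
      coeff f (suc n) ℤ.- coeff (constant f ·ₚ g) (suc n)
        ≡⟨ ≡.cong₂ ℤ._-_ (≡.trans (f≋ (suc n)) (⊗-sucʳ (coeff g) h n))
            (≡.trans (coeff-· (constant f) g (suc n)) (≡.cong (ℤ._* coeff g (suc n)) f₀)) ⟩
      (coeff g ⊗ shift h) n ℤ.+ coeff g (suc n) ℤ.* h 0 ℤ.- h 0 ℤ.* coeff g (suc n)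
        ≡⟨ solve 3 (λ s a b → s :+ a :* b :- b :* a := s) ≡.refl ((coeff g ⊗ shift h) n)
            (coeff g (suc n)) (h 0) ⟩
      (coeff g ⊗ shift h) n ∎
      where open IntegerCoefficients ℤₚ.+-*-commutativeRing

  -- Exactness enters as a known quotient `h`, and truncation at `length f` is harmless when `h`
  -- ends before it. Lower bounds on list lengths thus suffice, and leading coefficients need no
  -- inspection.
  coeff-÷ : ∀ f g h → coeff g 0 ≡ 1ℤ → coeff f ≋ coeff g ⊗ h →
    (∀ n → length f ℕ.≤ n → h n ≡ 0ℤ) → coeff (f ÷ₚ g) ≋ h
  coeff-÷ f g h g₀ f≋ h-bound n with ℕₚ.<-≤-connex n (length f)
  ... | inj₁ n<l = coeff-series÷ (length f) f g h g₀ f≋ n n<l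
  ... | inj₂ l≤n = ≡.trans (coeff-length (f ÷ₚ g) n
      (≡.subst (ℕ._≤ n) (≡.sym (length-series÷ (length f) f g)) l≤n))
                           (≡.sym (h-bound n l≤n))

  length-+ : ∀ f g → length f ℕ.⊔ length g ≡ length (f +ₚ g)
  length-+ []      g       = ≡.refl
  length-+ (a ∷ f) []      = ≡.refl
  length-+ (a ∷ f) (b ∷ g) = ≡.cong suc (length-+ f g)

  length-+ˡ : ∀ f g → length f ℕ.≤ length (f +ₚ g)
  length-+ˡ f g = ≡.subst (length f ℕ.≤_) (length-+ f g) (ℕₚ.m≤m⊔n _ _)

  length-+ʳ : ∀ f g → length g ℕ.≤ length (f +ₚ g)
  length-+ʳ f g = ≡.subst (length g ℕ.≤_) (length-+ f g) (ℕₚ.m≤n⊔m _ _)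

  length-* : ∀ f g → 0 ℕ.< length f → length f ℕ.+ length g ℕ.≤ suc (length (f *ₚ g))
  length-* (a ∷ []) g _ = ℕ.s≤s (≡.subst (ℕ._≤ length ((a ·ₚ g) +ₚ (0ℤ ∷ []))) (length-map (a ℤ.*_) g)
      (length-+ˡ (a ·ₚ g) (0ℤ ∷ [])))
  length-* (a ∷ f@(_ ∷ _)) g _ = ℕ.s≤s (ℕₚ.≤-trans (length-* f g (ℕ.s≤s ℕ.z≤n))
      (length-+ʳ (a ·ₚ g) (0ℤ ∷ (f *ₚ g))))

  length-X^ : ∀ k → length (X^ k) ≡ suc k
  length-X^ zero    = ≡.refl
  length-X^ (suc k) = ≡.cong suc (length-X^ k)

  length-1- : ∀ f → length f ℕ.≤ length (1ₚ -ₚ f)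
  length-1- f = ≡.subst (ℕ._≤ length (1ₚ -ₚ f)) (length-map (-1ℤ ℤ.*_) f) (length-+ʳ 1ₚ (-1ℤ ·ₚ f))

  qq : ℕ → Poly
  qq = qPochhammer (X^ 1)

  -- The triangular number n(n-1)/2; `tri (suc n)` is the degree of (q;q)_n.
  tri : ℕ → ℕ
  tri zero    = 0
  tri (suc n) = tri n ℕ.+ n

  length-qq : ∀ n → tri (suc n) ℕ.< length (qq n)
  length-qq zero    = ℕ.s≤s ℕ.z≤n
  length-qq (suc n) = ℕ.s≤s⁻¹ (begin
    2 ℕ.+ (tri (suc n) ℕ.+ suc n)             ≡⟨ ≡.cong suc (≡.sym (ℕₚ.+-suc (tri (suc n)) (suc n))) ⟩
    suc (tri (suc n)) ℕ.+ (2 ℕ.+ n)           ≤⟨ ℕₚ.+-mono-≤ (length-qq n) factor ⟩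
    length (qq n) ℕ.+ length (1ₚ -ₚ (X^ 1) *ₚ (X^ n))  ≤⟨ length-* (qq n) _ (ℕₚ.≤-trans (ℕ.s≤s ℕ.z≤n)
        (length-qq n)) ⟩
    suc (length (qq (suc n)))                 ∎)
    where
    open ℕₚ.≤-Reasoning
    factor : 2 ℕ.+ n ℕ.≤ length (1ₚ -ₚ (X^ 1) *ₚ (X^ n))
    factor = ℕₚ.≤-trans (ℕ.s≤s⁻¹ (≡.subst (λ l → 2 ℕ.+ l ℕ.≤ suc (length ((X^ 1) *ₚ (X^ n))))
        (length-X^ n) (length-* (X^ 1) (X^ n) (ℕ.s≤s ℕ.z≤n))))
                        (length-1- ((X^ 1) *ₚ (X^ n)))

  coeff-1-X^ : ∀ k f → coeff f ≋ X ^ₛ k → coeff (1ₚ -ₚ f) ≋ 1ₛ ⊕ (⊝ (X ^ₛ k))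
  coeff-1-X^ k f f≋ n = ≡.trans (coeff-- 1ₚ f n) (≡.cong₂ ℤ._-_ (coeff-1 n) (f≋ n))

  coeff-qq : ∀ n → coeff (qq n) ≋ ℤX.qfact n
  coeff-qq zero    = coeff-1
  coeff-qq (suc n) i = ≡.trans (coeff-* (qq n) _ i)
      (⊗-cong (coeff-qq n) (coeff-1-X^ (suc n) ((X^ 1) *ₚ (X^ n)) factor) i)
    where
    factor : coeff ((X^ 1) *ₚ (X^ n)) ≋ X ^ₛ suc n
    factor i = ≡.trans (coeff-* (X^ 1) (X^ n) i)
        (⊗-cong (λ i → ≡.trans (coeff-X^ 1 i) (ℤ[[X]].*-identityʳ X i)) (coeff-X^ n) i)

  coeff-qq-0 : ∀ n → coeff (qq n) 0 ≡ 1ℤ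
  coeff-qq-0 n = ≡.trans (coeff-qq n 0) (constant-qfact n)
    where
    constant-qfact : ∀ n → ℤX.qfact n 0 ≡ 1ℤ
    constant-qfact zero    = ≡.refl
    constant-qfact (suc n) rewrite constant-qfact n = ≡.refl

  X^-⊗ : ∀ k f i → ((X ^ₛ k) ⊗ f) (k ℕ.+ i) ≡ f i
  X^-⊗ zero    f i = ⊗-identityˡ f i
  X^-⊗ (suc k) f i = ≡.trans (⊗-assoc X (X ^ₛ k) f (suc (k ℕ.+ i)))
    (≡.trans (X⊗ ((X ^ₛ k) ⊗ f) (suc (k ℕ.+ i))) (X^-⊗ k f i))

  -- A crude bound, the true degree being k(n-k) for k ≤ n, chosen because it passes through
  -- Pascal's rule: the second summand is shifted by k + 1 ≤ n, and `tri` grows by exactly `n`.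
  qbinom-degree : ∀ n k i → tri n ℕ.< i → ℤX.qbinom n k i ≡ 0ℤ
  qbinom-degree n       zero    (suc i) _ = ≡.refl
  qbinom-degree zero    (suc k) i       _ = ≡.refl
  qbinom-degree (suc n) (suc k) i     t<i = ≡.cong₂ ℤ._+_
      (qbinom-degree n k i (ℕₚ.≤-<-trans (ℕₚ.m≤m+n _ n) t<i)) shifted
    where
    shifted : ((X ^ₛ suc k) ⊗ ℤX.qbinom n (suc k)) i ≡ 0ℤ
    shifted with ℕₚ.<-≤-connex n (suc k)
    ... | inj₁ n<k = ≡.trans (⊗-cong {f = X ^ₛ suc k} (λ _ → ≡.refl) (ℤX.qbinom-> n<k) i)
        (≡.trans (⊗-comm (X ^ₛ suc k) 0ₛ i) (⊗-zeroˡ (X ^ₛ suc k) i))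
    ... | inj₂ k<n with ℕₚ.m≤n⇒∃[o]m+o≡n {suc k} {i} (ℕₚ.≤-trans k<n (ℕₚ.≤-trans (ℕₚ.m≤n+m n (tri n))
        (ℕₚ.<⇒≤ t<i)))
    ... | j , ≡.refl = ≡.trans (X^-⊗ (suc k) (ℤX.qbinom n (suc k)) j) (qbinom-degree n (suc k) j
          (ℕₚ.+-cancelˡ-< n (tri n) j (ℕₚ.<-≤-trans (≡.subst (ℕ._< suc k ℕ.+ j) (ℕₚ.+-comm (tri n) n)
              t<i) (ℕₚ.+-monoˡ-≤ j k<n))))

  coeff-gaussianBinomial : ∀ {n k} → k ℕ.≤ n → coeff (gaussianBinomial n k) ≋ ℤX.qbinom n k
  coeff-gaussianBinomial {n} {k} k≤n with k ℕₚ.≤? n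
  ... | no  k≰n = ⊥-elim (k≰n k≤n)
  ... | yes _ with ℕₚ.m≤n⇒∃[o]m+o≡n k≤n
  ... | l , ≡.refl rewrite ℕₚ.m+n∸m≡n k l = coeff-÷ (qq (k ℕ.+ l)) (qq k *ₚ qq l) (ℤX.qbinom (k ℕ.+ l) k)
    (≡.trans (coeff-* (qq k) (qq l) 0) (≡.cong₂ ℤ._*_ (coeff-qq-0 k) (coeff-qq-0 l)))
    (λ i → begin
      coeff (qq (k ℕ.+ l)) i                                      ≡⟨ coeff-qq (k ℕ.+ l) i ⟩
      ℤX.qfact (k ℕ.+ l) i                                        ≡⟨ ℤX.qbinom-qfact k l i ⟨
      (ℤX.qbinom (k ℕ.+ l) k ⊗ (ℤX.qfact k ⊗ ℤX.qfact l)) i       ≡⟨ ⊗-comm (ℤX.qbinom (k ℕ.+ l) k) _ i ⟩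
      ((ℤX.qfact k ⊗ ℤX.qfact l) ⊗ ℤX.qbinom (k ℕ.+ l) k) i
        ≡⟨ ⊗-cong {g = ℤX.qbinom (k ℕ.+ l) k} (λ i → ≡.trans (coeff-* (qq k) (qq l) i)
            (⊗-cong (coeff-qq k) (coeff-qq l) i)) (λ _ → ≡.refl) i ⟨
      (coeff (qq k *ₚ qq l) ⊗ ℤX.qbinom (k ℕ.+ l) k) i            ∎)
    (λ i len≤i → qbinom-degree (k ℕ.+ l) k i (ℕₚ.≤-<-trans (ℕₚ.m≤m+n _ (k ℕ.+ l))
        (ℕₚ.<-≤-trans (length-qq (k ℕ.+ l)) len≤i)))
    where open ≡.≡-Reasoning

  length-gaussianBinomial : ∀ {n k} → k ℕ.≤ n → length (gaussianBinomial n k) ≡ length (qq n)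
  length-gaussianBinomial {n} {k} k≤n with k ℕₚ.≤? n
  ... | no  k≰n = ⊥-elim (k≰n k≤n)
  ... | yes _   = length-series÷ (length (qq n)) (qq n) _

  qnum-degree : ∀ n i → n ℕ.≤ i → ℤX.qnum n i ≡ 0ℤ
  qnum-degree zero    i       _         = ≡.refl
  qnum-degree (suc n) (suc i) (ℕ.s≤s p) =
    ≡.cong₂ ℤ._+_ (qnum-degree n (suc i) (ℕₚ.m≤n⇒m≤1+n p)) (≡.trans (≡.sym (coeff-X^ n (suc i)))
      (coeff-length (X^ n) (suc i) (ℕₚ.≤-trans (ℕₚ.≤-reflexive (length-X^ n)) (ℕ.s≤s p))))

  coeff-qNumber : ∀ n → coeff (qNumber n) ≋ ℤX.qnum n
  coeff-qNumber n = coeff-÷ (1ₚ -ₚ (X^ n)) (1ₚ -ₚ (X^ 1)) (ℤX.qnum n) ≡.refl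
    (λ i → ≡.trans (coeff-1-X^ n (X^ n) (coeff-X^ n) i) (≡.trans (≡.sym (ℤX.qnum-closed n i))
      (⊗-cong {g = ℤX.qnum n} (λ i → ≡.sym (≡.trans (coeff-1-X^ 1 (X^ 1) (coeff-X^ 1) i)
          (≡.cong (λ z → 1ₛ i ℤ.- z) (ℤ[[X]].*-identityʳ X i)))) (λ _ → ≡.refl) i)))
    (λ i l≤i → qnum-degree n i
        (ℕₚ.≤-trans (ℕₚ.≤-trans (ℕₚ.n≤1+n n) (ℕₚ.≤-reflexive (≡.sym (length-X^ n))))
        (ℕₚ.≤-trans (length-1- (X^ n)) l≤i)))

  -- The factor `q` in the second summand costs one degree. The gap 2n between `tri (2 * n)` and the
  -- degree of (q;q)_2n pays for it, except at n = 0, where both coefficients are explicit.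
  qCat-degree : ∀ n i → length (qq (2 ℕ.* n)) ℕ.≤ i → ℤX.qCat n i ≡ 0ℤ
  qCat-degree zero    (suc i) _ = ≡.cong₂ ℤ._-_ (≡.refl {x = 0ℤ}) (≡.trans (⊗-comm X 0ₛ (suc i))
      (⊗-zeroˡ X (suc i)))
  qCat-degree n@(suc m) zero l≤i = ⊥-elim (ℕₚ.n≮0 (ℕₚ.<-≤-trans (length-qq (2 ℕ.* n)) l≤i))
  qCat-degree n@(suc m) (suc i) l≤i = ≡.cong₂ ℤ._-_ (qbinom-degree (2 ℕ.* n) (n ℕ.+ 0) (suc i)
      (ℕₚ.m≤n⇒m≤1+n t<i))
      (≡.trans (X⊗ (ℤX.central n 1) (suc i)) (qbinom-degree (2 ℕ.* n) (n ℕ.+ 1) i t<i))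
    where
    t<i : tri (2 ℕ.* n) ℕ.< i
    t<i = ℕₚ.≤-trans (ℕ.s≤s (ℕₚ.≤-trans (ℕₚ.m≤m+n _ (m ℕ.+ (n ℕ.+ 0))) ℕₚ.≤-refl))
        (ℕ.s≤s⁻¹ (ℕₚ.≤-trans (≡.subst (λ j → suc j ℕ.≤ length (qq (2 ℕ.* n)))
        (ℕₚ.+-suc (tri (2 ℕ.* n)) _) (length-qq (2 ℕ.* n))) l≤i))

  coeff-qCatalan : ∀ n → coeff (qCatalan n) ≋ ℤX.qCat n
  coeff-qCatalan n = coeff-÷ (gaussianBinomial (2 ℕ.* n) n) (qNumber (suc n)) (ℤX.qCat n)
    (≡.trans (coeff-qNumber (suc n) 0) (ℤX.qnum-suc n 0))
    (λ i → ≡.trans (coeff-gaussianBinomial n≤2n i) (≡.trans (≡.sym (ℤX.qnum-qCat n i))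
      (⊗-cong {g = ℤX.qCat n} (λ i → ≡.sym (coeff-qNumber (suc n) i)) (λ _ → ≡.refl) i)))
    (λ i l≤i → qCat-degree n i (≡.subst (ℕ._≤ i) (length-gaussianBinomial n≤2n) l≤i))
    where
    n≤2n : n ℕ.≤ 2 ℕ.* n
    n≤2n = ℕₚ.m≤m+n n _

  module Evaluation {ℓ₁ ℓ₂} (R : CommutativeRing ℓ₁ ℓ₂) (q : CommutativeRing.Carrier R) where
    open CommutativeRing R
    open IntegerCoefficients R
    open Algebra.Properties.Ring ring using (-1*x≈-x)
    open Algebra.Properties.Semiring.Exp semiring
    open Relation.Binary.Reasoning.Setoid setoid
    module Q = QBinomial R q

    evaluate : Poly → Carrier
    evaluate []      = 0#
    evaluate (a ∷ f) = int a + q * evaluate f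

    evaluate-zero : ∀ f → coeff f ≋ 0ₛ → evaluate f ≈ 0#
    evaluate-zero []      _ = refl
    evaluate-zero (a ∷ f) e = begin
      int a + q * evaluate f  ≈⟨ +-cong (reflexive (≡.cong int (e 0)))
          (*-congˡ (evaluate-zero f (λ n → e (suc n)))) ⟩
      0# + q * 0#             ≈⟨ trans (+-identityˡ _) (zeroʳ q) ⟩
      0#                      ∎

    evaluate-cong : ∀ f g → coeff f ≋ coeff g → evaluate f ≈ evaluate g
    evaluate-cong []      g       e = sym (evaluate-zero g (λ n → ≡.sym (e n)))
    evaluate-cong (a ∷ f) []      e = evaluate-zero (a ∷ f) e
    evaluate-cong (a ∷ f) (b ∷ g) e = +-cong (reflexive (≡.cong int (e 0)))
        (*-congˡ (evaluate-cong f g (λ n → e (suc n))))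

    evaluate-+ : ∀ f g → evaluate (f +ₚ g) ≈ evaluate f + evaluate g
    evaluate-+ []      g       = sym (+-identityˡ _)
    evaluate-+ (a ∷ f) []      = sym (+-identityʳ _)
    evaluate-+ (a ∷ f) (b ∷ g) = trans (+-cong (int-+ a b) (*-congˡ (evaluate-+ f g)))
      (solve 5 (λ a b q u v → a :+ b :+ q :* (u :+ v) := a :+ q :* u :+ (b :+ q :* v)) refl _ _ _ _ _)

    evaluate-· : ∀ a f → evaluate (a ·ₚ f) ≈ int a * evaluate f
    evaluate-· a []      = sym (zeroʳ _)
    evaluate-· a (b ∷ f) = trans (+-cong (int-* a b) (*-congˡ (evaluate-· a f)))
      (solve 4 (λ a b q u → a :* b :+ q :* (a :* u) := a :* (b :+ q :* u)) refl _ _ _ _)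

    evaluate-- : ∀ f g → evaluate (f -ₚ g) ≈ evaluate f - evaluate g
    evaluate-- f g = trans (evaluate-+ f (-1ℤ ·ₚ g)) (+-congˡ (trans (evaluate-· -1ℤ g) (-1*x≈-x _)))

    evaluate-* : ∀ f g → evaluate (f *ₚ g) ≈ evaluate f * evaluate g
    evaluate-* []      g = sym (zeroˡ _)
    evaluate-* (a ∷ f) g = begin
      evaluate ((a ·ₚ g) +ₚ (0ℤ ∷ (f *ₚ g)))               ≈⟨ evaluate-+ (a ·ₚ g) (0ℤ ∷ (f *ₚ g)) ⟩
      evaluate (a ·ₚ g) + (0# + q * evaluate (f *ₚ g))     ≈⟨ +-cong (evaluate-· a g)
          (+-congˡ (*-congˡ (evaluate-* f g))) ⟩
      int a * evaluate g + (0# + q * (evaluate f * evaluate g))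
        ≈⟨ solve 4 (λ a g q f → a :* g :+ (con 0ℤ :+ q :* (f :* g)) := (a :+ q :* f) :* g) refl _ _ _ _ ⟩
      (int a + q * evaluate f) * evaluate g ∎

    evaluate-1 : evaluate 1ₚ ≈ 1#
    evaluate-1 = trans (+-congˡ (zeroʳ q)) (+-identityʳ 1#)

    evaluate-X^ : ∀ k → evaluate (X^ k) ≈ q ^ k
    evaluate-X^ zero    = evaluate-1
    evaluate-X^ (suc k) = trans (+-identityˡ _) (*-congˡ (evaluate-X^ k))

    -- A series cannot be evaluated at `q`. This list version of Pascal's rule has the coefficients
    -- of `ℤX.qbinom` and evaluates to `Q.qbinom`, and so connects the two.
    pascal : ℕ → ℕ → Poly
    pascal n       zero    = 1ₚ
    pascal zero    (suc k) = []
    pascal (suc n) (suc k) = pascal n k +ₚ (X^ suc k) *ₚ pascal n (suc k)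

    coeff-pascal : ∀ n k → coeff (pascal n k) ≋ ℤX.qbinom n k
    coeff-pascal zero    zero    = coeff-1
    coeff-pascal (suc n) zero    = coeff-1
    coeff-pascal zero    (suc k) = λ _ → ≡.refl
    coeff-pascal (suc n) (suc k) i = ≡.trans (coeff-+ (pascal n k) _ i)
        (≡.cong₂ ℤ._+_ (coeff-pascal n k i)
      (≡.trans (coeff-* (X^ suc k) (pascal n (suc k)) i) (⊗-cong (coeff-X^ (suc k))
          (coeff-pascal n (suc k)) i)))

    evaluate-pascal : ∀ n k → evaluate (pascal n k) ≈ Q.qbinom n k
    evaluate-pascal zero    zero    = evaluate-1
    evaluate-pascal (suc n) zero    = evaluate-1
    evaluate-pascal zero    (suc k) = refl
    evaluate-pascal (suc n) (suc k) = trans (evaluate-+ (pascal n k) _) (+-cong (evaluate-pascal n k)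
      (trans (evaluate-* (X^ suc k) (pascal n (suc k))) (*-cong (evaluate-X^ (suc k))
          (evaluate-pascal n (suc k)))))

    evaluate-qCatalan : ∀ n → evaluate (qCatalan n) ≈ Q.qCat n
    evaluate-qCatalan n = begin
      evaluate (qCatalan n)   ≈⟨ evaluate-cong (qCatalan n) (f -ₚ (X^ 1) *ₚ g) same ⟩
      evaluate (f -ₚ (X^ 1) *ₚ g)        ≈⟨ evaluate-- f ((X^ 1) *ₚ g) ⟩
      evaluate f - evaluate ((X^ 1) *ₚ g)  ≈⟨ +-cong (evaluate-pascal (2 ℕ.* n) (n ℕ.+ 0))
          (-‿cong (trans (evaluate-* (X^ 1) g)
                                             (*-cong (trans (evaluate-X^ 1) (*-identityʳ q))
                                                 (evaluate-pascal (2 ℕ.* n) (n ℕ.+ 1))))) ⟩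
      Q.qCat n ∎
      where
      f = pascal (2 ℕ.* n) (n ℕ.+ 0)
      g = pascal (2 ℕ.* n) (n ℕ.+ 1)
      same : coeff (qCatalan n) ≋ coeff (f -ₚ (X^ 1) *ₚ g)
      same i = ≡.trans (coeff-qCatalan n i)
          (≡.sym (≡.trans (coeff-- f ((X^ 1) *ₚ g) i) (≡.cong₂ ℤ._-_ (coeff-pascal (2 ℕ.* n) (n ℕ.+ 0) i)
        (≡.trans (coeff-* (X^ 1) g i) (⊗-cong (λ i → ≡.trans (coeff-X^ 1 i) (ℤ[[X]].*-identityʳ X i))
            (coeff-pascal (2 ℕ.* n) (n ℕ.+ 1)) i)))))

-- Catalan numbers modulo a prime

legendre₃-0 : ∀ m → m %ℕ 3 ≡ 0 → legendre₃ m ≡ 0ℤ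
legendre₃-0 m e with m %ℕ 3
legendre₃-0 m ≡.refl | .0 = ≡.refl

legendre₃-1 : ∀ m → m %ℕ 3 ≡ 1 → legendre₃ m ≡ 1ℤ
legendre₃-1 m e with m %ℕ 3
legendre₃-1 m ≡.refl | .1 = ≡.refl

legendre₃-2 : ∀ m → m %ℕ 3 ≡ 2 → legendre₃ m ≡ -1ℤ
legendre₃-2 m e with m %ℕ 3
legendre₃-2 m ≡.refl | .2 = ≡.refl

-- Euclid's lemma places one factor `p` at a time inside `y`.
prime-power-∣ : ∀ {p} → Prime p → ∀ a {x y} → p ℕ.^ a ∣ x ℕ.* y → ¬ (p ∣ x) → p ℕ.^ a ∣ y
prime-power-∣ pp zero {y = y} _ _ = divides y (≡.sym (ℕₚ.*-identityʳ _))
prime-power-∣ {p} pp (suc a) {x} {y} d p∤x with euclidsLemma x y pp (∣-trans (m∣m*n (p ℕ.^ a)) d)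
... | inj₁ p∣x = ⊥-elim (p∤x p∣x)
... | inj₂ (divides z ≡.refl) rewrite ℕₚ.*-comm z p =
  *-monoʳ-∣ p (prime-power-∣ pp a (*-cancelˡ-∣ p {{prime⇒nonZero pp}}
      (≡.subst (p ℕ.* p ℕ.^ a ∣_) swap d)) p∤x)
  where
  swap : x ℕ.* (p ℕ.* z) ≡ p ℕ.* (x ℕ.* z)
  swap = ≡.trans (≡.sym (ℕₚ.*-assoc x p z)) (≡.trans (≡.cong (ℕ._* z) (ℕₚ.*-comm x p))
      (ℕₚ.*-assoc p x z))

prime∣power : ∀ {p q} → Prime q → ∀ a → q ∣ p ℕ.^ a → q ∣ p
prime∣power {p} pq zero    d rewrite ∣1⇒≡1 d = divides p (≡.sym (ℕₚ.*-identityʳ p))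
prime∣power {p} pq (suc a) d with euclidsLemma p (p ℕ.^ a) pq d
... | inj₁ q∣p = q∣p
... | inj₂ q∣pᵃ = prime∣power pq a q∣pᵃ

module ℤ₁ = QBinomial ℤₚ.+-*-commutativeRing 1ℤ

+-0-rawMonoid : ∀ {ℓ} → Rel ℤ ℓ → RawMonoid _ ℓ
+-0-rawMonoid _≈_ = record { _≈_ = _≈_ ; _∙_ = ℤ._+_ ; ε = 0ℤ }

-- The relation is a parameter because the multiple is also taken in the ring
-- of integers modulo p.
×1≡+ : ∀ {ℓ} (_≈_ : Rel ℤ ℓ) n → RawMonoidDefinitions._×′_ (+-0-rawMonoid _≈_) n 1ℤ ≡ + n
×1≡+ _≈_ zero          = ≡.refl
×1≡+ _≈_ (suc zero)    = ≡.refl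
×1≡+ _≈_ (suc (suc n)) = ≡.trans (≡.cong (ℤ._+ 1ℤ) (×1≡+ _≈_ (suc n))) (≡.cong +_ (ℕₚ.+-comm (suc n) 1))

ℤ-qbinom : ∀ n k → ℤ₁.qbinom n k ≡ + (n C k)
ℤ-qbinom n k = ≡.trans (UnitParameter.qbinom-one ℤₚ.+-*-commutativeRing n k) (×1≡+ _≡_ (n C k))

ℤ-qnum : ∀ n → ℤ₁.qnum n ≡ + n
ℤ-qnum zero    = ≡.refl
ℤ-qnum (suc n) = ≡.trans (≡.cong₂ ℤ._+_ (ℤ-qnum n) (UnitParameter.1^ ℤₚ.+-*-commutativeRing n))
    (≡.cong +_ (ℕₚ.+-comm n 1))

-- `qbinom-step` in ℤ at q = 1.
C-step : ∀ k l → suc k ℕ.* ((k ℕ.+ l) C suc k) ≡ l ℕ.* ((k ℕ.+ l) C k)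
C-step k l = ℤₚ.+-injective (begin
  + (suc k ℕ.* ((k ℕ.+ l) C suc k))               ≡⟨ ℤₚ.pos-* (suc k) _ ⟩
  + suc k ℤ.* + ((k ℕ.+ l) C suc k)               ≡⟨ ≡.cong₂ ℤ._*_ (ℤ-qnum (suc k))
      (ℤ-qbinom (k ℕ.+ l) (suc k)) ⟨
  ℤ₁.qnum (suc k) ℤ.* ℤ₁.qbinom (k ℕ.+ l) (suc k) ≡⟨ ℤ₁.qbinom-step k l ⟩
  ℤ₁.qnum l ℤ.* ℤ₁.qbinom (k ℕ.+ l) k             ≡⟨ ≡.cong₂ ℤ._*_ (ℤ-qnum l) (ℤ-qbinom (k ℕ.+ l) k) ⟩
  + l ℤ.* + ((k ℕ.+ l) C k)                       ≡⟨ ℤₚ.pos-* l _ ⟨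
  + (l ℕ.* ((k ℕ.+ l) C k))                       ∎)
  where open ≡.≡-Reasoning

C-absorb : ∀ {n k} → k ℕ.≤ n → suc k ℕ.* (suc n C suc k) ≡ suc n ℕ.* (n C k)
C-absorb {n} {k} k≤n with ℕₚ.m≤n⇒∃[o]m+o≡n k≤n
... | l , ≡.refl = begin
  suc k ℕ.* (suc n C suc k)                              ≡⟨ ≡.cong (suc k ℕ.*_)
      (nCk+nC[k+1]≡[n+1]C[k+1] n k) ⟨
  suc k ℕ.* ((k ℕ.+ l) C k ℕ.+ (k ℕ.+ l) C suc k)        ≡⟨ ℕₚ.*-distribˡ-+ (suc k) ((k ℕ.+ l) C k) _ ⟩
  suc k ℕ.* ((k ℕ.+ l) C k) ℕ.+ suc k ℕ.* ((k ℕ.+ l) C suc k) ≡⟨ ≡.cong (suc k ℕ.* ((k ℕ.+ l) C k) ℕ.+_)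
      (C-step k l) ⟩
  suc k ℕ.* ((k ℕ.+ l) C k) ℕ.+ l ℕ.* ((k ℕ.+ l) C k)    ≡⟨ ℕₚ.*-distribʳ-+ ((k ℕ.+ l) C k) (suc k) l ⟨
  suc (k ℕ.+ l) ℕ.* ((k ℕ.+ l) C k)                      ∎
  where open ≡.≡-Reasoning

-- Put n = p^a. By absorption (n+j)·C(2n, n+j) = 2n·C(2n-1, n+j-1), so `n` divides the left side. If
-- `p` did not divide the coefficient, `n` would divide n + j and hence `j`.
prime∣C : ∀ {p} → Prime p → ∀ a j → 0 ℕ.< j → j ℕ.< p ℕ.^ a → p ∣ ((2 ℕ.* p ℕ.^ a) C (p ℕ.^ a ℕ.+ j))
prime∣C {p} pp a j 0<j j<n with p ∣? ((2 ℕ.* p ℕ.^ a) C (p ℕ.^ a ℕ.+ j))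
... | yes p∣C = p∣C
... | no  p∤C = ⊥-elim (>⇒∤ {{ℕ.>-nonZero 0<j}} j<n (∣m+n∣m⇒∣n (prime-power-∣ pp a n∣ p∤C) ∣-refl))
  where
  n = p ℕ.^ a
  absorb : ∀ k m → 0 ℕ.< k → k ℕ.≤ m → k ℕ.* (m C k) ≡ m ℕ.* (ℕ.pred m C ℕ.pred k)
  absorb (suc k) (suc m) _ (ℕ.s≤s k≤m) = C-absorb k≤m
  n∣ : n ∣ ((2 ℕ.* n) C (n ℕ.+ j)) ℕ.* (n ℕ.+ j)
  n∣ = ≡.subst (n ∣_)
    (≡.trans (≡.sym (absorb (n ℕ.+ j) (2 ℕ.* n) (ℕₚ.<-≤-trans 0<j (ℕₚ.m≤n+m j n))
        (ℕₚ.+-monoʳ-≤ n (ℕₚ.≤-trans (ℕₚ.<⇒≤ j<n) (ℕₚ.≤-reflexive (≡.sym (ℕₚ.+-identityʳ n)))))))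
      (ℕₚ.*-comm (n ℕ.+ j) _))
    (∣m⇒∣m*n _ (n∣m*n 2))

-- The integers modulo p

module ModP (p : ℕ) where
  infix 4 _≈_
  -- Wrapping the divisibility in a record lets `x` and `y` be recovered from the type of a
  -- congruence; the difference alone does not determine them.
  record _≈_ (x y : ℤ) : Set where
    constructor mod
    field p∣x-y : (+ p) ℤ∣.∣ (x ℤ.- y)
  open _≈_ public

  open IntegerCoefficients ℤₚ.+-*-commutativeRing using (solve; con; _:+_; _:*_; _:-_; :-_; _:=_)

  ≡⇒≈ : ∀ {x y} → x ≡ y → x ≈ y
  ≡⇒≈ {x} ≡.refl = mod (ℤ∣.divides 0ℤ (ℤₚ.+-inverseʳ x))

  private
    via : ∀ {x y z} → z ≡ x ℤ.- y → (+ p) ℤ∣.∣ z → x ≈ y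
    via e d = mod (≡.subst ((+ p) ℤ∣.∣_) e d)

  -- The residue ring is ℤ with a coarser equality, so reduction modulo `p` is the identity on
  -- elements.
  ring : CommutativeRing _ _
  ring = record
    { Carrier = ℤ ; _≈_ = _≈_ ; _+_ = ℤ._+_ ; _*_ = ℤ._*_ ; -_ = ℤ.-_ ; 0# = 0ℤ ; 1# = 1ℤ
    ; isCommutativeRing = record
      { isRing = record
        { +-isAbelianGroup = record
          { isGroup = record
            { isMonoid = record
              { isSemigroup = record
                { isMagma = record
                  { isEquivalence = record
                    { refl  = ≡⇒≈ ≡.refl
                    ; sym   = λ {x} {y} (mod d) → via (solve 2 (λ x y → :- (x :- y) := y :- x) ≡.refl x
                        y) (ℤ∣.∣m⇒∣-m d)
                    ; trans = λ {x} {y} {z} (mod d) (mod e) → via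
                        (solve 3 (λ x y z → (x :- y) :+ (y :- z) := x :- z) ≡.refl x y z)
                        (ℤ∣.∣m∣n⇒∣m+n d e)
                    }
                  ; ∙-cong = λ {x} {y} {u} {v} (mod d) (mod e) → via
                      (solve 4 (λ x y u v → (x :- y) :+ (u :- v) := (x :+ u) :- (y :+ v)) ≡.refl x y u v)
                          (ℤ∣.∣m∣n⇒∣m+n d e)
                  }
                ; assoc = λ x y z → ≡⇒≈ (ℤₚ.+-assoc x y z)
                }
              ; identity = (λ x → ≡⇒≈ (ℤₚ.+-identityˡ x)) , (λ x → ≡⇒≈ (ℤₚ.+-identityʳ x))
              }
            ; inverse = (λ x → ≡⇒≈ (ℤₚ.+-inverseˡ x)) , (λ x → ≡⇒≈ (ℤₚ.+-inverseʳ x))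
            ; ⁻¹-cong = λ {x} {y} (mod d) → via (solve 2 (λ x y → :- (x :- y) := :- x :- :- y) ≡.refl x
                y) (ℤ∣.∣m⇒∣-m d)
            }
          ; comm = λ x y → ≡⇒≈ (ℤₚ.+-comm x y)
          }
        ; *-cong = λ {x} {y} {u} {v} (mod d) (mod e) → via
            (solve 4 (λ x y u v → x :* (u :- v) :+ (x :- y) :* v := x :* u :- y :* v) ≡.refl x y u v)
            (ℤ∣.∣m∣n⇒∣m+n (ℤ∣.∣n⇒∣m*n x e) (ℤ∣.∣m⇒∣m*n v d))
        ; *-assoc = λ x y z → ≡⇒≈ (ℤₚ.*-assoc x y z)
        ; *-identity = (λ x → ≡⇒≈ (ℤₚ.*-identityˡ x)) , (λ x → ≡⇒≈ (ℤₚ.*-identityʳ x))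
        ; distrib = (λ x y z → ≡⇒≈ (ℤₚ.*-distribˡ-+ x y z)) , (λ x y z → ≡⇒≈ (ℤₚ.*-distribʳ-+ x y z))
        }
      ; *-comm = λ x y → ≡⇒≈ (ℤₚ.*-comm x y)
      }
    }

catalanℤ : ℕ → ℤ
catalanℤ = ℤ₁.qCat

-- Cross-multiplied, this is `qnum-qCat` at q = 1, where the q-number of n + 1 is n + 1.
catalan≡ : ∀ n → catalan n ≡ catalanℤ n ℚ./ 1
catalan≡ n = ℚₚ.fromℚᵘ-cong {mkℚᵘ (+ ((2 ℕ.* n) C n)) n} {mkℚᵘ (catalanℤ n) 0} (*≡* (begin
  + ((2 ℕ.* n) C n) ℤ.* 1ℤ           ≡⟨ ℤₚ.*-identityʳ _ ⟩
  + ((2 ℕ.* n) C n)                  ≡⟨ ℤ-qbinom (2 ℕ.* n) n ⟨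
  ℤ₁.qbinom (2 ℕ.* n) n              ≡⟨ ℤ₁.qnum-qCat n ⟨
  ℤ₁.qnum (suc n) ℤ.* catalanℤ n     ≡⟨ ≡.cong (ℤ._* catalanℤ n) (ℤ-qnum (suc n)) ⟩
  + suc n ℤ.* catalanℤ n             ≡⟨ ℤₚ.*-comm (+ suc n) (catalanℤ n) ⟩
  catalanℤ n ℤ.* + suc n             ∎))
  where open ≡.≡-Reasoning

integral : ℤ → ℚ
integral z = mkℚ z 0 (Coprimality.sym (1-coprimeTo _))

/1≡integral : ∀ z → z ℚ./ 1 ≡ integral z
/1≡integral z = ℚₚ.↥p/↧p≡p (integral z)

integral-+ : ∀ x y → integral x ℚ.+ integral y ≡ integral (x ℤ.+ y)
integral-+ x y = ≡.trans (≡.cong (ℚ._/ 1) (≡.cong₂ ℤ._+_ (ℤₚ.*-identityʳ x) (ℤₚ.*-identityʳ y)))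
    (/1≡integral _)

open PartialSums ℤₚ.+-*-commutativeRing using () renaming (Σ< to Σℤ; Σ<-cong to Σℤ-cong)

sum-integral : ∀ n (f : ℕ → ℚ) g → (∀ k → f k ≡ g k ℚ./ 1) → sumℚ {n} (λ k → f (toℕ k)) ≡ integral
    (Σℤ n g)
sum-integral zero    f g e = ≡.refl
sum-integral (suc n) f g e = ≡.trans (≡.cong₂ ℚ._+_ (≡.trans (e 0) (/1≡integral (g 0)))
    (sum-integral n (λ k → f (suc k)) (λ k → g (suc k)) (λ k → e (suc k))))
  (integral-+ (g 0) _)

-- The congruence for sums of Catalan numbers

module CatalanCongruence {p : ℕ} (pp : Prime p) (a : ℕ) where
  private
    n = p ℕ.^ a
    module R = CommutativeRing (ModP.ring p)
    module Rₚ = UnitParameter (ModP.ring p)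
    module Q = QBinomial (ModP.ring p) 1ℤ
    module Sₚ = PartialSums (ModP.ring p)
    open ModP p using (≡⇒≈; mod; p∣x-y)
    open Algebra.Properties.Semiring.Exp R.semiring using () renaming (_^_ to _^ₚ_)

  mod-qbinom : ∀ n k → Q.qbinom n k R.≈ + (n C k)
  mod-qbinom n k = R.trans (Rₚ.qbinom-one n k) (≡⇒≈ (×1≡+ R._≈_ (n C k)))

  mod-qCat : ∀ k → Q.qCat k R.≈ catalanℤ k
  mod-qCat k = R.+-cong (same 0) (R.-‿cong (R.*-congˡ {1ℤ} (same 1)))
    where
    same : ∀ j → Q.central k j R.≈ ℤ₁.central k j
    same j = R.trans (mod-qbinom _ (k ℕ.+ j)) (≡⇒≈ (≡.sym (ℤ-qbinom (2 ℕ.* k) (k ℕ.+ j))))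

  vanish : ∀ j → 0 ℕ.< j → j ℕ.< n → Q.central n j R.≈ 0ℤ
  vanish j 0<j j<n = R.trans (mod-qbinom (2 ℕ.* n) (n ℕ.+ j))
    (mod (≡.subst ((+ p) ℤ∣.∣_) (≡.sym (ℤₚ.+-identityʳ (+ ((2 ℕ.* n) C (n ℕ.+ j)))))
        (ℤ∣.∣ᵤ⇒∣ (prime∣C pp a j 0<j j<n))))

  Σcatalan≈ : ∀ {z} → Sₚ.Σ< n (λ k → (1ℤ ^ₚ k) R.* Q.qCat k) R.≈ z →
    Σℤ n catalanℤ R.≈ z
  Σcatalan≈ e = R.trans (Sₚ.Σ<-cong n (λ k _ → R.sym (R.trans (R.*-cong (Rₚ.1^ k) (mod-qCat k))
      (R.*-identityˡ _)))) e

  private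
    S = Σℤ n catalanℤ

  sum≡S : sumℚ {n} (λ k → catalan (toℕ k)) ≡ integral S
  sum≡S = sum-integral n catalan catalanℤ catalan≡

  integral-congruence : ∀ s t → s R.≈ t → integral s ≡ integral t [modℚ p ]
  integral-congruence s t d = 1-coprimeTo p , 1-coprimeTo p ,
    ≡.subst (λ x → (+ p) ℤ∣ᵤ.∣ (↥ x)) (≡.sym (≡.trans (≡.cong (integral s ℚ.+_) (neg t))
        (integral-+ s (ℤ.- t)))) (ℤ∣.∣⇒∣ᵤ (p∣x-y d))
    where
    neg : ∀ t → ℚ.- integral t ≡ integral (ℤ.- t)
    neg (+ zero)  = ≡.refl
    neg +[1+ _ ]  = ≡.refl
    neg -[1+ _ ]  = ≡.refl

  -- `D` is the reduced numerator times gcd(D, 2), and 3 cannot divide that gcd.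
  half-numerator : 3 ≡ p → ∀ D → (+ p) ℤ∣.∣ D → (+ p) ℤ∣ᵤ.∣ (↥ (D ℚ./ 2))
  half-numerator 3≡p D p∣D = [ (λ d → d) ,
      (λ d → ⊥-elim (>⇒∤ {2} {3} (ℕₚ.n<1+n 2) (≡.subst (_∣ 2) (≡.sym 3≡p)
      (∣-trans d (gcd[m,n]∣n ℤ.∣ D ∣ 2))))) ]′
    (euclidsLemma ℤ.∣ ↥ (D ℚ./ 2) ∣ ℤ.∣ gcd D (+ 2) ∣ pp
      (≡.subst (p ∣_) (≡.trans (≡.cong ℤ.∣_∣ (≡.sym (ℚₚ.↥-/ D 2))) (ℤₚ.abs-* (↥ (D ℚ./ 2))
          (gcd D (+ 2)))) (ℤ∣.∣⇒∣ᵤ p∣D)))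

  half-congruence : 3 ≡ p → ∀ s → s R.≈ 1ℤ → integral s ≡ ℚ.- ½ [modℚ p ]
  half-congruence 3≡p s s≈1 = 1-coprimeTo p , ≡.subst (Coprime 2) 3≡p (from-yes (coprime? 2 3)) ,
    -- The argument is the unreduced numerator that rational addition forms for s - (-1/2). It
    -- equals 2s + 1 = 2(s - 1) + 3.
    half-numerator 3≡p (s ℤ.* + 2 ℤ.+ 1ℤ ℤ.* 1ℤ)
      (≡.subst ((+ p) ℤ∣.∣_) (solve 1 (λ s → con (+ 2) :* (s :- con 1ℤ) :+ con (+ 3) := s :* con (+ 2)
          :+ con 1ℤ :* con 1ℤ) ≡.refl s)
        (ℤ∣.∣m∣n⇒∣m+n (ℤ∣.∣n⇒∣m*n (+ 2) (p∣x-y s≈1)) (ℤ∣.divides 1ℤ (≡.cong (λ k → 1ℤ ℤ.* + k) 3≡p))))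
    where open IntegerCoefficients ℤₚ.+-*-commutativeRing

  catalan-sum : sumℚ {n} (λ k → catalan (toℕ k))
    ≡ ½ ℚ.* ((+ 3 ℚ./ 1) ℚ.* (legendre₃ (+ n) ℚ./ 1) ℚ.- 1ℚ) [modℚ p ]
  catalan-sum = cases (n % 3) ≡.refl (m%n<n n 3)
    where
    rhs : ℤ → ℚ
    rhs l = ½ ℚ.* ((+ 3 ℚ./ 1) ℚ.* (l ℚ./ 1) ℚ.- 1ℚ)
    conclude : ∀ {l} → legendre₃ (+ n) ≡ l → integral S ≡ rhs l [modℚ p ] →
      sumℚ {n} (λ k → catalan (toℕ k)) ≡ rhs (legendre₃ (+ n)) [modℚ p ]
    conclude e = ≡.subst₂ (λ x l → x ≡ rhs l [modℚ p ]) (≡.sym sum≡S) (≡.sym e)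
    split : ∀ r → n % 3 ≡ r → n ≡ r ℕ.+ n / 3 ℕ.* 3
    split r e = ≡.trans (m≡m%n+[m/n]*n n 3) (≡.cong (ℕ._+ n / 3 ℕ.* 3) e)
    3∣n⇒3≡p : n ≡ n / 3 ℕ.* 3 → 3 ≡ p
    3∣n⇒3≡p n≡ with prime⇒irreducible pp (prime∣power (from-yes (prime? 3)) a (divides (n / 3) n≡))
    ... | inj₂ e = e
    S≈1 : ∀ k → n ≡ k ℕ.* 3 → S R.≈ 1ℤ
    S≈1 zero    n≡0 = ⊥-elim (ℕₚ.<-irrefl (≡.sym n≡0) (ℕₚ.m^n>0 p {{prime⇒nonZero pp}} a))
    S≈1 (suc k) n≡  = Σcatalan≈ (Rₚ.Σ-qCat≡0 n vanish k n≡)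
    -- By computation `rhs` takes the values -1/2, 1, -2 at 0, 1, -1. Residue 0 forces p = 3, and
    -- there -1/2 is congruent to 1.
    cases : ∀ r → n % 3 ≡ r → r ℕ.< 3 → sumℚ {n} (λ k → catalan (toℕ k)) ≡ rhs (legendre₃ (+ n)) [modℚ p
        ]
    cases 0 e _ = conclude (legendre₃-0 (+ n) e) (half-congruence (3∣n⇒3≡p (split 0 e)) S
        (S≈1 (n / 3) (split 0 e)))
    cases 1 e _ = conclude (legendre₃-1 (+ n) e) (integral-congruence S 1ℤ
        (Σcatalan≈ (Rₚ.Σ-qCat≡1 n vanish (n / 3) (split 1 e))))
    cases 2 e _ = conclude (legendre₃-2 (+ n) e) (integral-congruence S -[1+ 1 ]
        (Σcatalan≈ (Rₚ.Σ-qCat≡2 n vanish (n / 3) (split 2 e))))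
    cases (suc (suc (suc _))) _ (ℕ.s≤s (ℕ.s≤s (ℕ.s≤s ())))

-- Limits in a real field

module RealOrder {c ℓ₁ ℓ₂} (R : RealField c ℓ₁ ℓ₂) where
  open RealField R
  open IntegerCoefficients commutativeRing
  open Algebra.Properties.Ring ring using (-0#≈0#; x∙y⁻¹≈ε⇒x≈y)
  open Algebra.Properties.Semiring.Mult semiring using (×-homo-+; ×1-homo-*)
  open Relation.Binary.Reasoning.Setoid setoid

  infix 4 _≤_
  -- Being a negation, the weak order may be proved by contradiction even though the strict order is
  -- not decidable.
  _≤_ : Carrier → Carrier → Set ℓ₂
  x ≤ y = ¬ (y < x)

  <-asym : ∀ {x y} → x < y → ¬ (y < x)
  <-asym p r = <-irrefl refl (<-trans p r)

  ≤-reflexive : ∀ {x y} → x ≈ y → x ≤ y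
  ≤-reflexive e y<x = <-irrefl (sym e) y<x

  ≤-<-trans : ∀ {x y z} → x ≤ y → y < z → x < z
  ≤-<-trans {x} x≤y y<z = [ (λ y<x → ⊥-elim (x≤y y<x)) , (λ x<z → x<z) ]′ (<-cotransitive y<z x)

  <-≤-trans : ∀ {x y z} → x < y → y ≤ z → x < z
  <-≤-trans {z = z} x<y y≤z = [ (λ x<z → x<z) , (λ z<y → ⊥-elim (y≤z z<y)) ]′ (<-cotransitive x<y z)

  ≤-trans : ∀ {x y z} → x ≤ y → y ≤ z → x ≤ z
  ≤-trans x≤y y≤z z<x = x≤y (≤-<-trans y≤z z<x)

  <⇒0<- : ∀ {x y} → x < y → 0# < y - x
  <⇒0<- {x} x<y = <-respˡ-≈ (-‿inverseʳ x) (+-monoˡ-< (- x) x<y)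

  0<-⇒< : ∀ {x y z} → z ≈ y - x → 0# < z → x < y
  0<-⇒< {x} {y} {z} e 0<z = <-respˡ-≈ (+-identityˡ x) (<-respʳ-≈ (begin
    z + x      ≈⟨ +-congʳ e ⟩
    y - x + x  ≈⟨ solve 2 (λ x y → y :- x :+ x := y) refl x y ⟩
    y          ∎) (+-monoˡ-< x 0<z))

  ≤⇒0≤- : ∀ {x y} → x ≤ y → 0# ≤ y - x
  ≤⇒0≤- {x} {y} x≤y p = x≤y (0<-⇒< (solve 2 (λ x y → con 0ℤ :- (y :- x) := x :- y) refl x y) (<⇒0<- p))

  0≤-⇒≤ : ∀ {x y z} → z ≈ y - x → 0# ≤ z → x ≤ y
  0≤-⇒≤ {x} {y} {z} e 0≤z p = 0≤z (0<-⇒< (trans (solve 2 (λ x y → x :- y := con 0ℤ :- (y :- x)) refl x y)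
      (+-congˡ (-‿cong (sym e)))) (<⇒0<- p))

  0≤-cong : ∀ {x y} → x ≈ y → 0# ≤ x → 0# ≤ y
  0≤-cong e p = ≤-trans p (≤-reflexive e)

  <⇒≤ : ∀ {x y} → x < y → x ≤ y
  <⇒≤ = <-asym

  0<+ : ∀ {x y} → 0# < x → 0# < y → 0# < x + y
  0<+ {x} {y} 0<x 0<y = <-trans 0<y (<-respˡ-≈ (+-identityˡ y) (+-monoˡ-< y 0<x))

  -- Cotransitivity at `y`: either 0 < y, or y < x + y and hence 0 < x.
  0<+⇒ : ∀ {x y} → 0# < x + y → 0# < x ⊎ 0# < y
  0<+⇒ {x} {y} p = [ inj₂ , (λ q → inj₁ (0<-⇒< (solve 2 (λ x y → x :+ y :- y := x :- con 0ℤ) refl x y)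
      (<⇒0<- q))) ]′ (<-cotransitive p y)

  0≤+ : ∀ {x y} → 0# ≤ x → 0# ≤ y → 0# ≤ x + y
  0≤+ {x} {y} 0≤x 0≤y p = [ (λ q → 0≤x (0<-⇒< (solve 1 (λ x → :- x := con 0ℤ :- x) refl x) q))
                          , (λ q → 0≤y (0<-⇒< (solve 1 (λ x → :- x := con 0ℤ :- x) refl y) q)) ]′
    (0<+⇒ { - x} { - y} (<-respʳ-≈ (solve 2 (λ x y → con 0ℤ :- (x :+ y) := :- x :+ :- y) refl x y)
        (<⇒0<- p)))

  -- The goal is negative, so x and y may be assumed positive: otherwise
  -- tightness makes them zero.
  0≤* : ∀ {x y} → 0# ≤ x → 0# ≤ y → 0# ≤ x * y
  0≤* {x} {y} 0≤x 0≤y p = ¬¬0< 0≤x (trans (*-congʳ {y} {0#} {0#} refl) (zeroˡ y)) (λ e → *-congʳ e)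
      λ 0<x →
    ¬¬0< 0≤y (zeroʳ x) (λ e → *-congˡ e) λ 0<y → <-asym p (*-pos 0<x 0<y)
    where
    ¬¬0< : ∀ {z} → 0# ≤ z → ∀ {v} → v ≈ 0# → (z ≈ 0# → x * y ≈ v) → ¬ ¬ (0# < z)
    ¬¬0< 0≤z v≈0 xy≈v ¬0<z = <-irrefl (trans (xy≈v (<-tight 0≤z ¬0<z)) v≈0) p

  halve-≤ : ∀ {x} → 0# ≤ x + x → 0# ≤ x
  halve-≤ {x} p q = p (<-trans (<-respʳ-≈ (+-identityˡ x) (+-monoˡ-< x q)) q)

  *-cancel-0< : ∀ {x y} → 0# < x → x * y ≈ 0# → y ≈ 0#
  *-cancel-0< {x} {y} 0<x e = <-tight
    (λ y<0 → <-irrefl (trans (solve 1 (λ z → z := :- (:- z)) refl 0#)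
        (trans (-‿cong (trans -0#≈0# (sym e))) (solve 2 (λ x y → :- (x :* y) := x :* (con 0ℤ :- y)) refl
        x y))) (*-pos 0<x (<⇒0<- y<0)))
    (λ 0<y → <-irrefl (sym e) (*-pos 0<x 0<y))

  *-cancel-≤ : ∀ {x y z} → 0# < x → x * y ≤ x * z → y ≤ z
  *-cancel-≤ {x} {y} {z} 0<x p z<y = p (0<-⇒< (solve 3 (λ x y z → x :* (y :- z) := x :* y :- x :* z) refl
      x y z) (*-pos 0<x (<⇒0<- z<y)))

  fromℕ-+ : ∀ m n → fromℕ (m ℕ.+ n) ≈ fromℕ m + fromℕ n
  fromℕ-+ = ×-homo-+ 1#

  fromℕ-* : ∀ m n → fromℕ (m ℕ.* n) ≈ fromℕ m * fromℕ n
  fromℕ-* = ×1-homo-*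

  0≤fromℕ : ∀ n → 0# ≤ fromℕ n
  0≤fromℕ zero    = ≤-reflexive refl
  0≤fromℕ (suc n) = <⇒≤ (fromℕ-pos n)

  fromℕ-mono : ∀ {m n} → m ℕ.≤ n → fromℕ m ≤ fromℕ n
  fromℕ-mono {m} m≤n with ℕₚ.m≤n⇒∃[o]m+o≡n m≤n
  ... | o , ≡.refl = 0≤-⇒≤ (trans (solve 2 (λ m o → o := m :+ o :- m) refl (fromℕ m) (fromℕ o))
      (+-congʳ (sym (fromℕ-+ m o)))) (0≤fromℕ o)

  1/-inverse : ∀ n .{{_ : NonZero n}} → fromℕ n * 1/ n ≈ 1#
  1/-inverse (suc n) = proj₂ (inverse (fromℕ (suc n)) (inj₂ (fromℕ-pos n)))

  -- The axiom `inverse` is silent about signs. But `n` copies of 1/n add up to 1 > 0, so by `0<+⇒`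
  -- one of them is positive.
  1/-pos : ∀ n .{{_ : NonZero n}} → 0# < 1/ n
  1/-pos n@(suc _) = pos n (<-respʳ-≈ (sym (1/-inverse n)) 0<1)
    where
    pos : ∀ k {y} → 0# < fromℕ k * y → 0# < y
    pos zero    {y} p = ⊥-elim (<-irrefl (sym (zeroˡ y)) p)
    pos (suc k) {y} p = [ (λ q → q) , pos k ]′
        (0<+⇒ (<-respʳ-≈ (trans (distribʳ y 1# _) (+-congʳ (*-identityˡ y))) p))

  fromℕ-cancel : ∀ n {x y} → fromℕ (suc n) * x ≈ fromℕ (suc n) * y → x ≈ y
  fromℕ-cancel n {x} {y} e = begin
    x                 ≈⟨ step x ⟩
    i * (k * x)       ≈⟨ *-congˡ e ⟩
    i * (k * y)       ≈⟨ step y ⟨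
    y                 ∎
    where
    k = fromℕ (suc n)
    i = 1/ suc n
    step : ∀ x → x ≈ i * (k * x)
    step x = begin
      x            ≈⟨ *-identityˡ x ⟨
      1# * x       ≈⟨ *-congʳ (1/-inverse (suc n)) ⟨
      k * i * x    ≈⟨ solve 3 (λ k i x → k :* i :* x := i :* (k :* x)) refl k i x ⟩
      i * (k * x)  ∎

  half : Carrier → Carrier
  half x = 1/ 2 * x

  half+half : ∀ x → half x + half x ≈ x
  half+half x = begin
    -- `fromℕ 2` unfolds to 1 + (1 + 0), hence the numeral spelled out for the solver here and
    -- below.
    1/ 2 * x + 1/ 2 * x ≈⟨ solve 2 (λ h x → h :* x :+ h :* x := (con 1ℤ :+ (con 1ℤ :+ con 0ℤ)) :* h :* x)
        refl (1/ 2) x ⟩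
    fromℕ 2 * 1/ 2 * x  ≈⟨ *-congʳ (1/-inverse 2) ⟩
    1# * x              ≈⟨ *-identityˡ x ⟩
    x                   ∎

  half-pos : ∀ {x} → 0# < x → 0# < half x
  half-pos = *-pos (1/-pos 2)

  half< : ∀ {x} → 0# < x → half x < x
  half< {x} 0<x = 0<-⇒< (trans (solve 1 (λ h → h := h :+ h :- h) refl (half x)) (+-congʳ (half+half x)))
      (half-pos 0<x)

  infix 4 ∣_∣≤_
  -- Both halves are nonnegativity statements, so an estimate becomes a solver identity combined
  -- with `0≤+` and `0≤*`.
  ∣_∣≤_ : Carrier → Carrier → Set ℓ₂
  ∣ x ∣≤ a = (0# ≤ a - x) × (0# ≤ a + x)

  abs-cong : ∀ {x y a b} → x ≈ y → a ≈ b → ∣ x ∣≤ a → ∣ y ∣≤ b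
  abs-cong e f (p , r) = 0≤-cong (+-cong f (-‿cong e)) p , 0≤-cong (+-cong f e) r

  abs-0 : ∀ {a} → 0# ≤ a → ∣ 0# ∣≤ a
  abs-0 {a} p = 0≤-cong (solve 1 (λ a → a := a :- con 0ℤ) refl a) p , 0≤-cong (sym (+-identityʳ a)) p

  abs-self : ∀ {a} → 0# ≤ a → ∣ a ∣≤ a
  abs-self {a} p = ≤-reflexive (sym (-‿inverseʳ a)) , 0≤+ p p

  abs-neg : ∀ {x a} → ∣ x ∣≤ a → ∣ - x ∣≤ a
  abs-neg {x} {a} (p , r) = 0≤-cong (solve 2 (λ a x → a :+ x := a :- :- x) refl a x) r , p

  abs-+ : ∀ {x y a b} → ∣ x ∣≤ a → ∣ y ∣≤ b → ∣ x + y ∣≤ a + b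
  abs-+ {x} {y} {a} {b} (p , r) (p′ , r′) =
    0≤-cong (solve 4 (λ x y a b → a :- x :+ (b :- y) := a :+ b :- (x :+ y)) refl x y a b) (0≤+ p p′) ,
    0≤-cong (solve 4 (λ x y a b → a :+ x :+ (b :+ y) := a :+ b :+ (x :+ y)) refl x y a b) (0≤+ r r′)

  -- Twice a slack is a sum of products of slacks: 2(ab - xy) = (a-x)(b+y) + (a+x)(b-y), and
  -- likewise for ab + xy.
  abs-* : ∀ {x y a b} → ∣ x ∣≤ a → ∣ y ∣≤ b → ∣ x * y ∣≤ a * b
  abs-* {x} {y} {a} {b} (p , r) (p′ , r′) =
    halve-≤ (0≤-cong (solve 4 (λ x y a b → (a :- x) :* (b :+ y) :+ (a :+ x) :* (b :- y) :=
        (a :* b :- x :* y) :+ (a :* b :- x :* y)) refl x y a b) (0≤+ (0≤* p r′) (0≤* r p′))) ,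
    halve-≤ (0≤-cong (solve 4 (λ x y a b → (a :- x) :* (b :- y) :+ (a :+ x) :* (b :+ y) :=
        (a :* b :+ x :* y) :+ (a :* b :+ x :* y)) refl x y a b) (0≤+ (0≤* p p′) (0≤* r r′)))

  abs-weaken : ∀ {x a b} → a ≤ b → ∣ x ∣≤ a → ∣ x ∣≤ b
  abs-weaken {x} {a} {b} a≤b (p , r) =
    0≤-cong (solve 3 (λ x a b → b :- a :+ (a :- x) := b :- x) refl x a b) (0≤+ (≤⇒0≤- a≤b) p) ,
    0≤-cong (solve 3 (λ x a b → b :- a :+ (a :+ x) := b :+ x) refl x a b) (0≤+ (≤⇒0≤- a≤b) r)

  abs-bounded : ∀ x → ∃[ k ] ∣ x ∣≤ fromℕ (suc k)
  abs-bounded x with archimedean x | archimedean (- x)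
  ... | m , x<m | n , -x<n = m ℕ.+ n ,
    ≤⇒0≤- (≤-trans (<⇒≤ x<m) (fromℕ-mono (ℕₚ.m≤n⇒m≤1+n (ℕₚ.m≤m+n m n)))) ,
    0≤-cong (+-congˡ (solve 1 (λ x → :- :- x := x) refl x))
        (≤⇒0≤- (≤-trans (<⇒≤ -x<n) (fromℕ-mono (ℕₚ.m≤n⇒m≤1+n (ℕₚ.m≤n+m n m)))))

  abs-<⇒≤ : ∀ {x ε} → ∣ x ∣< ε → ∣ x ∣≤ ε
  abs-<⇒≤ {x} {ε} (p , r) = ≤⇒0≤- (<⇒≤ r) , 0≤-cong (solve 2 (λ x ε → x :- :- ε := ε :+ x) refl x ε)
      (≤⇒0≤- (<⇒≤ p))

  abs-≤⇒< : ∀ {x δ ε} → δ < ε → ∣ x ∣≤ δ → ∣ x ∣< ε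
  abs-≤⇒< {x} {δ} {ε} δ<ε (p , r) =
    <-≤-trans (0<-⇒< (solve 2 (λ δ ε → ε :- δ := :- δ :- :- ε) refl δ ε) (<⇒0<- δ<ε))
        (0≤-⇒≤ (solve 2 (λ x δ → δ :+ x := x :- :- δ) refl x δ) r) ,
    ≤-<-trans (0≤-⇒≤ refl p) δ<ε

  -- Null sequences, with the weak inequality that the estimates produce; halving ε recovers the
  -- strict one in `⟶`.
  Small : (ℕ → Carrier) → Set _
  Small u = ∀ ε → 0# < ε → ∃[ N ] (∀ n → N ℕ.≤ n → ∣ u n ∣≤ ε)

  small⇒⟶ : ∀ {u l} → Small (λ n → u n - l) → u ⟶ l
  small⇒⟶ s ε 0<ε = let N , p = s (half ε) (half-pos 0<ε) in N , λ n N≤n → abs-≤⇒< (half< 0<ε) (p n N≤n)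

  ⟶⇒small : ∀ {u l} → u ⟶ l → Small (λ n → u n - l)
  ⟶⇒small s ε 0<ε = let N , p = s ε 0<ε in N , λ n N≤n → abs-<⇒≤ (p n N≤n)

  small-cong : ∀ {u v} → (∀ n → u n ≈ v n) → Small u → Small v
  small-cong e s ε 0<ε = let N , p = s ε 0<ε in N , λ n N≤n → abs-cong (e n) refl (p n N≤n)

  small-neg : ∀ {u} → Small u → Small (λ n → - u n)
  small-neg s ε 0<ε = let N , p = s ε 0<ε in N , λ n N≤n → abs-neg (p n N≤n)

  small-+ : ∀ {u v} → Small u → Small v → Small (λ n → u n + v n)
  small-+ s t ε 0<ε = let M , p = s (half ε) (half-pos 0<ε) ; N , r = t (half ε) (half-pos 0<ε) in M ℕ.⊔
      N , λ n le →
    abs-cong refl (half+half ε) (abs-+ (p n (ℕₚ.≤-trans (ℕₚ.m≤m⊔n M N) le))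
        (r n (ℕₚ.≤-trans (ℕₚ.m≤n⊔m M N) le)))

  small-* : ∀ k N (u : ℕ → Carrier) {v} → (∀ n → N ℕ.≤ n → ∣ u n ∣≤ fromℕ (suc k)) → Small v → Small
      (λ n → u n * v n)
  small-* k M u b s ε 0<ε = let N , r = s (1/ suc k * ε) (*-pos (1/-pos (suc k)) 0<ε) in M ℕ.⊔ N , λ n
      le →
    abs-cong refl (trans (sym (*-assoc _ _ _)) (trans (*-congʳ (1/-inverse (suc k))) (*-identityˡ ε)))
      (abs-* (b n (ℕₚ.≤-trans (ℕₚ.m≤m⊔n M N) le)) (r n (ℕₚ.≤-trans (ℕₚ.m≤n⊔m M N) le)))

  small-scale : ∀ a {v} → Small v → Small (λ n → a * v n)
  small-scale a s = let k , b = abs-bounded a in small-* k 0 (λ _ → a) (λ _ _ → b) s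

  small-const : ∀ {x} → Small (λ _ → x) → x ≈ 0#
  small-const {x} s = <-tight
    (λ x<0 → contra (-x>0 x<0) (abs-neg (bound (-x>0 x<0))))
    (λ 0<x → contra 0<x (bound 0<x))
    where
    -x>0 : x < 0# → 0# < - x
    -x>0 x<0 = <-respʳ-≈ (+-identityˡ (- x)) (<⇒0<- x<0)
    bound : ∀ {ε} → 0# < ε → ∣ x ∣≤ half ε
    bound {ε} 0<ε = let N , p = s (half ε) (half-pos 0<ε) in p N ℕₚ.≤-refl
    contra : ∀ {y} → 0# < y → ¬ (∣ y ∣≤ half y)
    contra 0<y (p , _) = 0≤-⇒≤ refl p (half< 0<y)

  ⟶-unique : ∀ {u v l m} → Small (λ n → u n - v n) → u ⟶ l → v ⟶ m → l ≈ m
  ⟶-unique {u} {v} {l} {m} d s t = x∙y⁻¹≈ε⇒x≈y l m (small-const (small-cong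
    (λ n → solve 4 (λ u v l m → u :- v :+ (:- (u :- l) :+ (v :- m)) := l :- m) refl (u n) (v n) l m)
    (small-+ d (small-+ (small-neg (⟶⇒small s)) (⟶⇒small t)))))

  small-0 : ∀ {u} → (∀ n → u n ≈ 0#) → Small u
  small-0 e ε 0<ε = 0 , λ n _ → abs-cong (sym (e n)) refl (abs-0 (<⇒≤ 0<ε))

  ⟶-+ : ∀ {u v l m} → u ⟶ l → v ⟶ m → (λ n → u n + v n) ⟶ (l + m)
  ⟶-+ {u} {v} {l} {m} s t = small⇒⟶ (small-cong
    (λ n → solve 4 (λ u v l m → u :- l :+ (v :- m) := u :+ v :- (l :+ m)) refl (u n) (v n) l m)
    (small-+ (⟶⇒small s) (⟶⇒small t)))

  ⟶-neg : ∀ {u l} → u ⟶ l → (λ n → - u n) ⟶ (- l)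
  ⟶-neg {u} {l} s = small⇒⟶ (small-cong
    (λ n → solve 2 (λ u l → :- (u :- l) := :- u :- :- l) refl (u n) l) (small-neg (⟶⇒small s)))

  -- uv - lm = (u-l)(v-m) + l(v-m) + m(u-l). In the first product u - l is eventually bounded by 1,
  -- by taking ε = 1 in its own convergence.
  ⟶-* : ∀ {u v l m} → u ⟶ l → v ⟶ m → (λ n → u n * v n) ⟶ (l * m)
  ⟶-* {u} {v} {l} {m} s t = let N , p = ⟶⇒small s 1# 0<1 in small⇒⟶ (small-cong
    (λ n → solve 4 (λ u v l m → (u :- l) :* (v :- m) :+ (l :* (v :- m) :+ m :* (u :- l)) := u :* v
        :- l :* m) refl (u n) (v n) l m)
    (small-+ (small-* 0 N (λ n → u n - l) (λ n le → abs-cong refl (sym (+-identityʳ 1#)) (p n le))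
        (⟶⇒small t))
      (small-+ (small-scale l (⟶⇒small t)) (small-scale m (⟶⇒small s)))))

  ⟶-cong : ∀ {u v l m} → (∀ n → u n ≈ v n) → l ≈ m → u ⟶ l → v ⟶ m
  ⟶-cong {u} {l = l} e f s = small⇒⟶ (small-cong {λ n → u n - l} (λ n → +-cong (e n) (-‿cong f))
      (⟶⇒small s))

  isCauchy : ∀ u → (∀ ε → 0# < ε → ∃[ N ] (∀ n → N ℕ.≤ n → ∀ j → ∣ u (n ℕ.+ j) - u n ∣≤ ε)) → IsCauchy u
  isCauchy u h ε 0<ε = let N , gap = h (half ε) (half-pos 0<ε) in N , near (half< 0<ε) N gap
    where
    near : ∀ {δ} → δ < ε → ∀ N → (∀ n → N ℕ.≤ n → ∀ j → ∣ u (n ℕ.+ j) - u n ∣≤ δ) →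
      ∀ m n → N ℕ.≤ m → N ℕ.≤ n → ∣ u m - u n ∣< ε
    near δ<ε N gap m n N≤m N≤n with ℕₚ.≤-total m n
    near δ<ε N gap m n N≤m N≤n | inj₁ m≤n with ℕₚ.m≤n⇒∃[o]m+o≡n m≤n
    ... | j , ≡.refl = abs-≤⇒< δ<ε (abs-cong (solve 2 (λ x y → :- (x :- y) := y :- x) refl (u (m ℕ.+ j))
        (u m)) refl (abs-neg (gap m N≤m j)))
    near δ<ε N gap m n N≤m N≤n | inj₂ n≤m with ℕₚ.m≤n⇒∃[o]m+o≡n n≤m
    ... | j , ≡.refl = abs-≤⇒< δ<ε (gap n N≤n j)

-- The exponential function

module CauchyProduct {ℓ₁ ℓ₂} (R : CommutativeRing ℓ₁ ℓ₂) where
  open CommutativeRing R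
  open IntegerCoefficients R
  open PartialSums R
  open PowerSeries R
  open Relation.Binary.Reasoning.Setoid setoid

  Σ<-split : ∀ n j f → Σ< (n ℕ.+ j) f ≈ Σ< n f + Σ< j (λ i → f (n ℕ.+ i))
  Σ<-split zero    j f = sym (+-identityˡ _)
  Σ<-split (suc n) j f = trans (+-congˡ (Σ<-split n j (shift f))) (sym (+-assoc _ _ _))

  Σ<-⊗ : ∀ n f g → Σ< (suc n) (f ⊗ g) ≈ f 0 * Σ< (suc n) g + Σ< n (shift f ⊗ g)
  Σ<-⊗ n f g = begin
    f 0 * g 0 + Σ< n (λ k → f 0 * g (suc k) + (shift f ⊗ g) k)
      ≈⟨ +-congˡ (Σ<-+ n (λ k → f 0 * g (suc k)) (shift f ⊗ g)) ⟩
    f 0 * g 0 + (Σ< n (λ k → f 0 * g (suc k)) + Σ< n (shift f ⊗ g))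
      ≈⟨ +-congˡ (+-congʳ (Σ<-* n (f 0) (shift g))) ⟩
    f 0 * g 0 + (f 0 * Σ< n (shift g) + Σ< n (shift f ⊗ g))
      ≈⟨ solve 4 (λ a b s t → a :* b :+ (a :* s :+ t) := a :* (b :+ s) :+ t) refl _ _ _ _ ⟩
    f 0 * (g 0 + Σ< n (shift g)) + Σ< n (shift f ⊗ g) ∎

  -- The two limits are separate because peeling `f` shortens only the first sum. When m ≥ n the
  -- recursion `remainder-suc` contains sums and products but no subtraction, which is what allows
  -- termwise majorisation.
  remainder : Series → Series → ℕ → ℕ → Carrier
  remainder f g n m = Σ< n f * Σ< m g - Σ< n (f ⊗ g)

  remainder-suc : ∀ f g n j → remainder f g (suc n) (suc n ℕ.+ j) ≈
    f 0 * Σ< j (λ i → g (suc n ℕ.+ i)) + remainder (shift f) g n (suc n ℕ.+ j)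
  remainder-suc f g n j = begin
    (f 0 + Σ< n (shift f)) * s - Σ< (suc n) (f ⊗ g)
      ≈⟨ +-congˡ (-‿cong (Σ<-⊗ n f g)) ⟩
    (f 0 + Σ< n (shift f)) * s - (f 0 * t + Σ< n (shift f ⊗ g))
      ≈⟨ solve 5 (λ a b s t w → (a :+ b) :* s :- (a :* t :+ w) := a :* (s :- t) :+ (b :* s :- w)) refl _
          _ _ _ _ ⟩
    f 0 * (s - t) + (Σ< n (shift f) * s - Σ< n (shift f ⊗ g))
      ≈⟨ +-congʳ (*-congˡ (trans (+-congʳ (Σ<-split (suc n) j g))
          (solve 2 (λ t u → t :+ u :- t := u) refl t _))) ⟩
    f 0 * Σ< j (λ i → g (suc n ℕ.+ i)) + remainder (shift f) g n (suc n ℕ.+ j) ∎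
    where
    s = Σ< (suc n ℕ.+ j) g
    t = Σ< (suc n) g

-- What the functional equation of the exponential series asks of a ring; supplied below for both ℝ
-- and ℂ.
record InverseFactorials {ℓ₁ ℓ₂} (R : CommutativeRing ℓ₁ ℓ₂) : Set (ℓ₁ ⊔ ℓ₂) where
  open CommutativeRing R
  open Algebra.Properties.Semiring.Mult semiring using () renaming (_×_ to _×′_)
  field
    1/!      : ℕ → Carrier
    1/!-zero : 1/! 0 ≈ 1#
    1/!-suc  : ∀ n → (suc n ×′ 1#) * 1/! (suc n) ≈ 1/! n
    cancel   : ∀ n {x y} → (suc n ×′ 1#) * x ≈ (suc n ×′ 1#) * y → x ≈ y

module ExponentialSeries {ℓ₁ ℓ₂} (R : CommutativeRing ℓ₁ ℓ₂) (inverseFactorials : InverseFactorials R) where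
  open CommutativeRing R
  open Algebra.Properties.Semiring.Mult semiring using () renaming (_×_ to _×′_)
  open InverseFactorials inverseFactorials
  open IntegerCoefficients R
  open PowerSeries R
  open Algebra.Properties.Semiring.Exp semiring
  open Relation.Binary.Reasoning.Setoid setoid

  expTerm : Carrier → Series
  expTerm x n = 1/! n * x ^ n

  expTerm-cong : ∀ {x y} → x ≈ y → expTerm x ≋ expTerm y
  expTerm-cong e n = *-congˡ (^-congˡ n e)

  expTerm-suc : ∀ x n → (suc n ×′ 1#) * expTerm x (suc n) ≈ x * expTerm x n
  expTerm-suc x n = begin
    (suc n ×′ 1#) * (1/! (suc n) * (x * x ^ n)) ≈⟨ solve 4 (λ n i x y → n :* (i :* (x :* y)) := x :*
        ((n :* i) :* y)) refl (suc n ×′ 1#) (1/! (suc n)) x (x ^ n) ⟩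
    x * ((suc n ×′ 1#) * 1/! (suc n) * x ^ n)   ≈⟨ *-congˡ (*-congʳ (1/!-suc n)) ⟩
    x * (1/! n * x ^ n)                         ∎

  expTerm-0 : ∀ x → expTerm x 0 ≈ 1#
  expTerm-0 x = trans (*-identityʳ _) 1/!-zero

  -- The binomial theorem in the form of a differential equation: by `expTerm-suc` each series
  -- satisfies f′ = x·f.
  expTerm-⊗ : ∀ x y → expTerm x ⊗ expTerm y ≋ expTerm (x + y)
  expTerm-⊗ x y = exp-⊗ cancel {x} {y} (expTerm-suc x) (expTerm-suc y) (expTerm-suc (x + y))
    (trans (*-cong (expTerm-0 x) (expTerm-0 y)) (trans (*-identityˡ 1#) (sym (expTerm-0 (x + y)))))

-- The real exponential series and its tails

module RealExponential {c ℓ₁ ℓ₂} (R : RealField c ℓ₁ ℓ₂) where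
  open RealField R
  open RealOrder R
  open IntegerCoefficients commutativeRing
  open PartialSums commutativeRing
  open PowerSeries commutativeRing using (_⊗_; shift)
  open CauchyProduct commutativeRing
  open Relation.Binary.Reasoning.Setoid setoid
  open Algebra.Properties.Semiring.Exp semiring using (_^_)

  1/! : ℕ → Carrier
  1/! n = (1/ (n !)) {{n ℕₚ.!≢0}}

  inverse-unique : ∀ {a x y} → a * x ≈ 1# → a * y ≈ 1# → x ≈ y
  inverse-unique {a} {x} {y} e f = begin
    x            ≈⟨ *-identityʳ x ⟨
    x * 1#       ≈⟨ *-congˡ f ⟨
    x * (a * y)  ≈⟨ solve 3 (λ x a y → x :* (a :* y) := (a :* x) :* y) refl x a y ⟩
    a * x * y    ≈⟨ *-congʳ e ⟩
    1# * y       ≈⟨ *-identityˡ y ⟩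
    y            ∎

  1/!-zero : 1/! 0 ≈ 1#
  1/!-zero = inverse-unique (1/-inverse 1) (trans (*-identityʳ _) (+-identityʳ 1#))

  1/!-suc : ∀ n → fromℕ (suc n) * 1/! (suc n) ≈ 1/! n
  1/!-suc n = inverse-unique (begin
    fromℕ (n !) * (fromℕ (suc n) * 1/! (suc n)) ≈⟨ solve 3 (λ a b x → a :* (b :* x) := b :* a :* x) refl
        (fromℕ (n !)) (fromℕ (suc n)) (1/! (suc n)) ⟩
    fromℕ (suc n) * fromℕ (n !) * 1/! (suc n)   ≈⟨ *-congʳ (fromℕ-* (suc n) (n !)) ⟨
    fromℕ (suc n !) * 1/! (suc n)               ≈⟨ 1/-inverse (suc n !) {{suc n ℕₚ.!≢0}} ⟩
    1#                                          ∎) (1/-inverse (n !) {{n ℕₚ.!≢0}})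

  inverseFactorials : InverseFactorials commutativeRing
  inverseFactorials = record { 1/! = 1/! ; 1/!-zero = 1/!-zero ; 1/!-suc = 1/!-suc ; cancel =
      fromℕ-cancel }

  open ExponentialSeries commutativeRing inverseFactorials public

  ≤-refl : ∀ {x} → x ≤ x
  ≤-refl = ≤-reflexive refl

  +-mono-≤ : ∀ {x y u v} → x ≤ y → u ≤ v → x + u ≤ y + v
  +-mono-≤ {x} {y} {u} {v} p r = 0≤-⇒≤ (solve 4 (λ x y u v → y :- x :+ (v :- u) := y :+ v :- (x :+ u))
      refl x y u v) (0≤+ (≤⇒0≤- p) (≤⇒0≤- r))

  *-monoʳ-≤ : ∀ {x y z} → 0# ≤ z → x ≤ y → z * x ≤ z * y
  *-monoʳ-≤ {x} {y} {z} p r = 0≤-⇒≤ (solve 3 (λ x y z → z :* (y :- x) := z :* y :- z :* x) refl x y z)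
      (0≤* p (≤⇒0≤- r))

  *-monoˡ-≤ : ∀ {x y z} → 0# ≤ z → x ≤ y → x * z ≤ y * z
  *-monoˡ-≤ {x} {y} {z} p r = 0≤-⇒≤ (solve 3 (λ x y z → (y :- x) :* z := y :* z :- x :* z) refl x y z)
      (0≤* (≤⇒0≤- r) p)

  0≤^ : ∀ {x} → 0# ≤ x → ∀ n → 0# ≤ x ^ n
  0≤^ p zero    = <⇒≤ 0<1
  0≤^ p (suc n) = 0≤* p (0≤^ p n)

  0≤1/! : ∀ n → 0# ≤ 1/! n
  0≤1/! n = <⇒≤ (1/-pos (n !) {{n ℕₚ.!≢0}})

  0≤expTerm : ∀ {x} → 0# ≤ x → ∀ n → 0# ≤ expTerm x n
  0≤expTerm p n = 0≤* (0≤1/! n) (0≤^ p n)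

  0≤Σ : ∀ n {f : ℕ → Carrier} → (∀ k → 0# ≤ f k) → 0# ≤ Σ< n f
  0≤Σ zero    p = ≤-refl
  0≤Σ (suc n) p = 0≤+ (p 0) (0≤Σ n (λ k → p (suc k)))

  Σ<-mono : ∀ n j {f : ℕ → Carrier} → (∀ k → 0# ≤ f k) → Σ< n f ≤ Σ< (n ℕ.+ j) f
  Σ<-mono n j {f} p = 0≤-⇒≤ (trans (solve 2 (λ s t → t := s :+ t :- s) refl (Σ< n f) _)
      (+-congʳ (sym (Σ<-split n j f)))) (0≤Σ j (λ i → p (n ℕ.+ i)))

  -- The square of index pairs i < n, j < m lies in the triangle i + j < n + m, and the remaining
  -- products are nonnegative.
  Σ*Σ≤Σ⊗ : ∀ n m {f g : ℕ → Carrier} → (∀ k → 0# ≤ f k) → (∀ k → 0# ≤ g k) → Σ< n f * Σ< m g ≤ Σ<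
      (n ℕ.+ m) (f ⊗ g)
  Σ*Σ≤Σ⊗ zero    m {f} {g} p r = ≤-trans (≤-reflexive (zeroˡ _)) (0≤Σ m 0≤⊗)
    where
    ⊗-nonneg : ∀ n {f : ℕ → Carrier} → (∀ k → 0# ≤ f k) → 0# ≤ (f ⊗ g) n
    ⊗-nonneg zero    p = 0≤* (p 0) (r 0)
    ⊗-nonneg (suc n) p = 0≤+ (0≤* (p 0) (r (suc n))) (⊗-nonneg n (λ k → p (suc k)))
    0≤⊗ : ∀ k → 0# ≤ (f ⊗ g) k
    0≤⊗ k = ⊗-nonneg k p
  Σ*Σ≤Σ⊗ (suc n) m {f} {g} p r =
    ≤-trans (≤-reflexive (distribʳ _ _ _)) (≤-trans
      (+-mono-≤ (*-monoʳ-≤ (p 0) (≡.subst (λ i → Σ< m g ≤ Σ< i g) (ℕₚ.+-comm m (suc n))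
          (Σ<-mono m (suc n) r))) (Σ*Σ≤Σ⊗ n m (λ k → p (suc k)) r))
      (≤-reflexive (sym (Σ<-⊗ (n ℕ.+ m) f g))))

  halving-sum : ∀ n {f : ℕ → Carrier} → (∀ k → 0# ≤ f k) → (∀ k → f (suc k) + f (suc k) ≤ f k) →
      Σ< n f ≤ f 0 + f 0
  halving-sum zero    p h = 0≤+ (p 0) (p 0)
  halving-sum (suc n) p h = +-mono-≤ ≤-refl (≤-trans (halving-sum n (λ k → p (suc k)) (λ k → h (suc k)))
      (h 0))

  -- The factor n + 1 in place of 2^n is enough, and it meets the Archimedean axiom directly.
  halving-decay : ∀ n {f : ℕ → Carrier} → (∀ k → 0# ≤ f k) → (∀ k → f (suc k) + f (suc k) ≤ f k) → fromℕ
      (suc n) * f n ≤ f 0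
  halving-decay zero    {f} p h = ≤-reflexive (trans (*-congʳ (+-identityʳ 1#)) (*-identityˡ _))
  halving-decay (suc n) {f} p h = ≤-trans
    (0≤-⇒≤ (solve 2 (λ k x → k :* x := (con 1ℤ :+ k) :* (x :+ x) :- (con 1ℤ :+ (con 1ℤ :+ k)) :* x) refl
        (fromℕ n) (f (suc n))) (0≤* (0≤fromℕ n) (p (suc n))))
    (≤-trans (*-monoʳ-≤ (0≤fromℕ (suc n)) (h n)) (halving-decay n p h))

  module Tail (K : ℕ) where
    M = fromℕ (suc K)
    τ = expTerm M

    0≤τ : ∀ n → 0# ≤ τ n
    0≤τ = 0≤expTerm (0≤fromℕ (suc K))

    -- This is 2M: from here on the ratio M/(n+1) of neighbouring terms is at most 1/2.
    peak : ℕ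
    peak = suc K ℕ.+ suc K

    τ-halving : ∀ n → peak ℕ.≤ n → τ (suc n) + τ (suc n) ≤ τ n
    τ-halving n s≤n = *-cancel-≤ (fromℕ-pos K) (≤-trans
      (≤-reflexive (solve 2 (λ m t → m :* (t :+ t) := (m :+ m) :* t) refl M (τ (suc n))))
      (≤-trans (*-monoˡ-≤ (0≤τ (suc n)) (≤-trans (≤-reflexive (sym (fromℕ-+ (suc K) (suc K))))
          (fromℕ-mono (ℕₚ.m≤n⇒m≤1+n s≤n))))
        (≤-reflexive (expTerm-suc M n))))

    shifted-halving : ∀ n → peak ℕ.≤ n → ∀ k → τ (n ℕ.+ suc k) + τ (n ℕ.+ suc k) ≤ τ (n ℕ.+ k)
    shifted-halving n s≤n k = ≡.subst (λ i → τ i + τ i ≤ τ (n ℕ.+ k)) (≡.sym (ℕₚ.+-suc n k))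
        (τ-halving (n ℕ.+ k) (ℕₚ.≤-trans s≤n (ℕₚ.m≤m+n n k)))

    tail : ℕ → ℕ → Carrier
    tail n j = Σ< j (λ i → τ (n ℕ.+ i))

    tail-small : ∀ ε → 0# < ε → ∃[ N ] (∀ n → N ℕ.≤ n → ∀ j → tail n j ≤ ε)
    tail-small ε 0<ε with inverse ε (inj₂ 0<ε)
    ... | y , εy≈1 with archimedean ((τ peak + τ peak) * y)
    -- `B` exceeds 2τ(peak)/ε. For n = peak + i with i ≥ B, the tail is at most 2τ(n) ≤
    -- 2τ(peak)/(i+1) ≤ ε.
    ... | B , lt = peak ℕ.+ B , bound
      where
      x = τ peak + τ peak
      x≤Bε : x ≤ fromℕ B * ε
      x≤Bε = ≤-trans (≤-reflexive (begin
        x            ≈⟨ *-identityʳ x ⟨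
        x * 1#       ≈⟨ *-congˡ εy≈1 ⟨
        x * (ε * y)  ≈⟨ solve 3 (λ x e y → x :* (e :* y) := x :* y :* e) refl x ε y ⟩
        x * y * ε    ∎)) (*-monoˡ-≤ (<⇒≤ 0<ε) (<⇒≤ lt))
      bound : ∀ n → peak ℕ.+ B ℕ.≤ n → ∀ j → tail n j ≤ ε
      bound n le j with ℕₚ.m≤n⇒∃[o]m+o≡n (ℕₚ.≤-trans (ℕₚ.m≤m+n peak B) le)
      ... | i , ≡.refl = ≤-trans (halving-sum j (λ k → 0≤τ (peak ℕ.+ i ℕ.+ k))
          (shifted-halving (peak ℕ.+ i) (ℕₚ.m≤m+n peak i)))
        (≡.subst (λ k → τ k + τ k ≤ ε) (≡.sym (ℕₚ.+-identityʳ (peak ℕ.+ i)))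
          (*-cancel-≤ (fromℕ-pos i) (≤-trans (≤-reflexive (distribˡ _ _ _))
            (≤-trans (+-mono-≤ decay decay)
                (≤-trans x≤Bε (*-monoˡ-≤ (<⇒≤ 0<ε)
                (fromℕ-mono (ℕₚ.m≤n⇒m≤1+n (ℕₚ.+-cancelˡ-≤ peak _ _ le)))))))))
        where
        decay : fromℕ (suc i) * τ (peak ℕ.+ i) ≤ τ peak
        decay = ≡.subst (λ k → fromℕ (suc i) * τ (peak ℕ.+ i) ≤ τ k) (ℕₚ.+-identityʳ peak)
          (halving-decay i {λ k → τ (peak ℕ.+ k)} (λ k → 0≤τ (peak ℕ.+ k))
              (shifted-halving peak ℕₚ.≤-refl))

-- The complex exponential function

module ComplexExponential {c ℓ₁ ℓ₂} (R : RealField c ℓ₁ ℓ₂) where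
  open Complex R
  open RealOrder R
  module Exp = RealExponential R
  module ℝ = RealField R
  module ℂR = CommutativeRing ℂ-commutativeRing
  open ℝ using () renaming (Carrier to ℝ)
  open IntegerCoefficients ℝ.commutativeRing
  open Algebra.Properties.Ring ℝ.ring using (-0#≈0#)
  open Algebra.Properties.Semiring.Exp ℝ.semiring using () renaming (_^_ to _^ʳ_)
  open Algebra.Properties.Semiring.Mult ℂR.semiring using () renaming (_×_ to _×ᶜ_)
  module Σᶜ = PartialSums ℂ-commutativeRing
  module Σʳ = PartialSums ℝ.commutativeRing
  module Pᶜ = PowerSeries ℂ-commutativeRing
  module Pʳ = PowerSeries ℝ.commutativeRing
  module Cᶜ = CauchyProduct ℂ-commutativeRing
  module Cʳ = CauchyProduct ℝ.commutativeRing

  real-+ : ∀ a b → real a + real b ≈ real (a ℝ.+ b)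
  real-+ a b = ℝ.refl ,≈ ℝ.+-identityˡ _

  real-* : ∀ a b → real a * real b ≈ real (a ℝ.* b)
  real-* a b = solve 2 (λ a b → a :* b :+ :- (con 0ℤ :* con 0ℤ) := a :* b) ℝ.refl a b
            ,≈ solve 2 (λ a b → a :* con 0ℤ :+ con 0ℤ :* b := con 0ℤ) ℝ.refl a b

  real-cong : ∀ {a b} → a ℝ.≈ b → real a ≈ real b
  real-cong e = e ,≈ ℝ.refl

  real-fromℕ : ∀ n → n ×ᶜ 1# ≈ real (ℝ.fromℕ n)
  real-fromℕ zero    = ℂR.refl
  real-fromℕ (suc n) = ℂR.trans (ℂR.+-congˡ (real-fromℕ n)) (real-+ _ _)

  real-scale : ∀ a z → real a * z ≈ (a ℝ.* re z +i a ℝ.* im z)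
  real-scale a (x +i y) = solve 3 (λ a x y → a :* x :+ :- (con 0ℤ :* y) := a :* x) ℝ.refl a x y
                       ,≈ solve 3 (λ a x y → a :* y :+ con 0ℤ :* x := a :* y) ℝ.refl a x y

  -- A bound on |re z| + |im z|, which unlike the modulus needs no square root and is
  -- still submultiplicative.
  record Bound (z : ℂ) (M : ℝ) : Set (c ⊔ ℓ₁ ⊔ ℓ₂) where
    constructor bound
    field
      {α β} : ℝ
      re≤ : ∣ re z ∣≤ α
      im≤ : ∣ im z ∣≤ β
      sum≈ : α ℝ.+ β ℝ.≈ M

  Bound-cong : ∀ {z w M N} → z ≈ w → M ℝ.≈ N → Bound z M → Bound w N
  Bound-cong (p ,≈ q) e (bound a b s) = bound (abs-cong p ℝ.refl a) (abs-cong q ℝ.refl b) (ℝ.trans s e)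

  Bound-real : ∀ {a} → ℝ.0# ≤ a → Bound (real a) a
  Bound-real p = bound (abs-self p) (abs-0 (≤-reflexive ℝ.refl)) (ℝ.+-identityʳ _)

  Bound-+ : ∀ {z w M N} → Bound z M → Bound w N → Bound (z + w) (M ℝ.+ N)
  Bound-+ (bound a b s) (bound a′ b′ s′) = bound (abs-+ a a′) (abs-+ b b′)
    (ℝ.trans (solve 4 (λ a b c d → a :+ b :+ (c :+ d) := a :+ c :+ (b :+ d)) ℝ.refl _ _ _ _)
        (ℝ.+-cong s s′))

  Bound-* : ∀ {z w M N} → Bound z M → Bound w N → Bound (z * w) (M ℝ.* N)
  Bound-* (bound a b s) (bound a′ b′ s′) = bound (abs-+ (abs-* a a′) (abs-neg (abs-* b b′)))
      (abs-+ (abs-* a b′) (abs-* b a′))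
    (ℝ.trans (solve 4 (λ a b c d → a :* c :+ b :* d :+ (a :* d :+ b :* c) := (a :+ b) :* (c :+ d)) ℝ.refl
        _ _ _ _) (ℝ.*-cong s s′))

  abs-nonneg : ∀ {x a} → ∣ x ∣≤ a → ℝ.0# ≤ a
  abs-nonneg {x} {a} (p , r) = halve-≤ (0≤-cong (solve 2 (λ a x → a :- x :+ (a :+ x) := a :+ a) ℝ.refl a
      x) (0≤+ p r))

  Bound-re : ∀ {z M} → Bound z M → ∣ re z ∣≤ M
  Bound-re (bound {α} {β} a b s) = abs-weaken
      (0≤-⇒≤ (ℝ.trans (solve 2 (λ a b → b := a :+ b :- a) ℝ.refl α β) (ℝ.+-congʳ s)) (abs-nonneg b)) a

  Bound-im : ∀ {z M} → Bound z M → ∣ im z ∣≤ M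
  Bound-im (bound {α} {β} a b s) = abs-weaken
      (0≤-⇒≤ (ℝ.trans (solve 2 (λ a b → a := a :+ b :- b) ℝ.refl α β) (ℝ.+-congʳ s)) (abs-nonneg a)) b

  bounded : ∀ z → ∃[ K ] Bound z (ℝ.fromℕ (suc K))
  bounded (x +i y) = let k , p = abs-bounded x ; l , q = abs-bounded y in
    k ℕ.+ suc l , bound p q (ℝ.sym (fromℕ-+ (suc k) (suc l)))

  Bound-^ : ∀ {z M} → Bound z M → ∀ n → Bound (z ^ n) (M ^ʳ n)
  Bound-^ b zero    = Bound-real (<⇒≤ ℝ.0<1)
  Bound-^ b (suc n) = Bound-* b (Bound-^ b n)

  Bound-Σ : ∀ n {f : ℕ → ℂ} {F : ℕ → ℝ} → (∀ k → Bound (f k) (F k)) → Bound (Σᶜ.Σ< n f) (Σʳ.Σ< n F)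
  Bound-Σ zero    b = Bound-real (≤-reflexive ℝ.refl)
  Bound-Σ (suc n) b = Bound-+ (b 0) (Bound-Σ n (λ k → b (suc k)))

  -- Both remainders obey the subtraction-free recursion `remainder-suc`, along which bounds
  -- propagate. Shortening `n` lengthens `j`, so n + j stays fixed.
  Bound-remainder : ∀ n j {f g : ℕ → ℂ} {F G : ℕ → ℝ} → (∀ k → Bound (f k) (F k)) →
      (∀ k → Bound (g k) (G k)) →
    Bound (Cᶜ.remainder f g n (n ℕ.+ j)) (Cʳ.remainder F G n (n ℕ.+ j))
  Bound-remainder zero    j {f} {g} {F} {G} b d = Bound-cong
      (ℂR.sym (RingIdentities.0*x-0≈0 ℂ-commutativeRing _))
      (ℝ.sym (RingIdentities.0*x-0≈0 ℝ.commutativeRing _)) (Bound-real (≤-reflexive ℝ.refl))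
  Bound-remainder (suc n) j {f} {g} {F} {G} b d =
    Bound-cong (ℂR.sym (Cᶜ.remainder-suc f g n j)) (ℝ.sym (Cʳ.remainder-suc F G n j))
      (Bound-+ (Bound-* (b 0) (Bound-Σ j (λ i → d (suc n ℕ.+ i))))
        (≡.subst (λ m → Bound (Cᶜ.remainder (Pᶜ.shift f) g n m) (Cʳ.remainder (Pʳ.shift F) G n m))
            (ℕₚ.+-suc n j)
          (Bound-remainder n (suc j) (λ k → b (suc k)) d)))

  fromℕᶜ-cancel : ∀ n {x y} → (suc n ×ᶜ 1#) * x ≈ (suc n ×ᶜ 1#) * y → x ≈ y
  fromℕᶜ-cancel n {x} {y} e = fromℕ-cancel n (_≈_.re≈ scaled) ,≈ fromℕ-cancel n (_≈_.im≈ scaled)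
    where
    scale : ∀ x → (suc n ×ᶜ 1#) * x ≈ (ℝ.fromℕ (suc n) ℝ.* re x +i ℝ.fromℕ (suc n) ℝ.* im x)
    scale x = ℂR.trans (ℂR.*-congʳ (real-fromℕ (suc n))) (real-scale _ x)
    scaled = ℂR.trans (ℂR.sym (scale x)) (ℂR.trans e (scale y))

  inverseFactorialsᶜ : InverseFactorials ℂ-commutativeRing
  inverseFactorialsᶜ = record
    { 1/!      = λ n → real (Exp.1/! n)
    ; 1/!-zero = real-cong Exp.1/!-zero
    ; 1/!-suc  = λ n → ℂR.trans (ℂR.*-congʳ (real-fromℕ (suc n))) (ℂR.trans (real-* _ _)
        (real-cong (Exp.1/!-suc n)))
    ; cancel   = fromℕᶜ-cancel
    }

  module Term = ExponentialSeries ℂ-commutativeRing inverseFactorialsᶜ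

  -- Unfolds to the same sum as `expPartialSum`, so estimates for it apply to `IsExp` as they stand.
  partial : ℂ → ℕ → ℂ
  partial z n = Σᶜ.Σ< n (Term.expTerm z)

  Bound-term : ∀ {z M} → Bound z M → ∀ k → Bound (Term.expTerm z k) (Exp.expTerm M k)
  Bound-term b k = Bound-* (Bound-real (Exp.0≤1/! k)) (Bound-^ b k)

  Smallᶜ : (ℕ → ℂ) → Set _
  Smallᶜ u = Small (λ n → re (u n)) × Small (λ n → im (u n))

  ⟶ᶜ-unique : ∀ {u v l m} → Smallᶜ (λ n → u n - v n) → u ⟶ l → v ⟶ m → l ≈ m
  ⟶ᶜ-unique (d , d′) (s , s′) (t , t′) = ⟶-unique d s t ,≈ ⟶-unique d′ s′ t′

  ⟶ᶜ-* : ∀ {u v l m} → u ⟶ l → v ⟶ m → (λ n → u n * v n) ⟶ (l * m)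
  ⟶ᶜ-* (s , s′) (t , t′) = ⟶-+ (⟶-* s t) (⟶-neg (⟶-* s′ t′)) , ⟶-+ (⟶-* s t′) (⟶-* s′ t)

  Smallᶜ-0 : ∀ {u} → (∀ n → u n ≈ 0#) → Smallᶜ u
  Smallᶜ-0 e = small-0 (λ n → _≈_.re≈ (e n)) , small-0 (λ n → _≈_.im≈ (e n))

  exp-cong : ∀ {z z′ w w′} → z ≈ z′ → IsExp z w → IsExp z′ w′ → w ≈ w′
  exp-cong {z} {z′} e = ⟶ᶜ-unique {partial z} {partial z′} (Smallᶜ-0 (λ n →
    ℂR.trans (ℂR.+-congʳ (Σᶜ.Σ<-cong n (λ k _ → Term.expTerm-cong e k))) (ℂR.-‿inverseʳ _)))

  partial-cauchy : ∀ z (f : ℂ → ℝ) → (∀ {x y} → x ≈ y → f x ℝ.≈ f y) →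
      (∀ x y → f (x + y) ℝ.≈ f x ℝ.+ f y) →
    (∀ {x M} → Bound x M → ∣ f x ∣≤ M) → ℝ.IsCauchy (λ n → f (partial z n))
  partial-cauchy z f f-cong f-+ f-bound = isCauchy (λ n → f (partial z n)) λ ε 0<ε →
    let N , small = tail-small ε 0<ε in N , λ n N≤n j → abs-weaken (small n N≤n j) (gap n j)
    where
    K = proj₁ (bounded z)
    open Exp.Tail K
    gap : ∀ n j → ∣ f (partial z (n ℕ.+ j)) ℝ.- f (partial z n) ∣≤ tail n j
    gap n j = abs-cong
      (ℝ.trans (solve 2 (λ s t → t := s :+ t :- s) ℝ.refl (f (partial z n)) (f T))
        (ℝ.+-congʳ (ℝ.sym (ℝ.trans (f-cong (Cᶜ.Σ<-split n j (Term.expTerm z))) (f-+ _ _)))))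
      ℝ.refl (f-bound (Bound-Σ j (λ i → Bound-term (proj₂ (bounded z)) (n ℕ.+ i))))
      where T = Σᶜ.Σ< j (λ i → Term.expTerm z (n ℕ.+ i))

  exp-exists : ∀ z → ∃[ w ] IsExp z w
  exp-exists z =
    let a , p = ℝ.complete (λ n → re (partial z n)) (partial-cauchy z re _≈_.re≈ (λ _ _ → ℝ.refl) Bound-re)
        b , q = ℝ.complete (λ n → im (partial z n)) (partial-cauchy z im _≈_.im≈ (λ _ _ → ℝ.refl)
            Bound-im)
    in (a +i b) , p , q

  -- With real bounds K+1 and L+1 for `z` and `w`, the error is at most that of the two real series.
  -- By `Σ*Σ≤Σ⊗` the latter is at most the sum of `τ k` over n ≤ k < 2n, `τ` belonging to the
  -- parameter (K+1) + (L+1).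
  exp-remainder : ∀ z w → Smallᶜ (λ n → partial z n * partial w n - partial (z + w) n)
  exp-remainder z w = small re Bound-re , small im Bound-im
    where
    K = proj₁ (bounded z)
    L = proj₁ (bounded w)
    open Exp.Tail (K ℕ.+ suc L)
    F = Exp.expTerm (ℝ.fromℕ (suc K))
    G = Exp.expTerm (ℝ.fromℕ (suc L))
    F⊗G : ∀ k → (F Pʳ.⊗ G) k ℝ.≈ τ k
    F⊗G k = ℝ.trans (Exp.expTerm-⊗ _ _ k) (Exp.expTerm-cong (ℝ.sym (fromℕ-+ (suc K) (suc L))) k)
    rem≤ : ∀ n → Cʳ.remainder F G n (n ℕ.+ 0) ≤ tail n n
    rem≤ n rewrite ℕₚ.+-identityʳ n = 0≤-⇒≤ (begin
        Σʳ.Σ< (n ℕ.+ n) (F Pʳ.⊗ G) ℝ.- Σʳ.Σ< n F ℝ.* Σʳ.Σ< n G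
          ≈⟨ ℝ.+-congʳ (ℝ.trans (Σʳ.Σ<-cong (n ℕ.+ n) (λ k _ → F⊗G k)) (Cʳ.Σ<-split n n τ)) ⟩
        Σʳ.Σ< n τ ℝ.+ tail n n ℝ.- Σʳ.Σ< n F ℝ.* Σʳ.Σ< n G
          ≈⟨ solve 4 (λ s t f g → s :+ t :- f :* g := t :- (f :* g :- s)) ℝ.refl _ _ _ _ ⟩
        tail n n ℝ.- (Σʳ.Σ< n F ℝ.* Σʳ.Σ< n G ℝ.- Σʳ.Σ< n τ)
          ≈⟨ ℝ.+-congˡ (ℝ.-‿cong (ℝ.+-congˡ (ℝ.-‿cong (Σʳ.Σ<-cong n (λ k _ → F⊗G k))))) ⟨
        tail n n ℝ.- Cʳ.remainder F G n n ∎)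
      (≤⇒0≤- (Exp.Σ*Σ≤Σ⊗ n n (Exp.0≤expTerm (0≤fromℕ (suc K))) (Exp.0≤expTerm (0≤fromℕ (suc L)))))
      where open Relation.Binary.Reasoning.Setoid ℝ.setoid
    B : ∀ n → Bound (partial z n * partial w n - partial (z + w) n) (Cʳ.remainder F G n (n ℕ.+ 0))
    B n = Bound-cong (ℂR.trans (ℂR.reflexive (≡.cong (Cᶜ.remainder (Term.expTerm z) (Term.expTerm w) n)
        (ℕₚ.+-identityʳ n)))
        (ℂR.+-congˡ (ℂR.-‿cong (Σᶜ.Σ<-cong n (λ k _ → Term.expTerm-⊗ z w k))))) ℝ.refl
      (Bound-remainder n 0 (Bound-term (proj₂ (bounded z))) (Bound-term (proj₂ (bounded w))))
    small : (f : ℂ → ℝ) → (∀ {x M} → Bound x M → ∣ f x ∣≤ M) → Small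
        (λ n → f (partial z n * partial w n - partial (z + w) n))
    small f fb ε 0<ε = let N , t = tail-small ε 0<ε in N , λ n N≤n → abs-weaken
        (≤-trans (rem≤ n) (t n N≤n n)) (fb (B n))

  exp-+ : ∀ {z z′ w w′ v} → IsExp z w → IsExp z′ w′ → IsExp (z + z′) v → v ≈ w * w′
  exp-+ {z} {z′} s t r = ℂR.sym (⟶ᶜ-unique {λ n → partial z n * partial z′ n} {partial (z + z′)}
      (exp-remainder z z′)
    (⟶ᶜ-* {partial z} {partial z′} s t) r)

  conj : ℂ → ℂ
  conj (x +i y) = x +i ℝ.- y

  conj-cong : ∀ {z w} → z ≈ w → conj z ≈ conj w
  conj-cong (p ,≈ q) = p ,≈ ℝ.-‿cong q

  conj-+ : ∀ z w → conj (z + w) ≈ conj z + conj w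
  conj-+ (a +i b) (a′ +i b′) = ℝ.refl ,≈ solve 2 (λ b c → :- (b :+ c) := :- b :+ :- c) ℝ.refl b b′

  conj-* : ∀ z w → conj (z * w) ≈ conj z * conj w
  conj-* (a +i b) (a′ +i b′) =
      solve 4 (λ a b c d → a :* c :+ :- (b :* d) := a :* c :+ :- (:- b :* :- d)) ℝ.refl a b a′ b′
    ,≈ solve 4 (λ a b c d → :- (a :* d :+ b :* c) := a :* :- d :+ :- b :* c) ℝ.refl a b a′ b′

  conj-real : ∀ a → conj (real a) ≈ real a
  conj-real a = ℝ.refl ,≈ -0#≈0#

  conj-^ : ∀ z n → conj (z ^ n) ≈ conj z ^ n
  conj-^ z zero    = conj-real _
  conj-^ z (suc n) = ℂR.trans (conj-* z (z ^ n)) (ℂR.*-congˡ (conj-^ z n))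

  conj-Σ : ∀ n {f g : ℕ → ℂ} → (∀ k → conj (f k) ≈ g k) → conj (Σᶜ.Σ< n f) ≈ Σᶜ.Σ< n g
  conj-Σ zero    e = conj-real _
  conj-Σ (suc n) e = ℂR.trans (conj-+ _ _) (ℂR.+-cong (e 0) (conj-Σ n (λ k → e (suc k))))

  conj-partial : ∀ z n → conj (partial z n) ≈ partial (conj z) n
  conj-partial z n = conj-Σ n (λ k → ℂR.trans (conj-* (real (Exp.1/! k)) (z ^ k))
      (ℂR.*-cong (conj-real (Exp.1/! k)) (conj-^ z k)))

  -- The partial sums have real coefficients and so commute with conjugation.
  exp-conj : ∀ {z w} → IsExp z w → IsExp (conj z) (conj w)
  exp-conj {z} {w} (s , t) =
    ⟶-cong (λ n → _≈_.re≈ (conj-partial z n)) ℝ.refl s ,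
    ⟶-cong (λ n → _≈_.im≈ (conj-partial z n)) ℝ.refl (⟶-neg t)

  exp-0 : IsExp 0# 1#
  exp-0 = ⟶-cong (λ n → ℝ.refl) ℝ.refl (eventually (λ e → _≈_.re≈ e)) , ⟶-cong (λ n → ℝ.refl) ℝ.refl
      (eventually (λ e → _≈_.im≈ e))
    where
    term-suc : ∀ k → Term.expTerm 0# (suc k) ≈ 0#
    term-suc k = ℂR.trans (ℂR.*-congˡ (ℂR.zeroˡ _)) (ℂR.zeroʳ _)
    partial-suc : ∀ n → partial 0# (suc n) ≈ 1#
    partial-suc n = ℂR.trans (ℂR.+-cong (Term.expTerm-0 0#) (Σᶜ.Σ<-zero n (λ k _ → term-suc k)))
        (ℂR.+-identityʳ 1#)
    eventually : ∀ {f : ℂ → ℝ} → (∀ {x y} → x ≈ y → f x ℝ.≈ f y) → (λ n → f (partial 0# n)) ℝ.⟶ f 1#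
    eventually f-cong = small⇒⟶ λ ε 0<ε → 1 , λ { (suc n) _ →
      abs-cong (ℝ.sym (ℝ.trans (ℝ.+-congʳ (f-cong (partial-suc n))) (ℝ.-‿inverseʳ _))) ℝ.refl
          (abs-0 (<⇒≤ 0<ε)) }

-- Roots of unity

module Trigonometry {c ℓ₁ ℓ₂} (R : RealField c ℓ₁ ℓ₂) where
  open Complex R
  open RealOrder R
  open ComplexExponential R using (module ℝ; module ℂR; exp-exists; exp-cong; exp-+; exp-0; exp-conj; conj; conj-cong; real-*)
  open ℝ using () renaming (Carrier to ℝ)
  open IntegerCoefficients ℝ.commutativeRing
  open Algebra.Properties.Ring ℝ.ring using (-0#≈0#; x∙y⁻¹≈ε⇒x≈y)

  abstract
    -- Opaque, so that type checking never unfolds the limit; only `exp-isExp` is visible outside.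
    exp : ℂ → ℂ
    exp z = proj₁ (exp-exists z)

    exp-isExp : ∀ z → IsExp z (exp z)
    exp-isExp z = proj₂ (exp-exists z)

  IsExp-exp : ∀ {z z′ w} → z ≈ z′ → IsExp z w → w ≈ exp z′
  IsExp-exp {z′ = z′} e s = exp-cong e s (exp-isExp z′)

  cis : ℝ → ℂ
  cis x = exp (𝕚 * real x)

  𝕚* : ∀ x → 𝕚 * real x ≈ (ℝ.0# +i x)
  𝕚* x = solve 1 (λ x → con 0ℤ :* x :+ :- (con 1ℤ :* con 0ℤ) := con 0ℤ) ℝ.refl x
      ,≈ solve 1 (λ x → con 0ℤ :* con 0ℤ :+ con 1ℤ :* x := x) ℝ.refl x

  cis-cong : ∀ {x y} → x ℝ.≈ y → cis x ≈ cis y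
  cis-cong {x} {y} e = IsExp-exp (ℂR.*-congˡ {𝕚} (e ,≈ ℝ.refl)) (exp-isExp (𝕚 * real x))

  cis-+ : ∀ x y → cis (x ℝ.+ y) ≈ cis x * cis y
  cis-+ x y = ℂR.trans
    (IsExp-exp {z′ = 𝕚 * real x + 𝕚 * real y}
        (ℂR.trans (ℂR.*-congˡ {𝕚} (ℝ.refl ,≈ ℝ.sym (ℝ.+-identityˡ ℝ.0#))) (ℂR.distribˡ 𝕚 (real x)
        (real y))) (exp-isExp (𝕚 * real (x ℝ.+ y))))
    (exp-+ (exp-isExp (𝕚 * real x)) (exp-isExp (𝕚 * real y)) (exp-isExp (𝕚 * real x + 𝕚 * real y)))

  cis-0 : cis ℝ.0# ≈ 1#
  cis-0 = ℂR.sym (IsExp-exp (ℂR.sym (𝕚* ℝ.0#)) exp-0)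

  cis-neg : ∀ x → cis (ℝ.- x) ≈ conj (cis x)
  cis-neg x = ℂR.sym (IsExp-exp (ℂR.trans (conj-cong (𝕚* x)) (ℂR.sym (𝕚* (ℝ.- x))))
      (exp-conj {𝕚 * real x} {cis x} (exp-isExp (𝕚 * real x))))

  cis-inverse : ∀ x → cis (ℝ.- x) * cis x ≈ 1#
  cis-inverse x = ℂR.trans (ℂR.sym (cis-+ (ℝ.- x) x)) (ℂR.trans (cis-cong (ℝ.-‿inverseˡ x)) cis-0)

  cis-norm : ∀ x → re (cis x) ℝ.* re (cis x) ℝ.+ im (cis x) ℝ.* im (cis x) ℝ.≈ ℝ.1#
  cis-norm x = ℝ.trans (solve 2 (λ a b → a :* a :+ b :* b := a :* a :+ :- (:- b :* b)) ℝ.refl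
      (re (cis x)) (im (cis x)))
    (_≈_.re≈ (ℂR.trans (ℂR.*-congʳ (ℂR.sym (cis-neg x))) (cis-inverse x)))

  cis-×-one : ∀ n {x} → cis x ≈ 1# → cis (ℝ.fromℕ n ℝ.* x) ≈ 1#
  cis-×-one zero    {x} e = ℂR.trans (cis-cong (ℝ.zeroˡ x)) cis-0
  cis-×-one (suc n) {x} e = ℂR.trans
      (cis-cong (ℝ.trans (ℝ.distribʳ x _ _) (ℝ.+-congʳ (ℝ.*-identityˡ x))))
    (ℂR.trans (cis-+ x _) (ℂR.trans (ℂR.*-cong e (cis-×-one n e)) (ℂR.*-identityˡ 1#)))

  cis-ℤ-one : ∀ t {x} → cis x ≈ 1# → cis (ℝ.fromℤ t ℝ.* x) ≈ 1#
  cis-ℤ-one (+ n)    e = cis-×-one n e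
  cis-ℤ-one -[1+ n ] {x} e = begin
    cis (ℝ.- k ℝ.* x)                          ≈⟨ cis-cong (solve 2 (λ k x → :- k :* x := :- (k :* x))
        ℝ.refl k x) ⟩
    cis (ℝ.- (k ℝ.* x))                        ≈⟨ ℂR.*-identityʳ _ ⟨
    cis (ℝ.- (k ℝ.* x)) * 1#                   ≈⟨ ℂR.*-congˡ {cis (ℝ.- (k ℝ.* x))}
        (cis-×-one (suc n) e) ⟨
    cis (ℝ.- (k ℝ.* x)) * cis (k ℝ.* x)        ≈⟨ cis-inverse (k ℝ.* x) ⟩
    1#                                         ∎
    where
    open Relation.Binary.Reasoning.Setoid ℂR.setoid
    k = ℝ.fromℕ (suc n)

  0≤square : ∀ a → ℝ.0# ≤ a ℝ.* a
  0≤square a p = 0≤* ¬a<0 ¬a<0 p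
    where
    ¬a<0 : ¬ (a ℝ.< ℝ.0#)
    ¬a<0 q = <-asym p (ℝ.<-respʳ-≈ (solve 1 (λ a → (con 0ℤ :- a) :* (con 0ℤ :- a) := a :* a) ℝ.refl a)
        (ℝ.*-pos (<⇒0<- q) (<⇒0<- q)))

  -- Multiplication by the conjugate of `z` leaves the norm a² + b², which is positive since b is.
  -- The two solver identities are the real and imaginary parts of this product.
  *-cancel-im : ∀ {z w} → ℝ.0# ℝ.< im z → z * w ≈ 0# → w ≈ 0#
  *-cancel-im {a +i b} {x +i y} 0<b (e ,≈ f) =
    *-cancel-0< 0<norm (ℝ.trans (solve 4 (λ a b x y → (a :* a :+ b :* b) :* x := a :*
        (a :* x :+ :- (b :* y)) :+ b :* (a :* y :+ b :* x)) ℝ.refl a b x y) (vanish a b e f)) ,≈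
    *-cancel-0< 0<norm (ℝ.trans (solve 4 (λ a b x y → (a :* a :+ b :* b) :* y := a :* (a :* y :+ b :* x)
        :+ :- b :* (a :* x :+ :- (b :* y))) ℝ.refl a b x y) (vanish a (ℝ.- b) f e))
    where
    0<norm : ℝ.0# ℝ.< a ℝ.* a ℝ.+ b ℝ.* b
    0<norm = <-≤-trans (ℝ.*-pos 0<b 0<b) (0≤-⇒≤ (solve 2 (λ a b → a := a :+ b :- b) ℝ.refl (a ℝ.* a)
        (b ℝ.* b)) (0≤square a))
    vanish : ∀ u v {s t} → s ℝ.≈ ℝ.0# → t ℝ.≈ ℝ.0# → u ℝ.* s ℝ.+ v ℝ.* t ℝ.≈ ℝ.0#
    vanish u v e f = ℝ.trans (ℝ.+-cong (ℝ.*-congˡ e) (ℝ.*-congˡ f))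
        (solve 2 (λ u v → u :* con 0ℤ :+ v :* con 0ℤ := con 0ℤ) ℝ.refl u v)

  module Pi (π : ℝ) (isPi : IsPi π) where
    0<π : ℝ.0# ℝ.< π
    0<π = proj₁ isPi

    im-cis-π : im (cis π) ℝ.≈ ℝ.0#
    im-cis-π = let w , s , e = proj₁ (proj₂ isPi) in ℝ.trans (ℝ.sym (_≈_.im≈ (IsExp-exp ℂR.refl s))) e

    0<im-cis : ∀ {x} → ℝ.0# ℝ.< x → x ℝ.< π → ℝ.0# ℝ.< im (cis x)
    0<im-cis {x} p q = proj₂ (proj₂ isPi) x (im (cis x)) p q (cis x , exp-isExp (𝕚 * real x) , ℝ.refl)

    -- The square root cis (π/2) of cis π lies on the unit circle and, as its square is
    -- real and its imaginary part positive, on the imaginary axis.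
    cis-π : cis π ≈ - 1#
    cis-π = ℝ.trans (_≈_.re≈ square) re-square ,≈ ℝ.trans im-cis-π (ℝ.sym -0#≈0#)
      where
      a = re (cis (half π))
      b = im (cis (half π))
      square : cis π ≈ cis (half π) * cis (half π)
      square = ℂR.trans (cis-cong (ℝ.sym (half+half π))) (cis-+ (half π) (half π))
      a≈0 : a ℝ.≈ ℝ.0#
      a≈0 = fromℕ-cancel 1 (ℝ.trans (*-cancel-0< (0<im-cis (half-pos 0<π) (half< 0<π))
        (ℝ.trans (solve 2 (λ a b → b :* ((con 1ℤ :+ (con 1ℤ :+ con 0ℤ)) :* a) := a :* b :+ b :* a) ℝ.refl
            a b) (ℝ.trans (ℝ.sym (_≈_.im≈ square)) im-cis-π)))
        (ℝ.sym (ℝ.zeroʳ _)))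
      re-square : a ℝ.* a ℝ.+ ℝ.- (b ℝ.* b) ℝ.≈ ℝ.- ℝ.1#
      re-square = begin
        a ℝ.* a ℝ.+ ℝ.- (b ℝ.* b)                     ≈⟨ solve 2 (λ a b → a :* a :+ :- (b :* b) :=
            (a :+ a) :* a :- (a :* a :+ b :* b)) ℝ.refl a b ⟩
        (a ℝ.+ a) ℝ.* a ℝ.- (a ℝ.* a ℝ.+ b ℝ.* b)     ≈⟨ ℝ.+-cong (ℝ.trans (ℝ.*-congˡ a≈0) (ℝ.zeroʳ _))
            (ℝ.-‿cong (cis-norm (half π))) ⟩
        ℝ.0# ℝ.- ℝ.1#                                 ≈⟨ ℝ.+-identityˡ _ ⟩
        ℝ.- ℝ.1#                                      ∎
        where open Relation.Binary.Reasoning.Setoid ℝ.setoid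

    cis-2π : cis (π ℝ.+ π) ≈ 1#
    cis-2π = ℂR.trans (cis-+ π π) (ℂR.trans (ℂR.*-cong cis-π cis-π)
      (solve 0 (:- con 1ℤ :* :- con 1ℤ :+ :- (:- con 0ℤ :* :- con 0ℤ) := con 1ℤ) ℝ.refl
        ,≈ solve 0 (:- con 1ℤ :* :- con 0ℤ :+ :- con 0ℤ :* :- con 1ℤ := con 0ℤ) ℝ.refl))

    third : ℝ
    third = ℝ.1/ 3 ℝ.* π

    third*3 : third ℝ.+ (third ℝ.+ third) ℝ.≈ π
    third*3 = begin
      third ℝ.+ (third ℝ.+ third)       ≈⟨ solve 2 (λ t p → t :* p :+ (t :* p :+ t :* p) :=
          (con 1ℤ :+ (con 1ℤ :+ (con 1ℤ :+ con 0ℤ))) :* t :* p) ℝ.refl (ℝ.1/ 3) π ⟩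
      ℝ.fromℕ 3 ℝ.* ℝ.1/ 3 ℝ.* π        ≈⟨ ℝ.*-congʳ (1/-inverse 3) ⟩
      ℝ.1# ℝ.* π                        ≈⟨ ℝ.*-identityˡ π ⟩
      π                                 ∎
      where open Relation.Binary.Reasoning.Setoid ℝ.setoid

    0<third : ℝ.0# ℝ.< third
    0<third = ℝ.*-pos (1/-pos 3) 0<π

    third<π : third ℝ.< π
    third<π = 0<-⇒< (ℝ.trans (solve 1 (λ t → t :+ t := t :+ (t :+ t) :- t) ℝ.refl third)
        (ℝ.+-congʳ third*3)) (0<+ 0<third 0<third)

    v : ℂ
    v = cis third

    v³≈-1 : v * (v * v) ≈ - 1#
    v³≈-1 = ℂR.trans (ℂR.*-congˡ {v} (ℂR.sym (cis-+ third third)))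
        (ℂR.trans (ℂR.sym (cis-+ third (third ℝ.+ third)))
      (ℂR.trans (cis-cong third*3) cis-π))

    v-quadratic : v * v - v + 1# ≈ 0#
    v-quadratic = *-cancel-im {v + 1#} (ℝ.<-respʳ-≈ (ℝ.sym (ℝ.+-identityʳ (im v)))
        (0<im-cis 0<third third<π))
      (ℂR.trans (RingIdentities.x³+1 ℂ-commutativeRing v) (ℂR.trans (ℂR.+-congʳ v³≈-1)
          (ℂR.-‿inverseˡ 1#)))

    module Sqrt (√3 : ℝ) (isSqrt : ℝ.IsSqrt (ℝ.fromℕ 3) √3) where
      private
        x = re v
        y = im v
        0<y : ℝ.0# ℝ.< y
        0<y = 0<im-cis 0<third third<π
        h = ℝ.1/ 2

      -- The imaginary part of v² - v + 1 is y(2x - 1), and y > 0 cancels.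
      2x≈1 : ℝ.fromℕ 2 ℝ.* x ℝ.≈ ℝ.1#
      2x≈1 = x∙y⁻¹≈ε⇒x≈y _ _ (*-cancel-0< 0<y (ℝ.trans
        (solve 2 (λ x y → y :* ((con 1ℤ :+ (con 1ℤ :+ con 0ℤ)) :* x :- con 1ℤ) := x :* y :+ y :* x :+
            :- y :+ con 0ℤ) ℝ.refl x y)
        (_≈_.im≈ v-quadratic)))

      -- 4y² = 3 follows from the real part of the quadratic and 2x = 1. The sign of the square root
      -- enters by cancelling the positive factor 2y + √3.
      2y≈√3 : ℝ.fromℕ 2 ℝ.* y ℝ.≈ √3
      2y≈√3 = x∙y⁻¹≈ε⇒x≈y _ _ (*-cancel-0< {ℝ.fromℕ 2 ℝ.* y ℝ.+ √3}
        (<-≤-trans (ℝ.*-pos (ℝ.fromℕ-pos 1) 0<y) (0≤-⇒≤ (solve 2 (λ a s → s := a :+ s :- a) ℝ.refl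
            (ℝ.fromℕ 2 ℝ.* y) √3) (proj₁ isSqrt)))
        (begin
          (two ℝ.* y ℝ.+ √3) ℝ.* (two ℝ.* y ℝ.- √3)
            ≈⟨ solve 3 (λ x y s → let two = con 1ℤ :+ (con 1ℤ :+ con 0ℤ) in (two :* y :+ s) :*
                (two :* y :- s)
                 := :- (two :* two) :* (x :* x :+ :- (y :* y) :+ :- x :+ con 1ℤ) :+ (two :* x :- con 1ℤ)
                     :* (two :* x :- con 1ℤ) :+ (con 1ℤ :+ (con 1ℤ :+ (con 1ℤ :+ con 0ℤ)) :- s :* s))
                     ℝ.refl x y √3 ⟩
          ℝ.- (two ℝ.* two) ℝ.* (x ℝ.* x ℝ.+ ℝ.- (y ℝ.* y) ℝ.+ ℝ.- x ℝ.+ ℝ.1#) ℝ.+ (two ℝ.* x ℝ.- ℝ.1#)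
              ℝ.* (two ℝ.* x ℝ.- ℝ.1#) ℝ.+ (ℝ.fromℕ 3 ℝ.- √3 ℝ.* √3)
            ≈⟨ ℝ.+-cong (ℝ.+-cong (ℝ.*-congˡ (_≈_.re≈ v-quadratic)) (ℝ.*-cong (ℝ.+-congʳ 2x≈1)
                (ℝ.+-congʳ 2x≈1))) (ℝ.+-congˡ (ℝ.-‿cong (proj₂ isSqrt))) ⟩
          ℝ.- (two ℝ.* two) ℝ.* ℝ.0# ℝ.+ (ℝ.1# ℝ.- ℝ.1#) ℝ.* (ℝ.1# ℝ.- ℝ.1#) ℝ.+
              (ℝ.fromℕ 3 ℝ.- ℝ.fromℕ 3)
            ≈⟨ solve 2 (λ a b → a :* con 0ℤ :+ (con 1ℤ :- con 1ℤ) :* (con 1ℤ :- con 1ℤ) :+ (b :- b)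
                := con 0ℤ) ℝ.refl _ _ ⟩
          ℝ.0# ∎))
        where
        open Relation.Binary.Reasoning.Setoid ℝ.setoid
        two = ℝ.fromℕ 2

      halved : ∀ {a b} → ℝ.fromℕ 2 ℝ.* a ℝ.≈ b → h ℝ.* b ℝ.≈ a
      halved {a} {b} e = ℝ.trans (ℝ.*-congˡ (ℝ.sym e)) (ℝ.trans
        (solve 3 (λ h t a → h :* (t :* a) := t :* h :* a) ℝ.refl h (ℝ.fromℕ 2) a)
        (ℝ.trans (ℝ.*-congʳ (1/-inverse 2)) (ℝ.*-identityˡ a)))

      answer : ℤ → ℂ
      answer s = real h * (𝕚 * real √3 * fromℤ s - 1#)

      answer≈ : ∀ s → answer s ≈ (h ℝ.* (ℝ.- ℝ.1#) +i h ℝ.* √3 ℝ.* ℝ.fromℤ s)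
      answer≈ s =
        solve 3 (λ h r t → h :* ((con 0ℤ :* r :+ :- (con 1ℤ :* con 0ℤ)) :* t :+ :-
            ((con 0ℤ :* con 0ℤ :+ con 1ℤ :* r) :* con 0ℤ) :+ :- con 1ℤ)
            :+ :- (con 0ℤ :* (((con 0ℤ :* r :+ :- (con 1ℤ :* con 0ℤ)) :* con 0ℤ :+
                (con 0ℤ :* con 0ℤ :+ con 1ℤ :* r) :* t) :+ :- con 0ℤ))
          := h :* (:- con 1ℤ)) ℝ.refl h √3 (ℝ.fromℤ s)
        ,≈ solve 3 (λ h r t → h :* ((con 0ℤ :* r :+ :- (con 1ℤ :* con 0ℤ)) :* con 0ℤ :+
            (con 0ℤ :* con 0ℤ :+ con 1ℤ :* r) :* t :+ :- con 0ℤ)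
            :+ con 0ℤ :* ((con 0ℤ :* r :+ :- (con 1ℤ :* con 0ℤ)) :* t :+ :-
                ((con 0ℤ :* con 0ℤ :+ con 1ℤ :* r) :* con 0ℤ) :+ :- con 1ℤ)
          := h :* r :* t) ℝ.refl h √3 (ℝ.fromℤ s)

      private
        hr : h ℝ.* ℝ.1# ℝ.≈ x
        hr = halved 2x≈1
        hs : h ℝ.* √3 ℝ.≈ y
        hs = halved 2y≈√3
        v²≈v-1 : v * v ≈ v - 1#
        v²≈v-1 = ℂR.trans (RingIdentities.x²-split ℂ-commutativeRing v)
            (ℂR.trans (ℂR.+-congʳ v-quadratic) (ℂR.+-identityˡ _))

      -- v² = v - 1 by the quadratic, and v = (1 + i√3)/2.
      v²≈answer : v * v ≈ answer 1ℤ
      v²≈answer = ℂR.trans v²≈v-1 (ℂR.trans (re-eq ,≈ im-eq) (ℂR.sym (answer≈ 1ℤ)))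
        where
        re-eq : x ℝ.+ ℝ.- ℝ.1# ℝ.≈ h ℝ.* (ℝ.- ℝ.1#)
        re-eq = ℝ.trans (ℝ.+-congˡ (ℝ.-‿cong (ℝ.trans (ℝ.sym 2x≈1) (ℝ.*-congˡ (ℝ.sym hr)))))
          (ℝ.trans (ℝ.+-congʳ (ℝ.sym hr))
              (solve 1 (λ h → h :* con 1ℤ :+ :- ((con 1ℤ :+ (con 1ℤ :+ con 0ℤ)) :* (h :* con 1ℤ)) := h :*
              :- con 1ℤ) ℝ.refl h))
        im-eq : y ℝ.+ ℝ.- ℝ.0# ℝ.≈ h ℝ.* √3 ℝ.* ℝ.fromℤ 1ℤ
        im-eq = ℝ.trans (ℝ.+-congʳ (ℝ.sym hs)) (solve 1 (λ s → s :+ :- con 0ℤ := s :* (con 1ℤ :+ con 0ℤ))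
            ℝ.refl (h ℝ.* √3))

      -- v⁴ = v·v³ = -v.
      v⁴≈answer : (v * v) * (v * v) ≈ answer -1ℤ
      v⁴≈answer = ℂR.trans (ℂR.*-assoc v v (v * v)) (ℂR.trans (ℂR.*-congˡ {v} v³≈-1)
          (ℂR.trans (re-eq ,≈ im-eq) (ℂR.sym (answer≈ -1ℤ))))
        where
        re-eq : x ℝ.* (ℝ.- ℝ.1#) ℝ.+ ℝ.- (y ℝ.* (ℝ.- ℝ.0#)) ℝ.≈ h ℝ.* (ℝ.- ℝ.1#)
        re-eq = ℝ.trans (ℝ.+-congʳ (ℝ.*-congʳ (ℝ.sym hr)))
            (solve 2 (λ h y → h :* con 1ℤ :* :- con 1ℤ :+ :- (y :* :- con 0ℤ) := h :* :- con 1ℤ) ℝ.refl h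
            y)
        im-eq : x ℝ.* (ℝ.- ℝ.0#) ℝ.+ y ℝ.* (ℝ.- ℝ.1#) ℝ.≈ h ℝ.* √3 ℝ.* ℝ.fromℤ -1ℤ
        im-eq = ℝ.trans (ℝ.+-congˡ (ℝ.*-congʳ (ℝ.sym hs)))
            (solve 2 (λ x s → x :* :- con 0ℤ :+ s :* :- con 1ℤ := s :* :- (con 1ℤ :+ con 0ℤ)) ℝ.refl x
            (h ℝ.* √3))

-- The root of unity e^(2πim/n)

module RootOfUnity {c ℓ₁ ℓ₂} (R : RealField c ℓ₁ ℓ₂) where
  open Complex R
  open RealOrder R
  open ComplexExponential R using (module ℝ; module ℂR; real-*; real-fromℕ)
  open Trigonometry R
  open ℝ using () renaming (Carrier to ℝ)
  open IntegerCoefficients ℝ.commutativeRing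
  open IntegerPolynomials using (module Evaluation)
  module ℂInt = IntegerCoefficients ℂ-commutativeRing
  open Algebra.Properties.Ring ℝ.ring using (-0#≈0#)

  -- `fromℤ` is built on the plain multiple and `int` on the optimised one, so they agree only up to
  -- ring equality.
  fromℤ≈int : ∀ z → ℝ.fromℤ z ℝ.≈ int z
  fromℤ≈int (+ n)    = ×ᵤ≈× n ℝ.1#
    where open Mult′ ℝ.semiring
  fromℤ≈int -[1+ n ] = ℝ.-‿cong (×ᵤ≈× (suc n) ℝ.1#)
    where open Mult′ ℝ.semiring

  fromℤ-+ : ∀ i j → ℝ.fromℤ (i ℤ.+ j) ℝ.≈ ℝ.fromℤ i ℝ.+ ℝ.fromℤ j
  fromℤ-+ i j = ℝ.trans (fromℤ≈int (i ℤ.+ j))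
      (ℝ.trans (int-+ i j) (ℝ.sym (ℝ.+-cong (fromℤ≈int i) (fromℤ≈int j))))

  fromℤ-* : ∀ i j → ℝ.fromℤ (i ℤ.* j) ℝ.≈ ℝ.fromℤ i ℝ.* ℝ.fromℤ j
  fromℤ-* i j = ℝ.trans (fromℤ≈int (i ℤ.* j))
      (ℝ.trans (int-* i j) (ℝ.sym (ℝ.*-cong (fromℤ≈int i) (fromℤ≈int j))))

  fromℤ≈ℂint : ∀ z → fromℤ z ≈ ℂInt.int z
  fromℤ≈ℂint (+ n)    = ℂR.trans (ℂR.sym (real-fromℕ n)) (×ᵤ≈× n 1#)
    where open Mult′ ℂR.semiring
  fromℤ≈ℂint -[1+ n ] = ℂR.trans (ℝ.refl ,≈ ℝ.sym -0#≈0#) (ℂR.-‿cong (fromℤ≈ℂint (+ suc n)))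

  eval≈evaluate : ∀ f z → eval f z ≈ Evaluation.evaluate ℂ-commutativeRing z f
  eval≈evaluate []      z = ℂR.refl
  eval≈evaluate (a ∷ f) z = ℂR.+-cong (fromℤ≈ℂint a) (ℂR.*-congˡ {z} (eval≈evaluate f z))

  module _ (π : ℝ) (isPi : IsPi π) (n : ℕ) .{{n≢0 : NonZero n}} (m : ℤ) where
    open Pi π isPi

    -- Half of the angle 2π/n: for 0 < r < n the multiple r·φ stays between 0 and π, where the sine
    -- is known to be positive. Powers of `q` then appear as squares of `cis (r * φ)`.
    φ : ℝ
    φ = π ℝ.* ℝ.1/ n

    θ : ℝ
    θ = ℝ.fromℕ 2 ℝ.* π ℝ.* ℝ.fromℤ m ℝ.* ℝ.1/ n

    angle : fromℤ (+ 2) * real π * fromℤ m * 𝕚 * real (ℝ.1/ n) ≈ 𝕚 * real θ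
    angle = ℂR.trans (ℂR.trans (RingIdentities.[x*y]*z≈y*[x*z] ℂ-commutativeRing _ 𝕚 _)
        (ℂR.*-congˡ {𝕚} (ℂR.*-congʳ (ℂR.trans (ℂR.*-congʳ (real-* _ _)) (real-* _ _)))))
      (ℂR.*-congˡ {𝕚} (real-* _ _))

    module _ (q : ℂ) (isExp : IsExp (fromℤ (+ 2) * real π * fromℤ m * 𝕚 * real (ℝ.1/ n)) q) where

      q≈cis : q ≈ cis θ
      q≈cis = IsExp-exp angle isExp

      q^ : ∀ j → q ^ j ≈ cis (ℝ.fromℕ j ℝ.* θ)
      q^ zero    = ℂR.sym (ℂR.trans (cis-cong (ℝ.zeroˡ θ)) cis-0)
      q^ (suc j) = ℂR.trans (ℂR.*-cong q≈cis (q^ j)) (ℂR.trans (ℂR.sym (cis-+ θ _))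
        (cis-cong (ℝ.sym (ℝ.trans (ℝ.distribʳ θ _ _) (ℝ.+-congʳ (ℝ.*-identityˡ θ))))))

      -- The multiple `t` of `n` contributes whole turns, which `cis-2π` removes.
      q^-residue : ∀ j r t → + j ℤ.* m ≡ + r ℤ.+ t ℤ.* + n →
        q ^ j ≈ cis (ℝ.fromℕ r ℝ.* φ) * cis (ℝ.fromℕ r ℝ.* φ)
      q^-residue j r t e = begin
        q ^ j                        ≈⟨ q^ j ⟩
        cis (ℝ.fromℕ j ℝ.* θ)        ≈⟨ cis-cong reduce ⟩
        cis (a ℝ.+ a ℝ.+ T ℝ.* (π ℝ.+ π))        ≈⟨ cis-+ (a ℝ.+ a) _ ⟩
        cis (a ℝ.+ a) * cis (T ℝ.* (π ℝ.+ π))    ≈⟨ ℂR.*-cong (cis-+ a a) (cis-ℤ-one t cis-2π) ⟩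
        cis a * cis a * 1#           ≈⟨ ℂR.*-identityʳ _ ⟩
        cis a * cis a                ∎
        where
        a = ℝ.fromℕ r ℝ.* φ
        T = ℝ.fromℤ t
        open Relation.Binary.Reasoning.Setoid ℂR.setoid
        reduce : ℝ.fromℕ j ℝ.* θ ℝ.≈ a ℝ.+ a ℝ.+ T ℝ.* (π ℝ.+ π)
        reduce = R.begin
          ℝ.fromℕ j ℝ.* θ
            R.≈⟨ solve 4 (λ j p m i → j :* ((con 1ℤ :+ (con 1ℤ :+ con 0ℤ)) :* p :* m :* i) :=
                (p :+ p) :* i :* (j :* m)) ℝ.refl (ℝ.fromℕ j) π (ℝ.fromℤ m) (ℝ.1/ n) ⟩
          (π ℝ.+ π) ℝ.* ℝ.1/ n ℝ.* (ℝ.fromℕ j ℝ.* ℝ.fromℤ m)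
            R.≈⟨ ℝ.*-congˡ (ℝ.trans (ℝ.sym (fromℤ-* (+ j) m)) (ℝ.trans (ℝ.reflexive (≡.cong ℝ.fromℤ e))
                (ℝ.trans (fromℤ-+ (+ r) (t ℤ.* + n)) (ℝ.+-congˡ (fromℤ-* t (+ n)))))) ⟩
          (π ℝ.+ π) ℝ.* ℝ.1/ n ℝ.* (ℝ.fromℕ r ℝ.+ T ℝ.* ℝ.fromℕ n)
            R.≈⟨ solve 5 (λ p i r t n → (p :+ p) :* i :* (r :+ t :* n) := r :* (p :* i) :+ r :* (p :* i)
                :+ t :* (n :* i) :* (p :+ p)) ℝ.refl π (ℝ.1/ n) (ℝ.fromℕ r) T (ℝ.fromℕ n) ⟩
          a ℝ.+ a ℝ.+ T ℝ.* (ℝ.fromℕ n ℝ.* ℝ.1/ n) ℝ.* (π ℝ.+ π)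
            R.≈⟨ ℝ.+-congˡ (ℝ.*-congʳ (ℝ.trans (ℝ.*-congˡ (1/-inverse n)) (ℝ.*-identityʳ T))) ⟩
          a ℝ.+ a ℝ.+ T ℝ.* (π ℝ.+ π) R.∎
          where module R = Relation.Binary.Reasoning.Setoid ℝ.setoid

      qⁿ≈1 : q ^ n ≈ 1#
      qⁿ≈1 = ℂR.trans (q^-residue n 0 m (≡.trans (ℤₚ.*-comm (+ n) m) (≡.sym (ℤₚ.+-identityˡ _))))
        (ℂR.trans (ℂR.*-cong cis-0φ cis-0φ) (ℂR.*-identityˡ 1#))
        where
        cis-0φ : cis (ℝ.fromℕ 0 ℝ.* φ) ≈ 1#
        cis-0φ = ℂR.trans (cis-cong (ℝ.zeroˡ φ)) cis-0

      nφ≈π : ℝ.fromℕ n ℝ.* φ ℝ.≈ π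
      nφ≈π = ℝ.trans (solve 3 (λ n p i → n :* (p :* i) := p :* (n :* i)) ℝ.refl (ℝ.fromℕ n) π (ℝ.1/ n))
        (ℝ.trans (ℝ.*-congˡ (1/-inverse n)) (ℝ.*-identityʳ π))

      0<φ : ℝ.0# ℝ.< φ
      0<φ = ℝ.*-pos 0<π (1/-pos n)

      rφ<π : ∀ {r} → r ℕ.< n → ℝ.fromℕ r ℝ.* φ ℝ.< π
      rφ<π {r} r<n with ℕₚ.m≤n⇒∃[o]m+o≡n r<n
      ... | o , e = 0<-⇒< (ℝ.trans (solve 3 (λ r o p → (con 1ℤ :+ o) :* p := ((con 1ℤ :+ r) :+ o) :* p
          :- r :* p) ℝ.refl (ℝ.fromℕ r) (ℝ.fromℕ o) φ)
          (ℝ.+-congʳ (ℝ.trans (ℝ.*-congʳ (ℝ.trans (ℝ.sym (fromℕ-+ (suc r) o))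
              (ℝ.reflexive (≡.cong ℝ.fromℕ e)))) nφ≈π)))
        (ℝ.*-pos (ℝ.fromℕ-pos o) 0<φ)

      module _ (coprime : gcd (+ n) m ≡ 1ℤ) where

        n⊥m : Coprime n ℤ.∣ m ∣
        n⊥m = gcd≡1⇒coprime (ℤₚ.+-injective coprime)

        -- With q^j = w², the factor 1 - q^j is -(w - 1)(w + 1), and both w - 1 and w + 1 have the
        -- imaginary part of `w`. It is positive because the residue of jm modulo `n` is nonzero, by
        -- coprimality.
        regular : ∀ j → 0 ℕ.< j → j ℕ.< n → ∀ x → (1# - q ^ j) * x ≈ 0# → x ≈ 0#
        regular j 0<j j<n x e = *-cancel-im {w + 1#} 0<im⁺ (*-cancel-im {w - 1#} 0<im⁻ (begin
          (w - 1#) * ((w + 1#) * x)  ≈⟨ RingIdentities.[1-x²]y ℂ-commutativeRing w x ⟩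
          - ((1# - w * w) * x)       ≈⟨ ℂR.-‿cong
              (ℂR.*-congʳ (ℂR.+-congˡ {1#}
              (ℂR.-‿cong (q^-residue j r t (a≡a%ℕn+[a/ℕn]*n (+ j ℤ.* m) n))))) ⟨
          - ((1# - q ^ j) * x)       ≈⟨ ℂR.-‿cong e ⟩
          - 0#                       ≈⟨ (-0#≈0# ,≈ -0#≈0#) ⟩
          0#                         ∎))
          where
          open Relation.Binary.Reasoning.Setoid ℂR.setoid
          r = (+ j ℤ.* m) %ℕ n
          t = (+ j ℤ.* m) /ℕ n
          w = cis (ℝ.fromℕ r ℝ.* φ)
          n∤ : r ≡ 0 → ⊥
          n∤ r≡0 = >⇒∤ {{ℕ.>-nonZero 0<j}} j<n
              (coprime-divisor n⊥m (≡.subst (n ∣_) (≡.trans (ℤₚ.abs-* (+ j) m) (ℕₚ.*-comm j ℤ.∣ m ∣))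
            (ℤ∣.∣⇒∣ᵤ {+ n} {+ j ℤ.* m} (ℤ∣.divides t (≡.trans (a≡a%ℕn+[a/ℕn]*n (+ j ℤ.* m) n)
                (≡.trans (≡.cong (λ i → + i ℤ.+ t ℤ.* + n) r≡0) (ℤₚ.+-identityˡ _)))))))
          0<fromℕ : ∀ i → i ≢ 0 → ℝ.0# ℝ.< ℝ.fromℕ i
          0<fromℕ zero    i≢0 = ⊥-elim (i≢0 ≡.refl)
          0<fromℕ (suc i) _   = ℝ.fromℕ-pos i
          0<im : ℝ.0# ℝ.< im w
          0<im = 0<im-cis (ℝ.*-pos (0<fromℕ r n∤) 0<φ) (rφ<π (n%ℕd<d (+ j ℤ.* m) n))
          0<im⁺ : ℝ.0# ℝ.< im w ℝ.+ ℝ.0#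
          0<im⁺ = ℝ.<-respʳ-≈ (ℝ.sym (ℝ.+-identityʳ (im w))) 0<im
          0<im⁻ : ℝ.0# ℝ.< im w ℝ.+ ℝ.- ℝ.0#
          0<im⁻ = ℝ.<-respʳ-≈ (solve 1 (λ y → y := y :+ :- con 0ℤ) ℝ.refl (im w)) 0<im

        module _ (√3 : ℝ) (isSqrt : ℝ.IsSqrt (ℝ.fromℕ 3) √3) (e : ℕ) (n≡ : n ≡ suc e ℕ.* 3) where
          open Sqrt √3 isSqrt

          -- (e + 1)·φ is π/3, since n = 3(e + 1); the proof compares the triples of both angles.
          cis-third : ∀ r → cis (ℝ.fromℕ (suc e ℕ.* r) ℝ.* φ) ≈ cis (ℝ.fromℕ r ℝ.* third)
          cis-third r = cis-cong (fromℕ-cancel 2 (begin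
            ℝ.fromℕ 3 ℝ.* (ℝ.fromℕ (suc e ℕ.* r) ℝ.* φ)        ≈⟨ ℝ.*-congˡ
                (ℝ.*-congʳ (fromℕ-* (suc e) r)) ⟩
            ℝ.fromℕ 3 ℝ.* (ℝ.fromℕ (suc e) ℝ.* ℝ.fromℕ r ℝ.* φ) ≈⟨ solve 4
                (λ k d r p → k :* (d :* r :* p) := r :* (d :* k :* p)) ℝ.refl (ℝ.fromℕ 3)
                (ℝ.fromℕ (suc e)) (ℝ.fromℕ r) φ ⟩
            ℝ.fromℕ r ℝ.* (ℝ.fromℕ (suc e) ℝ.* ℝ.fromℕ 3 ℝ.* φ) ≈⟨ ℝ.*-congˡ
                (ℝ.trans (ℝ.*-congʳ (ℝ.trans (ℝ.sym (fromℕ-* (suc e) 3))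
                (ℝ.reflexive (≡.cong ℝ.fromℕ (≡.sym n≡))))) nφ≈π) ⟩
            ℝ.fromℕ r ℝ.* π                                     ≈⟨ ℝ.*-congˡ third*3 ⟨
            ℝ.fromℕ r ℝ.* (third ℝ.+ (third ℝ.+ third))         ≈⟨ solve 2 (λ r t → r :* (t :+ (t :+ t))
                := (con 1ℤ :+ (con 1ℤ :+ (con 1ℤ :+ con 0ℤ))) :* (r :* t)) ℝ.refl (ℝ.fromℕ r) third ⟩
            ℝ.fromℕ 3 ℝ.* (ℝ.fromℕ r ℝ.* third)                 ∎))
            where open Relation.Binary.Reasoning.Setoid ℝ.setoid

          residue : ∀ r → m %ℕ 3 ≡ r → + suc e ℤ.* m ≡ + (suc e ℕ.* r) ℤ.+ (m /ℕ 3) ℤ.* + n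
          residue r m%3≡r = begin
            + suc e ℤ.* m                                          ≡⟨ ≡.cong (+ suc e ℤ.*_)
                (≡.trans (a≡a%ℕn+[a/ℕn]*n m 3) (≡.cong (λ i → + i ℤ.+ (m /ℕ 3) ℤ.* + 3) m%3≡r)) ⟩
            + suc e ℤ.* (+ r ℤ.+ (m /ℕ 3) ℤ.* + 3)                 ≡⟨ Z.solve 4
                (λ d r t k → d Z.:* (r Z.:+ t Z.:* k) Z.:= d Z.:* r Z.:+ t Z.:* (d Z.:* k)) ≡.refl
                (+ suc e) (+ r) (m /ℕ 3) (+ 3) ⟩
            + suc e ℤ.* + r ℤ.+ (m /ℕ 3) ℤ.* (+ suc e ℤ.* + 3)     ≡⟨ ≡.cong₂
                (λ x y → x ℤ.+ (m /ℕ 3) ℤ.* y) (≡.sym (ℤₚ.pos-* (suc e) r))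
                (≡.trans (≡.sym (ℤₚ.pos-* (suc e) 3)) (≡.cong +_ (≡.sym n≡))) ⟩
            + (suc e ℕ.* r) ℤ.+ (m /ℕ 3) ℤ.* + n                   ∎
            where
            open ≡.≡-Reasoning
            module Z = IntegerCoefficients ℤₚ.+-*-commutativeRing

          -- Writing m = 3t + r gives (n/3)·m = (n/3)·r + t·n, so q^(n/3) is v² for r = 1 and v⁴ for
          -- r = 2.
          q^≈ : ∀ r → m %ℕ 3 ≡ r → q ^ suc e ≈ cis (ℝ.fromℕ r ℝ.* third) * cis (ℝ.fromℕ r ℝ.* third)
          q^≈ r m%3≡r = ℂR.trans (q^-residue (suc e) (suc e ℕ.* r) (m /ℕ 3) (residue r m%3≡r))
              (ℂR.*-cong (cis-third r) (cis-third r))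

          ¬3∣m : m %ℕ 3 ≡ 0 → ⊥
          ¬3∣m m%3≡0 with n⊥m (divides (suc e) n≡ , ℤ∣.∣⇒∣ᵤ {+ 3} {m}
              (ℤ∣.divides (m /ℕ 3) (≡.trans (a≡a%ℕn+[a/ℕn]*n m 3)
              (≡.trans (≡.cong (λ i → + i ℤ.+ (m /ℕ 3) ℤ.* + 3) m%3≡0) (ℤₚ.+-identityˡ _)))))
          ... | ()

          q^≈answer : q ^ suc e ≈ answer (legendre₃ m)
          q^≈answer = cases (m %ℕ 3) ≡.refl (n%ℕd<d m 3)
            where
            cases : ∀ r → m %ℕ 3 ≡ r → r ℕ.< 3 → q ^ suc e ≈ answer (legendre₃ m)
            cases 0 m%3≡r _ = ⊥-elim (¬3∣m m%3≡r)
            cases 1 m%3≡r _ = ℂR.trans (q^≈ 1 m%3≡r) (ℂR.trans (ℂR.*-cong one one)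
              (ℂR.trans v²≈answer (ℂR.reflexive (≡.cong answer (≡.sym (legendre₃-1 m m%3≡r))))))
              where
              one : cis (ℝ.fromℕ 1 ℝ.* third) ≈ v
              one = cis-cong (ℝ.trans (ℝ.*-congʳ (ℝ.+-identityʳ ℝ.1#)) (ℝ.*-identityˡ third))
            cases 2 m%3≡r _ = ℂR.trans (q^≈ 2 m%3≡r) (ℂR.trans (ℂR.*-cong two two)
              (ℂR.trans v⁴≈answer (ℂR.reflexive (≡.cong answer (≡.sym (legendre₃-2 m m%3≡r))))))
              where
              two : cis (ℝ.fromℕ 2 ℝ.* third) ≈ v * v
              two = ℂR.trans (cis-cong (solve 1 (λ t → (con 1ℤ :+ (con 1ℤ :+ con 0ℤ)) :* t := t :+ t)
                  ℝ.refl third)) (cis-+ third third)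
            cases (suc (suc (suc _))) _ (ℕ.s≤s (ℕ.s≤s (ℕ.s≤s ())))

          qCatalan-sum : sum {n} (λ k → q ^ toℕ k * eval (qCatalan (toℕ k)) q) ≈ answer (legendre₃ m)
          qCatalan-sum = ℂR.trans (PartialSums.Σ<-cong ℂ-commutativeRing n {λ k → q ^ k * eval
              (qCatalan k) q}
              (λ k _ → ℂR.*-congˡ {q ^ k} (ℂR.trans (eval≈evaluate (qCatalan k) q)
                  (Evaluation.evaluate-qCatalan ℂ-commutativeRing q k))))
            (ℂR.trans (PrimitiveRoot.Σ-qCat-root ℂ-commutativeRing q n
                (record { qⁿ≈1 = qⁿ≈1 ; regular = regular }) e n≡) q^≈answer)

corollary6p2 : ∀ {c ℓ₁ ℓ₂} →
  ( (R : RealField c ℓ₁ ℓ₂) →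
    let module ℝ = RealField R
        open Complex R
    in (π √3 : ℝ.Carrier) → IsPi π → ℝ.IsSqrt (ℝ.fromℕ 3) √3 →
       (n : ℕ) .{{_ : NonZero n}} (m : ℤ) → gcd (+ n) m ≡ 1ℤ →
       (q : ℂ) → IsExp (fromℤ (+ 2) * real π * fromℤ m * 𝕚 * real (ℝ.1/ n)) q →
       3 ∣ n →
       sum {n} (λ k → q ^ toℕ k * eval (qCatalan (toℕ k)) q)
         ≈ real (ℝ.1/ 2) * (𝕚 * real √3 * fromℤ (legendre₃ m) - 1#) )
  ×
  ( (p : ℕ) → Prime p → (a : ℕ) → 0 ℕ.< a →
    sumℚ {p ℕ.^ a} (λ k → catalan (toℕ k))
      ≡ ½ ℚ.* ((+ 3 ℚ./ 1) ℚ.* (legendre₃ (+ (p ℕ.^ a)) ℚ./ 1) ℚ.- 1ℚ) [modℚ p ] )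
corollary6p2 = part₁ , λ p pp a _ → CatalanCongruence.catalan-sum pp a
  where
  part₁ : ∀ {c ℓ₁ ℓ₂} (R : RealField c ℓ₁ ℓ₂) →
    let module ℝ = RealField R
        open Complex R
    in (π √3 : ℝ.Carrier) → IsPi π → ℝ.IsSqrt (ℝ.fromℕ 3) √3 →
    (n : ℕ) .{{_ : NonZero n}} (m : ℤ) → gcd (+ n) m ≡ 1ℤ →
    (q : ℂ) → IsExp (fromℤ (+ 2) * real π * fromℤ m * 𝕚 * real (ℝ.1/ n)) q →
    3 ∣ n →
    sum {n} (λ k → q ^ toℕ k * eval (qCatalan (toℕ k)) q)
    ≈ real (ℝ.1/ 2) * (𝕚 * real √3 * fromℤ (legendre₃ m) - 1#)
  part₁ R π √3 isPi isSqrt n m coprime q isExp (divides zero n≡0) = ⊥-elim (ℕ.≢-nonZero⁻¹ n n≡0)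
  part₁ R π √3 isPi isSqrt n m coprime q isExp (divides (suc e) n≡) =
    RootOfUnity.qCatalan-sum R π isPi n m q isExp coprime √3 isSqrt e n≡
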